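{- For every real $\alpha >0$ there exists a positive integer $c$ such that, whenever $A$ and $B$ are finite non-empty subsets of $\mathbb{Z}$ with $|A| \geq \alpha |B|$, there exist elements $b_1, b_2, \dots, b_c \in B$ such that $$|A+\{b_1, \dots, b_c\}| \ge |A|+|B|-1.$$
   Context: For subsets $X,Y$ of an abelian group, $X+Y=\{x+y : x\in X, y\in Y\}$. The elements $b_1,\dots,b_c$ are not required to be distinct. -}

module Defs where

open import Data.Empty using (⊥)
open import Data.Integer.Base as ℤ using (ℤ)
import Data.Integer.Properties as ℤ
open import Data.List.Base using (List; length; deduplicate; cartesianProductWith)
open import Data.Nat.Base using (ℕ; zero; suc)
open import Data.Product.Base using (∃-syntax; _×_; _,_)
open import Data.Rational.Base
open import Data.Rational.Properties
open import Data.Sum.Base using (_⊎_; inj₁; inj₂)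
open import Level using (0ℓ)
open import Relation.Binary.Definitions using (tri<; tri≈; tri>)
open import Relation.Binary.PropositionalEquality
open import Relation.Nullary using (contradiction)
open import Relation.Unary using (Pred; Satisfiable; _⊆_)

-- Real numbers as two-sided Dedekind cuts of ℚ: `L q` means q < x and
-- `U q` means x < q.

record ℝ : Set₁ where
  field
    L U         : Pred ℚ 0ℓ
    L-inhabited : Satisfiable L
    U-inhabited : Satisfiable U
    L-down      : ∀ {p q} → p < q → L q → L p
    U-up        : ∀ {p q} → p < q → U p → U q
    L-open      : ∀ {p} → L p → ∃[ q ] p < q × L q
    U-open      : ∀ {q} → U q → ∃[ p ] p < q × U p
    disjoint    : ∀ {q} → L q → U q → ⊥
    located     : ∀ {p q} → p < q → L p ⊎ U q

open ℝ

infix 4 _<ℝ_ _≤ℝ_ _≥ℝ_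

_<ℝ_ : ℝ → ℝ → Set
x <ℝ y = ∃[ q ] U x q × L y q

_≤ℝ_ : ℝ → ℝ → Set
x ≤ℝ y = L x ⊆ L y

_≥ℝ_ : ℝ → ℝ → Set
x ≥ℝ y = y ≤ℝ x

private
  p-1<p : ∀ p → p - 1ℚ < p
  p-1<p p = subst (p - 1ℚ <_) (+-identityʳ p) (+-monoʳ-< p (negative⁻¹ (- 1ℚ)))

  p<p+1 : ∀ p → p < p + 1ℚ
  p<p+1 p = subst (_< p + 1ℚ) (+-identityʳ p) (+-monoʳ-< p (positive⁻¹ 1ℚ))

  split : ∀ {p q} r → p < q → p < r ⊎ r < q
  split {p} r p<q with <-cmp p r
  ... | tri< p<r _ _ = inj₁ p<r
  ... | tri≈ _ refl _ = inj₂ p<q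
  ... | tri> _ _ r<p = inj₂ (<-trans r<p p<q)

fromℚ : ℚ → ℝ
fromℚ r = record
  { L           = _< r
  ; U           = r <_
  ; L-inhabited = r - 1ℚ , p-1<p r
  ; U-inhabited = r + 1ℚ , p<p+1 r
  ; L-down      = <-trans
  ; U-up        = λ p<q r<p → <-trans r<p p<q
  ; L-open      = <-dense
  ; U-open      = λ r<q → let s , r<s , s<q = <-dense r<q in s , s<q , r<s
  ; disjoint    = <-asym
  ; located     = split r
  }

ℕ→ℚ : ℕ → ℚ
ℕ→ℚ n = ℤ.+ n / 1

fromℕ : ℕ → ℝ
fromℕ n = fromℚ (ℕ→ℚ n)

0ℝ : ℝ
0ℝ = fromℕ 0

private
  ℕ→ℚ-pos : ∀ n → Positive (ℕ→ℚ (suc n))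
  ℕ→ℚ-pos n = normalize-pos (suc n) 1

  L<U : ∀ x {p q} → L x p → U x q → p < q
  L<U x {p} {q} Lp Uq with <-cmp p q
  ... | tri< p<q _ _ = p<q
  ... | tri≈ _ refl _ = contradiction Uq (disjoint x Lp)
  ... | tri> _ _ q<p = contradiction (U-up x q<p Uq) (disjoint x Lp)

  module _ (x : ℝ) where

    L·-U·-disjoint : ∀ n {p p′ q} → L x p → q < p * ℕ→ℚ n →
                     U x p′ → p′ * ℕ→ℚ n < q → ⊥
    L·-U·-disjoint zero {p} {p′} _ q<pn _ p′n<q =
      <-asym (subst (_ <_) (*-zeroʳ p) q<pn) (subst (_< _) (*-zeroʳ p′) p′n<q)
    L·-U·-disjoint (suc n) Lp q<pn Up′ p′n<q =
      <-asym (<-trans p′n<q q<pn)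
             (*-monoˡ-<-pos (ℕ→ℚ (suc n)) {{ℕ→ℚ-pos n}} (L<U x Lp Up′))

    ·-located : ∀ n {a b} → a < b →
                (∃[ p ] L x p × a < p * ℕ→ℚ n) ⊎ (∃[ p ] U x p × p * ℕ→ℚ n < b)
    ·-located zero a<b with split 0ℚ a<b
    ... | inj₁ a<0 = let p , Lp = L-inhabited x in
                     inj₁ (p , Lp , subst (_ <_) (sym (*-zeroʳ p)) a<0)
    ... | inj₂ 0<b = let p , Up = U-inhabited x in
                     inj₂ (p , Up , subst (_< _) (sym (*-zeroʳ p)) 0<b)
    ·-located (suc n) {a} {b} a<b = helper (<-dense a<b)
      where
      N = ℕ→ℚ (suc n)
      instance
        N-pos = ℕ→ℚ-pos n
        N-nonZero = pos⇒nonZero N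
        1/N-pos = 1/pos⇒pos N

      ÷-* : ∀ r → r * 1/ N * N ≡ r
      ÷-* r = trans (*-assoc r (1/ N) N)
                    (trans (cong (r *_) (*-inverseˡ N)) (*-identityʳ r))

      helper : ∃[ r ] a < r × r < b →
               (∃[ p ] L x p × a < p * N) ⊎ (∃[ p ] U x p × p * N < b)
      helper (r , a<r , r<b) with <-dense r<b
      ... | s , r<s , s<b with located x (*-monoˡ-<-pos (1/ N) r<s)
      ...   | inj₁ Lr = inj₁ (r * 1/ N , Lr , subst (a <_) (sym (÷-* r)) a<r)
      ...   | inj₂ Us = inj₂ (s * 1/ N , Us , subst (_< b) (sym (÷-* s)) s<b)

infixl 7 _·_

-- The product of a real and a natural number. The strict inequalities
-- (rather than q ≡ p * ℕ→ℚ n) make this correct for n = 0 as well.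
_·_ : ℝ → ℕ → ℝ
x · n = record
  { L           = λ q → ∃[ p ] L x p × q < p * ℕ→ℚ n
  ; U           = λ q → ∃[ p ] U x p × p * ℕ→ℚ n < q
  ; L-inhabited = let p , Lp = L-inhabited x in
                  p * ℕ→ℚ n - 1ℚ , p , Lp , p-1<p _
  ; U-inhabited = let p , Up = U-inhabited x in
                  p * ℕ→ℚ n + 1ℚ , p , Up , p<p+1 _
  ; L-down      = λ { a<b (p , Lp , b<pn) → p , Lp , <-trans a<b b<pn }
  ; U-up        = λ { a<b (p , Up , pn<a) → p , Up , <-trans pn<a a<b }
  ; L-open      = λ { (p , Lp , a<pn) → let r , a<r , r<pn = <-dense a<pn in
                      r , a<r , p , Lp , r<pn }
  ; U-open      = λ { (p , Up , pn<b) → let r , pn<r , r<b = <-dense pn<b in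
                      r , r<b , p , Up , pn<r }
  ; disjoint    = λ { (p , Lp , q<pn) (p′ , Up′ , p′n<q) →
                      L·-U·-disjoint x n Lp q<pn Up′ p′n<q }
  ; located     = ·-located x n
  }

-- A finite subset of ℤ is given by a list of its elements, in which order
-- and repetitions are irrelevant: ∣_∣ counts distinct elements.

FiniteSubset : Set
FiniteSubset = List ℤ

∣_∣ₛ : FiniteSubset → ℕ
∣ X ∣ₛ = length (deduplicate ℤ._≟_ X)

infixl 6 _+ₛ_

_+ₛ_ : FiniteSubset → FiniteSubset → FiniteSubset
_+ₛ_ = cartesianProductWith ℤ._+_

{-# OPTIONS --safe #-}
module Submission where

open import Data.Nat.Base using (ℕ; zero; suc; _+_; _*_; _∸_; _^_; _<_; _≤_; _≥_; z≤n; s≤s; NonZero; >-nonZero; >-nonZero⁻¹; ≢-nonZero; s≤s⁻¹; _⊓_; ≢-nonZero⁻¹)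
import Data.Nat.Properties as ℕ
open import Data.Integer.DivMod using (_%ℕ_; _/ℕ_; n%ℕd<d; a≡a%ℕn+[a/ℕn]*n)
open import Data.Integer.Divisibility.Signed using (_∣?_; divides)
open import Data.Nat.Tactic.RingSolver using () renaming (solve-∀ to ℕ-solve)
open import Data.Integer.Base as ℤ using (ℤ; +_; -[1+_]; 0ℤ; 1ℤ)
import Data.Integer.Properties as ℤ
open import Data.Integer.Tactic.RingSolver using () renaming (solve-∀ to ℤ-solve)
open import Data.List.Base using (List; []; _∷_; _++_; length; map; filter; upTo; tabulate; deduplicate)
import Data.List.Properties as List
open import Data.Nat.ListAction using (sum)
open import Data.List.Membership.Propositional using (_∈_; _∉_; find; lose)
open import Data.List.Membership.Propositional.Properties
open import Data.List.Relation.Unary.Any as Any using (here; there; any?)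
open import Data.List.Relation.Unary.All as All using (All; []; _∷_)
open import Data.List.Relation.Unary.AllPairs using ([]; _∷_)
open import Data.List.Relation.Unary.Unique.Propositional using (Unique)
import Data.List.Relation.Unary.Unique.Propositional.Properties as Unique
open import Data.Product.Base using (∃-syntax; _×_; _,_; proj₁; proj₂)
open import Data.Sum.Base using (_⊎_; inj₁; inj₂; [_,_]′)
open import Data.Empty using (⊥; ⊥-elim)
open import Function.Base using (_∘_; id; case_of_)
open import Relation.Nullary using (Dec; yes; no; ¬_; contradiction; _×-dec_; _⊎-dec_; ¬?)
open import Relation.Nullary.Decidable using (map′; decidable-stable)
open import Relation.Unary using (Decidable)
open import Relation.Binary.PropositionalEquality hiding (J)
open import Algebra.Properties.AbelianGroup ℤ.+-0-abelianGroup using (∙-cancelˡ; ∙-cancelʳ)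
open import Defs
open import Data.List.Relation.Unary.Unique.DecPropositional.Properties ℤ._≟_ using (deduplicate-!)
import Data.List.Membership.DecPropositional ℤ._≟_ as DecMembership
open import Data.List.Relation.Binary.Subset.Propositional using (_⊆_)
open import Relation.Binary.Definitions using (tri<; tri≈; tri>)
open import Data.Nat.DivMod using (_/_; _%_; m/n*n≤m; m≡m%n+[m/n]*n; m%n<n)
open import Data.Fin.Base using (Fin; zero; suc)
open import Data.Rational.Base as ℚ using (ℚ; mkℚ; 0ℚ)
import Data.Rational.Properties as ℚ
open import Data.Rational.Unnormalised.Base as ℚᵘ using (mkℚᵘ)
import Data.Rational.Unnormalised.Properties as ℚᵘ

-- Translate B so that min B = 0 and max B = m, put T = B ∖ {m}, and let S be the set of residues of
-- A modulo m. Since the largest element of each class of A yields a new sum in A + m, the sumset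
-- A + {0, m} has at least ∣A∣ + ∣S∣ elements, so at most e = ∣T∣ - ∣S∣ further ones are needed. Add
-- elements of B greedily as long as one of them contributes e / M new sums. After at most M steps
-- either enough sums are found, or the current sumset Y is saturated.
--
-- If Y is saturated then, up to a small fraction of e, every residue of Y outside S has a single
-- lift to Y, almost every a ∈ A reaches that lift, and hence almost all of A lies in an interval J
-- of length at most m whose residues in Y are almost all in S. Moreover T is almost invariant under
-- the differences of most elements of A. The sets of almost periods of T with error doubled at each
-- step have bounded size, so some W has ∣W + W∣ < 3/2 ∣W∣, and then W - W is a subgroup, generated
-- by some d ∣ m. It follows that d divides B, that T is almost all of dℤ ∩ [0, m), and that A fills
-- most of a long stretch of a progression with difference d.
--
-- It remains to treat d = 1. Shorten the stretch until all its initial and final segments are dense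
-- in A. If it has h holes and B misses g points of [0, m], at most h + g points of the stretch plus
-- [0, m] may be missed. All of them, except for few near the two ends, are hit by a positive
-- proportion of a block of about 4 (h + g) consecutive elements of B, and each single element of a
-- block misses at most h points. So boundedly many elements of boundedly many blocks suffice.

-- The bound |A| + |B| - 1 leaves no room for loss, whereas averaging always leaves some sums
-- uncovered. The room comes from the holes themselves: a stretch of length n in which A has h
-- holes, plus [0, m] of which B misses g points, has m + n possible sums, and only m + n - h - g of
-- them are required. Everything before the last phase serves to reach this situation.
--
-- Residues modulo m make saturation visible. For every x the set x + T has |T| distinct residues,
-- so a saturated Y has almost |T| of them, about e more than A has. Few of the new ones can have
-- two lifts, since second lifts would make Y large enough.
--
-- The ratio 3/2 is Freiman's threshold below which the differences of a finite set form a group.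
-- The real α enters only through a natural k with |B| ≤ k |A|, which converts errors measured in e
-- or |T| into multiples of |A|. The constants are chosen in the order `N` (132, forced by the
-- richness of the final stretch), `depth` (8k doublings of the error), `p` (how typical an element
-- must be) and `M` (the greedy threshold).

private variable
  𝕀 𝕂 : Set
  xs ys : List 𝕀

-- A linear inequality c ≤ d over ℕ follows from a ≤ b as soon as
-- c + b + s ≡ d + a; the identity is then left to the ring solver.
lin : ∀ {a b c d} s → a ≤ b → c + b + s ≡ d + a → c ≤ d
lin {a} {b} {c} {d} s a≤b eq = ℕ.+-cancelʳ-≤ b c d (begin
  c + b      ≤⟨ ℕ.m≤m+n (c + b) s ⟩
  c + b + s  ≡⟨ eq ⟩
  d + a      ≤⟨ ℕ.+-monoʳ-≤ d a≤b ⟩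
  d + b      ∎)
  where open ℕ.≤-Reasoning

linℤ : ∀ {a b c d} → a ℤ.≤ b → c ℤ.- d ≡ a ℤ.- b → c ℤ.≤ d
linℤ a≤b eq = ℤ.i-j≤0⇒i≤j (subst (ℤ._≤ 0ℤ) (sym eq) (ℤ.i≤j⇒i-j≤0 a≤b))

-- Finite sums, counting and double counting

Σ[_] : List 𝕀 → (𝕀 → ℕ) → ℕ
Σ[ xs ] f = sum (map f xs)

Σ-mono : ∀ {f g : 𝕀 → ℕ} (xs : List 𝕀) → (∀ {x} → x ∈ xs → f x ≤ g x) → Σ[ xs ] f ≤ Σ[ xs ] g
Σ-mono []       f≤g = z≤n
Σ-mono (x ∷ xs) f≤g = ℕ.+-mono-≤ (f≤g (here refl)) (Σ-mono xs (f≤g ∘ there))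

Σ-+ : ∀ (f g : 𝕀 → ℕ) xs → Σ[ xs ] (λ x → f x + g x) ≡ Σ[ xs ] f + Σ[ xs ] g
Σ-+ f g []       = refl
Σ-+ f g (x ∷ xs) = trans (cong (_+_ (f x + g x)) (Σ-+ f g xs)) (eq (f x) (g x) _ _)
  where
  eq : ∀ a b c d → a + b + (c + d) ≡ a + c + (b + d)
  eq = ℕ-solve

Σ-const : ∀ c (xs : List 𝕀) → Σ[ xs ] (λ _ → c) ≡ length xs * c
Σ-const c []       = refl
Σ-const c (x ∷ xs) = cong (_+_ c) (Σ-const c xs)

Σ-* : ∀ c (f : 𝕀 → ℕ) xs → Σ[ xs ] (λ x → c * f x) ≡ c * Σ[ xs ] f
Σ-* c f []       = sym (ℕ.*-zeroʳ c)
Σ-* c f (x ∷ xs) = trans (cong (_+_ (c * f x)) (Σ-* c f xs)) (sym (ℕ.*-distribˡ-+ c (f x) _))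

Σ-swap : ∀ (f : 𝕀 → 𝕂 → ℕ) xs ys → Σ[ xs ] (λ x → Σ[ ys ] (f x)) ≡ Σ[ ys ] (λ y → Σ[ xs ] (λ x → f x y))
Σ-swap f []       ys = sym (trans (Σ-const 0 ys) (ℕ.*-zeroʳ (length ys)))
Σ-swap f (x ∷ xs) ys = trans (cong (_+_ (Σ[ ys ] (f x))) (Σ-swap f xs ys)) (sym (Σ-+ (f x) _ ys))

Σ-max : ∀ (f : 𝕀 → ℕ) x xs → ∃[ y ] y ∈ x ∷ xs × Σ[ x ∷ xs ] f ≤ length (x ∷ xs) * f y
Σ-max f x []        = x , here refl , ℕ.≤-refl
Σ-max f x (x′ ∷ xs) with Σ-max f x′ xs
... | y , y∈ , le with ℕ.≤-total (f x) (f y)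
...   | inj₁ fx≤fy = y , there y∈ , ℕ.+-mono-≤ fx≤fy le
...   | inj₂ fy≤fx = x , here refl , ℕ.+-monoʳ-≤ (f x) (ℕ.≤-trans le (ℕ.*-monoʳ-≤ (length (x′ ∷ xs)) fy≤fx))

⟦_⟧ : Dec 𝕂 → ℕ
⟦ yes _ ⟧ = 1
⟦ no _ ⟧  = 0

⟦⟧-mono : ∀ {A B : Set} (A? : Dec A) (B? : Dec B) → (A → B) → ⟦ A? ⟧ ≤ ⟦ B? ⟧
⟦⟧-mono (yes a) (yes b) f = ℕ.≤-refl
⟦⟧-mono (yes a) (no ¬b) f = contradiction (f a) ¬b
⟦⟧-mono (no ¬a) B?      f = z≤n

⟦⟧-∪ : ∀ {A B C : Set} (A? : Dec A) (B? : Dec B) (C? : Dec C) → (A → B ⊎ C) → ⟦ A? ⟧ ≤ ⟦ B? ⟧ + ⟦ C? ⟧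
⟦⟧-∪ (no ¬a) B?      C?      f = z≤n
⟦⟧-∪ (yes a) (yes b) C?      f = s≤s z≤n
⟦⟧-∪ (yes a) (no ¬b) (yes c) f = s≤s z≤n
⟦⟧-∪ (yes a) (no ¬b) (no ¬c) f = [ ⊥-elim ∘ ¬b , ⊥-elim ∘ ¬c ]′ (f a)

⟦⟧-∩ : ∀ {A B C D : Set} (A? : Dec A) (B? : Dec B) (C? : Dec C) (D? : Dec D) →
       (A → C) → (B → C) → (A → B → D) → ⟦ A? ⟧ + ⟦ B? ⟧ ≤ ⟦ C? ⟧ + ⟦ D? ⟧
⟦⟧-∩ (no ¬a) B?      C? D? f g h = ℕ.≤-trans (⟦⟧-mono B? C? g) (ℕ.m≤m+n _ _)
⟦⟧-∩ (yes a) (no ¬b) C? D? f g h = ℕ.≤-trans (⟦⟧-mono (yes a) C? f) (ℕ.m≤m+n _ _)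
⟦⟧-∩ (yes a) (yes b) C? D? f g h = ℕ.+-mono-≤ (⟦⟧-mono (yes a) C? f) (⟦⟧-mono (yes b) D? (h a))

-- Pigeonhole along a relation, since partners usually come from existential statements. The partner
-- of the head is removed from `ys`; injectivity of `R` ensures that no later element asks for it.
length-rel : {R : 𝕀 → 𝕂 → Set} → Unique xs →
             (∀ {x} → x ∈ xs → ∃[ y ] y ∈ ys × R x y) →
             (∀ {x x′ y} → x ∈ xs → x′ ∈ xs → R x y → R x′ y → x ≡ x′) → length xs ≤ length ys
length-rel []       f inj = z≤n
length-rel {xs = x ∷ xs} {R = R} (x∉ ∷ uniq) f inj with f (here refl)
... | y , y∈ , xRy with ∈-∃++ y∈
... | ys₁ , ys₂ , refl = ℕ.≤-trans (s≤s (length-rel uniq g (λ p q → inj (there p) (there q)))) (ℕ.≤-reflexive (sym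
      (trans (List.length-++ ys₁) (trans (ℕ.+-suc _ _) (cong suc (sym (List.length-++ ys₁)))))))
  where
  g : ∀ {x′} → x′ ∈ xs → ∃[ y′ ] y′ ∈ ys₁ ++ ys₂ × R x′ y′
  g x′∈ with f (there x′∈)
  ... | y′ , y′∈ , r with ∈-++⁻ ys₁ y′∈
  ...   | inj₁ p           = y′ , ∈-++⁺ˡ p , r
  ...   | inj₂ (there p)   = y′ , ∈-++⁺ʳ ys₁ p , r
  ...   | inj₂ (here refl) = contradiction (inj (here refl) (there x′∈) xRy r) (All.lookup x∉ x′∈)

abstract

  -- A sum of indicators, so that double counting is an exchange of sums. It is abstract so that
  -- later goals mention counts and not their unfoldings.
  # : {P : 𝕀 → Set} → Decidable P → List 𝕀 → ℕ
  # P? xs = Σ[ xs ] (λ x → ⟦ P? x ⟧)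

  #-filter : ∀ {P : 𝕀 → Set} (P? : Decidable P) xs → # P? xs ≡ length (filter P? xs)
  #-filter P? []       = refl
  #-filter P? (x ∷ xs) with P? x
  ... | yes _ = cong suc (#-filter P? xs)
  ... | no _  = #-filter P? xs

  #-mono : ∀ {P Q : 𝕀 → Set} (P? : Decidable P) (Q? : Decidable Q) xs → (∀ {x} → x ∈ xs → P x → Q x) → # P? xs ≤ # Q? xs
  #-mono P? Q? xs f = Σ-mono xs (λ {x} x∈ → ⟦⟧-mono (P? x) (Q? x) (f x∈))

  #-∪ : ∀ {P Q V : 𝕀 → Set} (P? : Decidable P) (Q? : Decidable Q) (V? : Decidable V) xs →
        (∀ {x} → x ∈ xs → P x → Q x ⊎ V x) → # P? xs ≤ # Q? xs + # V? xs
  #-∪ P? Q? V? xs f = ℕ.≤-trans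
    (Σ-mono xs (λ {x} x∈ → ⟦⟧-∪ (P? x) (Q? x) (V? x) (f x∈)))
    (ℕ.≤-reflexive (Σ-+ _ _ xs))

  -- Inclusion-exclusion as an inequality. With an upper bound on `V` it forces two large sets to
  -- overlap; with `W` empty it gives additivity of disjoint sets.
  #-∩ : ∀ {P Q V W : 𝕀 → Set} (P? : Decidable P) (Q? : Decidable Q) (V? : Decidable V) (W? : Decidable W) xs →
        (∀ {x} → x ∈ xs → P x → V x) → (∀ {x} → x ∈ xs → Q x → V x) → (∀ {x} → x ∈ xs → P x → Q x → W x) →
        # P? xs + # Q? xs ≤ # V? xs + # W? xs
  #-∩ P? Q? V? W? xs f g h = begin
    # P? xs + # Q? xs                        ≡⟨ Σ-+ _ _ xs ⟨
    Σ[ xs ] (λ x → ⟦ P? x ⟧ + ⟦ Q? x ⟧)      ≤⟨ Σ-mono xs (λ {x} x∈ → ⟦⟧-∩ (P? x) (Q? x) (V? x) (W? x) (f x∈) (g x∈) (h x∈)) ⟩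
    Σ[ xs ] (λ x → ⟦ V? x ⟧ + ⟦ W? x ⟧)      ≡⟨ Σ-+ _ _ xs ⟩
    # V? xs + # W? xs                        ∎
    where open ℕ.≤-Reasoning

  #-++ : ∀ {P : 𝕀 → Set} (P? : Decidable P) xs ys → # P? (xs ++ ys) ≡ # P? xs + # P? ys
  #-++ P? []       ys = refl
  #-++ P? (x ∷ xs) ys = trans (cong (_+_ ⟦ P? x ⟧) (#-++ P? xs ys)) (sym (ℕ.+-assoc ⟦ P? x ⟧ _ _))

  #-¬ : ∀ {P : 𝕀 → Set} (P? : Decidable P) xs → # P? xs + # (¬? ∘ P?) xs ≡ length xs
  #-¬ P? []       = refl
  #-¬ P? (x ∷ xs) with P? x
  ... | yes _ = cong suc (#-¬ P? xs)
  ... | no _  = trans (ℕ.+-suc _ _) (cong suc (#-¬ P? xs))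

  #-all : ∀ {P : 𝕀 → Set} (P? : Decidable P) xs → (∀ {x} → x ∈ xs → P x) → length xs ≤ # P? xs
  #-all P? []       f = z≤n
  #-all P? (x ∷ xs) f with P? x
  ... | yes _ = s≤s (#-all P? xs (f ∘ there))
  ... | no ¬p = contradiction (f (here refl)) ¬p

  #-≤length : ∀ {P : 𝕀 → Set} (P? : Decidable P) xs → # P? xs ≤ length xs
  #-≤length P? xs = ℕ.≤-trans (ℕ.m≤m+n _ _) (ℕ.≤-reflexive (#-¬ P? xs))

  #-find : ∀ {P : 𝕀 → Set} (P? : Decidable P) xs → 1 ≤ # P? xs → ∃[ x ] x ∈ xs × P x
  #-find P? (x ∷ xs) le with P? x
  ... | yes p = x , here refl , p
  ... | no _  = let y , y∈ , py = #-find P? xs le in y , there y∈ , py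

  -- Markov's inequality without division. It bounds bad residues, atypical elements and almost
  -- periods, and drives the averaging in `Cover`.
  Σ-# : ∀ {P : 𝕀 → Set} (P? : Decidable P) (f : 𝕀 → ℕ) c xs → (∀ {x} → x ∈ xs → P x → c ≤ f x) → # P? xs * c ≤ Σ[ xs ] f
  Σ-# P? f c []       h = z≤n
  Σ-# P? f c (x ∷ xs) h with P? x
  ... | yes p = ℕ.+-mono-≤ (h (here refl) p) (Σ-# P? f c xs (h ∘ there))
  ... | no _  = ℕ.≤-trans (Σ-# P? f c xs (h ∘ there)) (ℕ.m≤n+m _ (f x))

  #-swap : ∀ {𝕀 𝕂 : Set} {Q : 𝕀 → 𝕂 → Set} (Q? : ∀ x → Decidable (Q x)) xs ys →
           Σ[ xs ] (λ x → # (Q? x) ys) ≡ Σ[ ys ] (λ y → # (λ x → Q? x y) xs)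
  #-swap Q? = Σ-swap (λ x y → ⟦ Q? x y ⟧)

  #-none : ∀ {P : 𝕀 → Set} (P? : Decidable P) xs → (∀ {x} → x ∈ xs → ¬ P x) → # P? xs ≤ 0
  #-none P? []       f = z≤n
  #-none P? (x ∷ xs) f with P? x
  ... | yes p = contradiction p (f (here refl))
  ... | no _  = #-none P? xs (f ∘ there)

  #-rel : {P : 𝕀 → Set} {Q : 𝕂 → Set} (P? : Decidable P) (Q? : Decidable Q) (R : 𝕀 → 𝕂 → Set) → Unique xs →
          (∀ {x} → x ∈ xs → P x → ∃[ y ] y ∈ ys × Q y × R x y) →
          (∀ {x x′ y} → x ∈ xs → P x → x′ ∈ xs → P x′ → R x y → R x′ y → x ≡ x′) → # P? xs ≤ # Q? ys
  #-rel {xs = xs} {ys = ys} P? Q? R uniq f inj = subst₂ _≤_ (sym (#-filter P? xs)) (sym (#-filter Q? ys))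
    (length-rel {R = R} (Unique.filter⁺ P? uniq)
      (λ x∈ → let x∈xs , px = ∈-filter⁻ P? x∈
                  y , y∈ , qy , r = f x∈xs px
              in y , ∈-filter⁺ Q? y∈ qy , r)
      (λ p q → let p₁ , p₂ = ∈-filter⁻ P? p
                   q₁ , q₂ = ∈-filter⁻ P? q in inj p₁ p₂ q₁ q₂))

#-disjoint : ∀ {P Q V : 𝕀 → Set} (P? : Decidable P) (Q? : Decidable Q) (V? : Decidable V) xs →
             (∀ {x} → x ∈ xs → P x → V x) → (∀ {x} → x ∈ xs → Q x → V x) → (∀ {x} → x ∈ xs → P x → Q x → ⊥) →
             # P? xs + # Q? xs ≤ # V? xs
#-disjoint P? Q? V? xs f g h = ℕ.≤-trans (#-∩ P? Q? V? (λ _ → no id) xs f g h)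
  (ℕ.≤-trans (ℕ.+-monoʳ-≤ (# V? xs) (#-none (λ _ → no id) xs (λ _ → id))) (ℕ.≤-reflexive (ℕ.+-identityʳ _)))

-- Congruences and intervals

infix 4 _<′_ _≈_[mod_]

-- The strict order as a weak inequality, so that `linℤ` handles both kinds.
_<′_ : ℤ → ℤ → Set
x <′ y = 1ℤ ℤ.+ x ℤ.≤ y

≰⇒<′ : ∀ {x y} → ¬ (x ℤ.≤ y) → y <′ x
≰⇒<′ x≰y = ℤ.i<j⇒suc[i]≤j (ℤ.≰⇒> x≰y)

<′-irrefl : ∀ {x y} → x <′ y → ¬ (y ℤ.≤ x)
<′-irrefl p q = ℤ.<-irrefl refl (ℤ.suc[i]≤j⇒i<j (ℤ.≤-trans p q))

abstract
  _<′?_ : ∀ x y → Dec (x <′ y)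
  x <′? y = (1ℤ ℤ.+ x) ℤ.≤? y

-- A record rather than an abbreviation, so that x, y and m can be inferred from a proof.
record _≈_[mod_] (x y : ℤ) (m : ℕ) : Set where
  constructor by
  field
    quotient : ℤ
    equality : x ≡ y ℤ.+ quotient ℤ.* + m

module _ {m : ℕ} where

  private
    infix 4 _≈_
    _≈_ : ℤ → ℤ → Set
    x ≈ y = x ≈ y [mod m ]

  ≈-refl : ∀ {x} → x ≈ x
  ≈-refl {x} = by 0ℤ (sym (trans (cong (ℤ._+_ x) (ℤ.*-zeroˡ (+ m))) (ℤ.+-identityʳ x)))

  ≈-+ : ∀ {x y x′ y′} → x ≈ y → x′ ≈ y′ → x ℤ.+ x′ ≈ y ℤ.+ y′
  ≈-+ {y = y} {y′ = y′} (by q refl) (by q′ refl) = by (q ℤ.+ q′) (eq y y′ q q′ (+ m))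
    where
    eq : ∀ y y′ q q′ m → (y ℤ.+ q ℤ.* m) ℤ.+ (y′ ℤ.+ q′ ℤ.* m) ≡ (y ℤ.+ y′) ℤ.+ (q ℤ.+ q′) ℤ.* m
    eq = ℤ-solve

  ≈-neg : ∀ {x y} → x ≈ y → ℤ.- x ≈ ℤ.- y
  ≈-neg {y = y} (by q refl) = by (ℤ.- q) (eq y q (+ m))
    where
    eq : ∀ y q m → ℤ.- (y ℤ.+ q ℤ.* m) ≡ ℤ.- y ℤ.+ (ℤ.- q) ℤ.* m
    eq = ℤ-solve

  -- A congruence depends only on the difference of its sides; every rearrangement is thus reduced
  -- to an identity for the ring solver.
  ≈-by : ∀ {x y x′ y′} → x ≈ y → x′ ℤ.- y′ ≡ x ℤ.- y → x′ ≈ y′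
  ≈-by {x} {y} {x′} {y′} (by q eq) eq′ = by q (begin
    x′                             ≡⟨ e₁ x′ y′ ⟩
    y′ ℤ.+ (x′ ℤ.- y′)             ≡⟨ cong (ℤ._+_ y′) (trans eq′ (cong (ℤ._- y) eq)) ⟩
    y′ ℤ.+ (y ℤ.+ q ℤ.* + m ℤ.- y) ≡⟨ e₂ y y′ (q ℤ.* + m) ⟩
    y′ ℤ.+ q ℤ.* + m               ∎)
    where
    open ≡-Reasoning
    e₁ : ∀ x y → x ≡ y ℤ.+ (x ℤ.- y)
    e₁ = ℤ-solve
    e₂ : ∀ y y′ z → y′ ℤ.+ (y ℤ.+ z ℤ.- y) ≡ y′ ℤ.+ z
    e₂ = ℤ-solve

  ≈-sym : ∀ {x y} → x ≈ y → y ≈ x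
  ≈-sym {x} {y} p = ≈-by (≈-neg p) (eq x y)
    where
    eq : ∀ x y → y ℤ.- x ≡ ℤ.- x ℤ.- ℤ.- y
    eq = ℤ-solve

  ≈-trans : ∀ {x y z} → x ≈ y → y ≈ z → x ≈ z
  ≈-trans {x} {y} {z} p q = ≈-by (≈-+ p q) (eq x y z)
    where
    eq : ∀ x y z → x ℤ.- z ≡ (x ℤ.+ y) ℤ.- (y ℤ.+ z)
    eq = ℤ-solve

  ≈-+ʳ : ∀ {x y} w → x ≈ y → x ℤ.+ w ≈ y ℤ.+ w
  ≈-+ʳ w p = ≈-+ p ≈-refl

  ≈-+ˡ : ∀ {x y} w → x ≈ y → w ℤ.+ x ≈ w ℤ.+ y
  ≈-+ˡ w p = ≈-+ (≈-refl {w}) p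

  ≈-cancelʳ : ∀ {x y} w → x ℤ.+ w ≈ y ℤ.+ w → x ≈ y
  ≈-cancelʳ {x} {y} w p = ≈-by p (eq x y w)
    where
    eq : ∀ x y w → x ℤ.- y ≡ (x ℤ.+ w) ℤ.- (y ℤ.+ w)
    eq = ℤ-solve

  ≈-m : ∀ x → x ℤ.+ + m ≈ x
  ≈-m x = by 1ℤ (cong (ℤ._+_ x) (sym (ℤ.*-identityˡ (+ m))))

  -- Each of the two bounds rules out the quotients of one sign, which leaves 0. This is the source
  -- of the injectivity statements for residues, for `T` and for `J`.
  ≈-window : ∀ {x y} → x ≈ y → x <′ y ℤ.+ + m → y <′ x ℤ.+ + m → x ≡ y
  ≈-window {y = y} (by (+ zero) refl) _ _ = trans (cong (ℤ._+_ y) (ℤ.*-zeroˡ (+ m))) (ℤ.+-identityʳ y)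
  ≈-window {y = y} (by (+ suc n) refl) p _ = ⊥-elim (<′-irrefl p
    (linℤ {0ℤ} {+ n ℤ.* + m} (subst (0ℤ ℤ.≤_) (ℤ.pos-* n m) (ℤ.+≤+ z≤n)) (eq y (+ n) (+ m))))
    where
    eq : ∀ y n m → y ℤ.+ m ℤ.- (y ℤ.+ (1ℤ ℤ.+ n) ℤ.* m) ≡ 0ℤ ℤ.- n ℤ.* m
    eq = ℤ-solve
  ≈-window {y = y} (by -[1+ n ] refl) _ p = ⊥-elim (<′-irrefl p
    (linℤ {0ℤ} {+ n ℤ.* + m} (subst (0ℤ ℤ.≤_) (ℤ.pos-* n m) (ℤ.+≤+ z≤n))
      (eq y (+ n) (+ m))))
    where
    eq : ∀ y n m → y ℤ.+ (ℤ.- (1ℤ ℤ.+ n)) ℤ.* m ℤ.+ m ℤ.- y ≡ 0ℤ ℤ.- n ℤ.* m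
    eq = ℤ-solve

  -- Translation by w, read modulo m, keeps distinct classes distinct, so injectivity modulo m has
  -- to be checked on the source alone.
  #-mod : {P Q : ℤ → Set} (P? : Decidable P) (Q? : Decidable Q) {xs ys : List ℤ} → Unique xs →
          (∀ {x x′} → x ∈ xs → P x → x′ ∈ xs → P x′ → x ≈ x′ → x ≡ x′) →
          ∀ w → (∀ {x} → x ∈ xs → P x → ∃[ y ] y ∈ ys × Q y × y ≈ x ℤ.+ w) → # P? xs ≤ # Q? ys
  #-mod P? Q? uniq inj w f = #-rel P? Q? (λ x y → y ≈ x ℤ.+ w) uniq f
    (λ x∈ px x′∈ px′ r r′ → inj x∈ px x′∈ px′ (≈-cancelʳ w (≈-trans (≈-sym r) r′)))

abstract
  ≈-dec : ∀ m x y → Dec (x ≈ y [mod m ])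
  ≈-dec m x y = map′ (λ { (divides q eq) → by q (trans (e₁ x y) (cong (ℤ._+_ y) eq)) })
                     (λ { (by q refl) → divides q (e₂ y (q ℤ.* + m)) }) (+ m ∣? (x ℤ.- y))
    where
    e₁ : ∀ x y → x ≡ y ℤ.+ (x ℤ.- y)
    e₁ = ℤ-solve
    e₂ : ∀ y z → y ℤ.+ z ℤ.- y ≡ z
    e₂ = ℤ-solve

ival : ℤ → ℕ → List ℤ
ival l n = map (λ i → l ℤ.+ + i) (upTo n)

length-ival : ∀ l n → length (ival l n) ≡ n
length-ival l n = trans (List.length-map _ (upTo n)) (List.length-upTo n)

ival-unique : ∀ l n → Unique (ival l n)
ival-unique l n = Unique.map⁺ (λ {i} {j} eq → ℤ.+-injective (∙-cancelˡ l (+ i) (+ j) eq)) (Unique.upTo⁺ n)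

∈-ival⁻ : ∀ {x l n} → x ∈ ival l n → l ℤ.≤ x × x <′ l ℤ.+ + n
∈-ival⁻ {x} {l} {n} x∈ with ∈-map⁻ _ x∈
... | i , i∈ , refl = ℤ.i≤i+j l (+ i) , linℤ (ℤ.+≤+ (∈-upTo⁻ i∈)) (eq l (+ i) (+ n))
  where
  eq : ∀ l i n → 1ℤ ℤ.+ (l ℤ.+ i) ℤ.- (l ℤ.+ n) ≡ (1ℤ ℤ.+ i) ℤ.- n
  eq = ℤ-solve

∈-ival⁺ : ∀ {x l n} → l ℤ.≤ x → x <′ l ℤ.+ + n → x ∈ ival l n
∈-ival⁺ {x} {l} {n} l≤x x<l+n = subst (_∈ ival l n) (trans (cong (ℤ._+_ l) i≡) (e₁ x l)) (∈-map⁺ _ (∈-upTo⁺ i<n))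
  where
  e₁ : ∀ x l → l ℤ.+ (x ℤ.- l) ≡ x
  e₁ = ℤ-solve
  e₂ : ∀ x l n → (1ℤ ℤ.+ (x ℤ.- l)) ℤ.- n ≡ 1ℤ ℤ.+ x ℤ.- (l ℤ.+ n)
  e₂ = ℤ-solve
  i≡ : + ℤ.∣ x ℤ.- l ∣ ≡ x ℤ.- l
  i≡ = ℤ.0≤i⇒+∣i∣≡i (ℤ.i≤j⇒0≤j-i l≤x)
  i<n : ℤ.∣ x ℤ.- l ∣ < n
  i<n = ℤ.drop‿+≤+ (subst (λ z → 1ℤ ℤ.+ z ℤ.≤ + n) (sym i≡) (linℤ x<l+n (e₂ x l (+ n))))

residues : ℕ → List ℤ
residues = ival 0ℤ

residues-inj : ∀ {m x x′} → x ∈ residues m → x′ ∈ residues m → x ≈ x′ [mod m ] → x ≡ x′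
residues-inj {m} x∈ x′∈ x≈x′ with ∈-ival⁻ {l = 0ℤ} x∈ | ∈-ival⁻ {l = 0ℤ} x′∈
... | a , b | a′ , b′ = ≈-window x≈x′
  (ℤ.≤-trans b (ℤ.+-monoˡ-≤ (+ m) a′)) (ℤ.≤-trans b′ (ℤ.+-monoˡ-≤ (+ m) a))

residue : ∀ m .{{_ : NonZero m}} x → ∃[ r ] r ∈ residues m × r ≈ x [mod m ]
residue m x = + (x %ℕ m) , ∈-ival⁺ {l = 0ℤ} (ℤ.+≤+ z≤n) (ℤ.+≤+ (n%ℕd<d x m)) , ≈-sym (by (x /ℕ m) (a≡a%ℕn+[a/ℕn]*n x m))

module _ {m : ℕ} .{{_ : NonZero m}} where

  #-residues : {P Q : ℤ → Set} (P? : Decidable P) (Q? : Decidable Q) {xs : List ℤ} → Unique xs →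
    (∀ {x x′} → x ∈ xs → P x → x′ ∈ xs → P x′ → x ≈ x′ [mod m ] → x ≡ x′) →
    (∀ {x y} → x ≈ y [mod m ] → Q x → Q y) →
    ∀ w → (∀ {x} → x ∈ xs → P x → Q (x ℤ.+ w)) → # P? xs ≤ # Q? (residues m)
  #-residues P? Q? uniq inj resp w f = #-mod P? Q? uniq inj w
    (λ {x} x∈ px → let r , r∈ , r≈ = residue m (x ℤ.+ w) in r , r∈ , resp (≈-sym r≈) (f x∈ px) , r≈)

Res : ℕ → List ℤ → ℤ → Set
Res m ys x = ∃[ y ] y ∈ ys × y ≈ x [mod m ]

abstract
  Res? : ∀ m ys → Decidable (Res m ys)
  Res? m ys x = map′ find (λ (_ , y∈ , p) → lose y∈ p) (any? (λ y → ≈-dec m y x) ys)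

Res-resp : ∀ {m ys x x′} → x ≈ x′ [mod m ] → Res m ys x → Res m ys x′
Res-resp x≈x′ (y , y∈ , y≈) = y , y∈ , ≈-trans y≈ x≈x′

abstract
  infix 4 _∈?_
  _∈?_ : (x : ℤ) (xs : List ℤ) → Dec (x ∈ xs)
  _∈?_ = DecMembership._∈?_

-- Sumsets and their greedy enlargement

sums : List ℤ → List ℤ → List ℤ
sums A bs = deduplicate ℤ._≟_ (A +ₛ bs)

sums-unique : ∀ A bs → Unique (sums A bs)
sums-unique A bs = deduplicate-! (A +ₛ bs)

∈-sums⁺ : ∀ {A bs a b} → a ∈ A → b ∈ bs → a ℤ.+ b ∈ sums A bs
∈-sums⁺ a∈ b∈ = ∈-deduplicate⁺ ℤ._≟_ (∈-cartesianProductWith⁺ ℤ._+_ a∈ b∈)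

∈-sums⁻ : ∀ A bs {x} → x ∈ sums A bs → ∃[ a ] ∃[ b ] a ∈ A × b ∈ bs × x ≡ a ℤ.+ b
∈-sums⁻ A bs x∈ = ∈-cartesianProductWith⁻ ℤ._+_ A bs (∈-deduplicate⁻ ℤ._≟_ (A +ₛ bs) x∈)

sums-mono : ∀ A {bs bs′} → bs ⊆ bs′ → sums A bs ⊆ sums A bs′
sums-mono A {bs} bs⊆ x∈ with ∈-sums⁻ A bs x∈
... | a , b , a∈ , b∈ , refl = ∈-sums⁺ a∈ (bs⊆ b∈)

⊆-length : ∀ {xs ys : List ℤ} → Unique xs → xs ⊆ ys → length xs ≤ length ys
⊆-length uniq xs⊆ys = length-rel {R = _≡_} uniq (λ x∈ → _ , xs⊆ys x∈ , refl) (λ { _ _ refl refl → refl })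

gain : List ℤ → List ℤ → ℤ → ℕ
gain A ys b = # (λ x → ¬? (x ℤ.+ b ∈? ys)) A

sums-gain : ∀ {A} → Unique A → ∀ bs b → length (sums A bs) + gain A (sums A bs) b ≤ length (sums A (b ∷ bs))
sums-gain {A} uA bs b = begin
  length Y + gain A Y b                       ≤⟨ ℕ.+-mono-≤ old new ⟩
  # (_∈? Y) Y′ + # (λ x → ¬? (x ∈? Y)) Y′     ≡⟨ #-¬ (_∈? Y) Y′ ⟩
  length Y′                                   ∎
  where
  open ℕ.≤-Reasoning
  Y  = sums A bs
  Y′ = sums A (b ∷ bs)
  old : length Y ≤ # (_∈? Y) Y′
  old = ℕ.≤-trans (#-all (_∈? Y) Y id) (#-rel (_∈? Y) (_∈? Y) _≡_ (sums-unique A bs)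
    (λ x∈ _ → _ , sums-mono A there x∈ , x∈ , refl) (λ { _ _ _ _ refl refl → refl }))
  new : gain A Y b ≤ # (λ x → ¬? (x ∈? Y)) Y′
  new = #-rel _ _ (λ x y → y ≡ x ℤ.+ b) uA
    (λ x∈ ∉ → _ , ∈-sums⁺ x∈ (here refl) , ∉ , refl)
    (λ { _ _ _ _ refl eq → ∙-cancelʳ b _ _ eq })

module _ {A : List ℤ} (uA : Unique A) (B : List ℤ) (M e : ℕ) where

  -- Each b that is added has M times its gain at least e, so f additions are worth f e / M new
  -- sums. For f = M this is the whole deficit e; stopping early means saturation.
  greedy : ∀ f bs → bs ⊆ B → ∃[ bs′ ] bs′ ⊆ B × bs ⊆ bs′ × length bs′ ≤ f + length bs ×
    (M * length (sums A bs) + f * e ≤ M * length (sums A bs′) ⊎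
     (∀ {b} → b ∈ B → M * gain A (sums A bs′) b ≤ e))
  greedy zero    bs bs⊆ = bs , bs⊆ , id , ℕ.≤-refl , inj₁ (ℕ.≤-reflexive (ℕ.+-identityʳ _))
  greedy (suc f) bs bs⊆ with any? (λ b → e ℕ.≤? M * gain A (sums A bs) b) B
  ... | no ¬p = bs , bs⊆ , id , ℕ.m≤n+m _ _ , inj₂ (λ b∈ → ℕ.≰⇒≥ (λ le → ¬p (lose b∈ le)))
  ... | yes p with find p
  ...   | b , b∈ , e≤ with greedy f (b ∷ bs) (λ { (here refl) → b∈ ; (there b∈) → bs⊆ b∈ })
  ...     | bs′ , sub , sup , len , inj₂ sat = bs′ , sub , sup ∘ there , ℕ.≤-trans len (ℕ.≤-reflexive (ℕ.+-suc f _)) , inj₂ sat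
  ...     | bs′ , sub , sup , len , inj₁ grow = bs′ , sub , sup ∘ there , ℕ.≤-trans len (ℕ.≤-reflexive (ℕ.+-suc f _)) , inj₁ (begin
    M * length (sums A bs) + (e + f * e)                             ≤⟨ ℕ.+-monoʳ-≤ (M * length (sums A bs)) (ℕ.+-monoˡ-≤ (f * e) e≤) ⟩
    M * length (sums A bs) + (M * gain A (sums A bs) b + f * e)      ≡⟨ eq M _ _ (f * e) ⟩
    M * (length (sums A bs) + gain A (sums A bs) b) + f * e          ≤⟨ ℕ.+-monoˡ-≤ (f * e) (ℕ.*-monoʳ-≤ M (sums-gain uA bs b)) ⟩
    M * length (sums A (b ∷ bs)) + f * e                             ≤⟨ grow ⟩
    M * length (sums A bs′)                                          ∎)
    where
    open ℕ.≤-Reasoning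
    eq : ∀ M x y z → M * x + (M * y + z) ≡ M * (x + y) + z
    eq = ℕ-solve

module _ {_≼_ : ℤ → ℤ → Set} (≼-refl : ∀ {x} → x ≼ x) (≼-trans : ∀ {x y z} → x ≼ y → y ≼ z → x ≼ z)
         (≼-total : ∀ x y → x ≼ y ⊎ y ≼ x) {P : ℤ → Set} (P? : Decidable P) where

  extremum : ∀ {x ys} → x ∈ ys → P x → ∃[ y ] y ∈ ys × P y × (∀ {z} → z ∈ ys → P z → y ≼ z)
  extremum {x} {y ∷ ys} x∈ px with any? P? ys
  ... | no ¬any with x∈
  ...   | there x∈ys = contradiction (lose x∈ys px) ¬any
  ...   | here refl  = x , here refl , px , λ { (here refl) _ → ≼-refl ; (there z∈) pz → contradiction (lose z∈ pz) ¬any }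
  extremum {x} {y ∷ ys} x∈ px | yes any with find any
  ... | w , w∈ , pw with extremum w∈ pw | P? y
  ...   | z , z∈ , pz , ext | no ¬py = z , there z∈ , pz , λ { (here refl) py → contradiction py ¬py ; (there u∈) → ext u∈ }
  ...   | z , z∈ , pz , ext | yes py with ≼-total y z
  ...     | inj₁ y≼z = y , here refl , py , λ { (here refl) _ → ≼-refl ; (there u∈) pu → ≼-trans y≼z (ext u∈ pu) }
  ...     | inj₂ z≼y = z , there z∈ , pz , λ { (here refl) _ → z≼y ; (there u∈) pu → ext u∈ pu }

module _ {P : ℤ → Set} (P? : Decidable P) where

  minimum : ∀ {x ys} → x ∈ ys → P x → ∃[ y ] y ∈ ys × P y × (∀ {z} → z ∈ ys → P z → y ℤ.≤ z)
  minimum = extremum ℤ.≤-refl ℤ.≤-trans ℤ.≤-total P?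

  maximum : ∀ {x ys} → x ∈ ys → P x → ∃[ y ] y ∈ ys × P y × (∀ {z} → z ∈ ys → P z → z ℤ.≤ y)
  maximum = extremum ℤ.≤-refl (λ p q → ℤ.≤-trans q p) (λ x y → ℤ.≤-total y x) P?

-- Saturated sumsets

module Lifts
  (m : ℕ) .{{_ : NonZero m}} (A Y : List ℤ) (uA : Unique A)
  (A⊆Y : ∀ {x} → x ∈ A → x ∈ Y)
  (A+m⊆Y : ∀ {x} → x ∈ A → x ℤ.+ + m ∈ Y)
  where

  private
    infix 4 _≈_
    _≈_ : ℤ → ℤ → Set
    x ≈ y = x ≈ y [mod m ]

  a χ : ℕ
  R : List ℤ
  R = residues m
  a = length A

  -- `Two` means at least two lifts to `Y`, expressed through one that is not the largest, because
  -- largest lifts are what `a+χ+double≤∣Y∣` counts separately.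
  S X Nontop Two : ℤ → Set
  S = Res m A
  X = Res m Y
  Nontop y = ∃[ y′ ] y′ ∈ Y × y′ ≈ y × y <′ y′
  Two x = ∃[ y ] y ∈ Y × y ≈ x × Nontop y

  S? : Decidable S
  S? = Res? m A

  X? : Decidable X
  X? = Res? m Y

  Nontop? : Decidable Nontop
  Nontop? y = map′ find (λ (_ , y∈ , h) → lose y∈ h) (any? (λ y′ → ≈-dec m y′ y ×-dec (y <′? y′)) Y)

  Two? : Decidable Two
  Two? x = map′ find (λ (_ , y∈ , h) → lose y∈ h) (any? (λ y → ≈-dec m y x ×-dec Nontop? y) Y)

  χ = # X? R

  double : ℕ
  double = # (λ x → ¬? (S? x) ×-dec Two? x) R

  y<y+m : ∀ y → y <′ y ℤ.+ + m
  y<y+m y = linℤ {1ℤ} {+ m} (ℤ.+≤+ (>-nonZero⁻¹ m)) (eq y (+ m))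
    where
    eq : ∀ y m → (1ℤ ℤ.+ y) ℤ.- (y ℤ.+ m) ≡ 1ℤ ℤ.- m
    eq = ℤ-solve

  top : ∀ {y} → y ∈ Y → ∃[ y′ ] y′ ∈ Y × ¬ Nontop y′ × y′ ≈ y
  top {y} y∈ with maximum (λ z → ≈-dec m z y) y∈ ≈-refl
  ... | y′ , y′∈ , y′≈y , max = y′ , y′∈ , (λ (z , z∈ , z≈ , lt) → <′-irrefl lt (max z∈ (≈-trans z≈ y′≈y))) , y′≈y

  -- Three disjoint parts of `Y`: the set `A`, none of whose elements is a largest lift because A +
  -- m lies in `Y`; the largest lift of each residue; and a lower lift outside `A` for each residue
  -- counted by `double`.
  a+χ+double≤∣Y∣ : a + (χ + double) ≤ length Y
  a+χ+double≤∣Y∣ = begin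
    a + (χ + double)                                                  ≤⟨ ℕ.+-mono-≤ inA (ℕ.≤-trans (ℕ.+-mono-≤ tops nontops) out) ⟩
    # (_∈? A) Y + # (λ y → ¬? (y ∈? A)) Y                             ≡⟨ #-¬ (_∈? A) Y ⟩
    length Y                                                          ∎
    where
    open ℕ.≤-Reasoning
    inA : a ≤ # (_∈? A) Y
    inA = ℕ.≤-trans (#-all (_∈? A) A id) (#-rel _ _ _≡_ uA (λ x∈ _ → _ , A⊆Y x∈ , x∈ , refl) (λ { _ _ _ _ refl refl → refl }))
    tops : χ ≤ # (λ y → ¬? (Nontop? y)) Y
    tops = #-rel _ _ (λ x y → y ≈ x) (ival-unique 0ℤ m)
      (λ { _ (y , y∈ , y≈x) → let y′ , y′∈ , ¬nt , y′≈y = top y∈ in y′ , y′∈ , ¬nt , ≈-trans y′≈y y≈x })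
      (λ x∈ _ x′∈ _ r r′ → residues-inj x∈ x′∈ (≈-trans (≈-sym r) r′))
    nontops : double ≤ # (λ y → ¬? (y ∈? A) ×-dec Nontop? y) Y
    nontops = #-rel _ _ (λ x y → y ≈ x) (ival-unique 0ℤ m)
      (λ { _ (¬s , y , y∈ , y≈x , nt) → y , y∈ , ((λ y∈A → ¬s (y , y∈A , y≈x)) , nt) , y≈x })
      (λ x∈ _ x′∈ _ r r′ → residues-inj x∈ x′∈ (≈-trans (≈-sym r) r′))
    out : # (λ y → ¬? (Nontop? y)) Y + # (λ y → ¬? (y ∈? A) ×-dec Nontop? y) Y ≤ # (λ y → ¬? (y ∈? A)) Y
    out = #-disjoint _ _ _ Y
      (λ {y} _ ¬nt y∈A → ¬nt (_ , A+m⊆Y y∈A , ≈-m y , y<y+m y))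
      (λ _ → proj₁)
      (λ _ ¬nt (_ , nt) → ¬nt nt)

-- T fills the multiples of d in [0, m) up to few gaps, and A fills most of a long stretch of x₀ + dℤ.
record ArithmeticStructure (N k m : ℕ) (A T : List ℤ) : Set where
  field
    d m′ gaps n    : ℕ
    x₀ l           : ℤ
    {{d≢0}}        : NonZero d
    m≡m′d          : m ≡ m′ * d
    d∣T            : ∀ {b} → b ∈ T → b ≈ 0ℤ [mod d ]
    m′≤2t          : m′ ≤ 2 * length T
    m′≤t+gaps      : m′ ≤ length T + gaps
    gaps-small     : N * gaps ≤ length A
    1-small        : N * 1 ≤ length A
    n≤m′           : n ≤ m′
    many           : N * length A ≤ N * # (λ z → x₀ ℤ.+ z ℤ.* + d ∈? A) (ival l n) + 2 * length A
    few            : N * # (λ z → ¬? (x₀ ℤ.+ z ℤ.* + d ∈? A)) (ival l n) ≤ 4 * length A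

-- T is B without its maximum m, e is the excess of ∣T∣ over the number of residues of A, and Y is a
-- set of sums A + bs that no element of B enlarges by more than e / M.
record Saturation : Set where
  field
    m k N p depth M q e : ℕ
    A T Y               : List ℤ
    {{m≢0}}             : NonZero m
    uA                  : Unique A
    uT                  : Unique T
    T-range             : ∀ {b} → b ∈ T → 0ℤ ℤ.≤ b × b <′ + m
    0∈T                 : 0ℤ ∈ T
    A⊆Y                 : ∀ {x} → x ∈ A → x ∈ Y
    A+m⊆Y               : ∀ {x} → x ∈ A → x ℤ.+ + m ∈ Y
    t≡s+e               : length T ≡ # (Res? m A) (residues m) + e
    e>0                 : 0 < e
    small               : length Y < length A + length T
    saturated           : ∀ {b} → b ∈ T → M * gain A Y b ≤ e
    t≤ka                : length T ≤ k * length A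
    q≡2N                : q ≡ N * 2
    N-large             : 16 ≤ N
    depth-large         : 4 * k * 2 ^ depth < 3 ^ depth
    p-large             : N * (2 ^ (2 + depth) * k) ≤ p
    M-large             : (q + 2) * k < M
    M-large₁            : N * (p * k) ≤ M
    M-large₂            : N * ((q + 2) * (k * k)) ≤ M

module Saturated (σ : Saturation) where

  open Saturation σ

  private
    infix 4 _≈_
    _≈_ : ℤ → ℤ → Set
    x ≈ y = x ≈ y [mod m ]

  open Lifts m A Y uA A⊆Y A+m⊆Y public

  t : ℕ
  t = length T

  T-inj : ∀ {b b′} → b ∈ T → b′ ∈ T → b ≈ b′ → b ≡ b′
  T-inj b∈ b′∈ p with T-range b∈ | T-range b′∈
  ... | l , u | l′ , u′ = ≈-window p
    (ℤ.≤-trans u (ℤ.+-monoˡ-≤ (+ m) l′))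
    (ℤ.≤-trans u′ (ℤ.+-monoˡ-≤ (+ m) l))

  tp : ℤ → ℕ
  tp x = # (λ b → ¬? (x ℤ.+ b ∈? Y)) T

  t≡ : ∀ x → # (λ b → x ℤ.+ b ∈? Y) T + tp x ≡ t
  t≡ x = #-¬ (λ b → x ℤ.+ b ∈? Y) T

  error : ℕ
  error = Σ[ A ] tp

  M*error≤te : M * error ≤ t * e
  M*error≤te = begin
    M * error                          ≡⟨ cong (_*_ M) (#-swap (λ x b → ¬? (x ℤ.+ b ∈? Y)) A T) ⟩
    M * Σ[ T ] (gain A Y)              ≡⟨ Σ-* M (gain A Y) T ⟨
    Σ[ T ] (λ b → M * gain A Y b)      ≤⟨ Σ-mono T saturated ⟩
    Σ[ T ] (λ _ → e)                   ≡⟨ Σ-const e T ⟩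
    t * e                              ∎
    where open ℕ.≤-Reasoning

  M*error≤kea : M * error ≤ k * e * a
  M*error≤kea = ℕ.≤-trans M*error≤te (ℕ.≤-trans (ℕ.*-monoˡ-≤ e t≤ka) (ℕ.≤-reflexive (eq k a e)))
    where
    eq : ∀ k a e → k * a * e ≡ k * e * a
    eq = ℕ-solve

  #-X-translate : ∀ x → # (λ b → X? (x ℤ.+ b)) T ≤ χ
  #-X-translate x = #-residues (λ b → X? (x ℤ.+ b)) X? uT (λ b∈ _ b′∈ _ → T-inj b∈ b′∈) Res-resp x
    (λ {b} _ → subst X (ℤ.+-comm x b))

  t≤χ+tp : ∀ x → t ≤ χ + tp x
  t≤χ+tp x = begin
    t                                          ≡⟨ t≡ x ⟨
    # (λ b → x ℤ.+ b ∈? Y) T + tp x            ≤⟨ ℕ.+-monoˡ-≤ (tp x) (ℕ.≤-trans (#-mono _ _ T (λ _ y∈ → _ , y∈ , ≈-refl)) (#-X-translate x)) ⟩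
    χ + tp x                                   ∎
    where open ℕ.≤-Reasoning

  χ+double<t : χ + double < t
  χ+double<t = ℕ.+-cancelˡ-< a _ _ (ℕ.≤-<-trans a+χ+double≤∣Y∣ small)

  χ≤t : χ ≤ t
  χ≤t = ℕ.≤-trans (ℕ.m≤m+n χ double) (ℕ.<⇒≤ χ+double<t)

  u : ℕ
  u = t ∸ χ

  χ+u≡t : χ + u ≡ t
  χ+u≡t = ℕ.m+[n∸m]≡n χ≤t

  double<u : double < u
  double<u = ℕ.+-cancelˡ-< χ _ _ (subst (χ + double <_) (sym χ+u≡t) χ+double<t)

  t>0 : 0 < t
  t>0 = ∈-length 0∈T

  a>0 : 0 < a
  a>0 = ℕ.n≢0⇒n>0 λ a≡0 → ℕ.<⇒≱ t>0 (ℕ.≤-trans t≤ka (ℕ.≤-reflexive (trans (cong (_*_ k) a≡0) (ℕ.*-zeroʳ k))))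

  instance
    a≢0 : NonZero a
    a≢0 = >-nonZero a>0

  -- For each x in `A` the t residues of x + T cannot all be among the χ residues of `Y`, so x
  -- misses at least u sums. Summed over `A`, this is part of `error`.
  M*u≤ke : M * u ≤ k * e
  M*u≤ke = ℕ.*-cancelʳ-≤ (M * u) (k * e) a (ℕ.≤-trans (ℕ.≤-trans (ℕ.≤-reflexive (ℕ.*-assoc M u a)) (ℕ.*-monoʳ-≤ M u*a≤error)) M*error≤kea)
    where
    u*a≤error : u * a ≤ error
    u*a≤error = subst (_≤ error) (trans (Σ-const u A) (ℕ.*-comm a u))
      (Σ-mono A (λ {x} _ → ℕ.+-cancelˡ-≤ χ _ _ (subst (_≤ χ + tp x) (sym χ+u≡t) (t≤χ+tp x))))

  -- Hits, misses and the interval J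

  Hit : ℤ → ℤ → Set
  Hit r x = ∃[ b ] b ∈ T × x ℤ.+ b ∈ Y × x ℤ.+ b ≈ r

  Hit? : ∀ r → Decidable (Hit r)
  Hit? r x = map′ find (λ (_ , b∈ , h) → lose b∈ h) (any? (λ b → (x ℤ.+ b ∈? Y) ×-dec ≈-dec m (x ℤ.+ b) r) T)

  MissX? : ∀ r → Decidable (λ x → X r × ¬ Hit r x)
  MissX? r x = X? r ×-dec ¬? (Hit? r x)

  misses : ℤ → ℕ
  misses r = # (MissX? r) A

  -- Each x reaches at least t - tp x of the χ ≤ t residues of `Y`, and therefore misses at most tp
  -- x of them.
  Σmisses≤error : Σ[ R ] misses ≤ error
  Σmisses≤error = begin
    Σ[ R ] misses                             ≡⟨ #-swap MissX? R A ⟩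
    Σ[ A ] (λ x → # (λ r → MissX? r x) R)     ≤⟨ Σ-mono A (λ {x} _ → pointwise x) ⟩
    error                                     ∎
    where
    open ℕ.≤-Reasoning
    pointwise : ∀ x → # (λ r → MissX? r x) R ≤ tp x
    pointwise x = ℕ.+-cancelˡ-≤ (# (λ b → x ℤ.+ b ∈? Y) T) _ _ (begin
      # (λ b → x ℤ.+ b ∈? Y) T + # (λ r → MissX? r x) R    ≤⟨ ℕ.+-monoˡ-≤ _ hits ⟩
      # (λ r → Hit? r x) R + # (λ r → MissX? r x) R        ≤⟨ #-disjoint _ _ X? R (λ { _ (b , b∈ , y∈ , y≈) → _ , y∈ , y≈ }) (λ _ → proj₁) (λ _ h (_ , ¬h) → ¬h h) ⟩
      χ                                                    ≤⟨ χ≤t ⟩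
      t                                                    ≡⟨ t≡ x ⟨
      # (λ b → x ℤ.+ b ∈? Y) T + tp x                      ∎)
      where
      hits : # (λ b → x ℤ.+ b ∈? Y) T ≤ # (λ r → Hit? r x) R
      hits = #-residues _ _ uT (λ b∈ _ b′∈ _ → T-inj b∈ b′∈)
        (λ { r≈ (b , b∈ , y∈ , y≈) → b , b∈ , y∈ , ≈-trans y≈ r≈ }) x
        (λ {b} b∈ y∈ → b , b∈ , y∈ , subst (x ℤ.+ b ≈_) (ℤ.+-comm x b) ≈-refl)

  Bad : ℤ → Set
  Bad r = a < q * misses r

  Bad? : Decidable Bad
  Bad? r = a ℕ.<? q * misses r

  M*bad≤qke : M * # Bad? R ≤ q * (k * e)
  M*bad≤qke = ℕ.*-cancelʳ-≤ _ _ a (begin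
    M * # Bad? R * a                          ≡⟨ ℕ.*-assoc M _ a ⟩
    M * (# Bad? R * a)                        ≤⟨ ℕ.*-monoʳ-≤ M (Σ-# Bad? (λ r → q * misses r) a R (λ _ → ℕ.<⇒≤)) ⟩
    M * Σ[ R ] (λ r → q * misses r)           ≡⟨ cong (_*_ M) (Σ-* q misses R) ⟩
    M * (q * Σ[ R ] misses)                   ≤⟨ ℕ.*-monoʳ-≤ M (ℕ.*-monoʳ-≤ q Σmisses≤error) ⟩
    M * (q * error)                           ≡⟨ e₁ M q error ⟩
    q * (M * error)                           ≤⟨ ℕ.*-monoʳ-≤ q M*error≤kea ⟩
    q * (k * e * a)                           ≡⟨ ℕ.*-assoc q (k * e) a ⟨
    q * (k * e) * a                           ∎)
    where
    open ℕ.≤-Reasoning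
    e₁ : ∀ x y z → x * (y * z) ≡ y * (x * z)
    e₁ = ℕ-solve

  -- G: new residues with a single lift, which almost every a ∈ A reaches; F: the other new residues.
  G F : ℤ → Set
  G x = X x × ¬ S x × ¬ Two x × ¬ Bad x
  F x = X x × ¬ S x × ¬ G x

  G? : Decidable G
  G? x = X? x ×-dec ¬? (S? x) ×-dec ¬? (Two? x) ×-dec ¬? (Bad? x)

  F? : Decidable F
  F? x = X? x ×-dec ¬? (S? x) ×-dec ¬? (G? x)

  Two-resp : ∀ {x x′} → x ≈ x′ → Two x → Two x′
  Two-resp x≈x′ (y , y∈ , y≈x , nt) = y , y∈ , ≈-trans y≈x x≈x′ , nt

  Bad-resp : ∀ {x x′} → x ≈ x′ → Bad x → Bad x′
  Bad-resp x≈x′ bad = ℕ.<-≤-trans bad (ℕ.*-monoʳ-≤ q (#-mono _ _ A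
    (λ _ (xX , ¬h) → Res-resp x≈x′ xX , λ (b , b∈ , y∈ , y≈) → ¬h (b , b∈ , y∈ , ≈-trans y≈ (≈-sym x≈x′)))))

  G-resp : ∀ {x x′} → x ≈ x′ → G x → G x′
  G-resp x≈x′ (xX , ¬s , ¬two , ¬bad) =
    Res-resp x≈x′ xX , ¬s ∘ Res-resp (≈-sym x≈x′) , ¬two ∘ Two-resp (≈-sym x≈x′) , ¬bad ∘ Bad-resp (≈-sym x≈x′)

  F-resp : ∀ {x x′} → x ≈ x′ → F x → F x′
  F-resp x≈x′ (xX , ¬s , ¬g) = Res-resp x≈x′ xX , ¬s ∘ Res-resp (≈-sym x≈x′) , ¬g ∘ G-resp (≈-sym x≈x′)

  -- New residues with two lifts enlarge `Y` and so number less than u; the bad ones are few by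
  -- Markov's inequality.
  M*F≤ : M * # F? R ≤ (q + 1) * (k * e)
  M*F≤ = begin
    M * # F? R                         ≤⟨ ℕ.*-monoʳ-≤ M (#-∪ F? (λ x → ¬? (S? x) ×-dec Two? x) Bad? R split) ⟩
    M * (double + # Bad? R)            ≡⟨ ℕ.*-distribˡ-+ M double _ ⟩
    M * double + M * # Bad? R          ≤⟨ ℕ.+-mono-≤ (ℕ.≤-trans (ℕ.*-monoʳ-≤ M (ℕ.<⇒≤ double<u)) M*u≤ke) M*bad≤qke ⟩
    k * e + q * (k * e)                ≡⟨ eq q (k * e) ⟩
    (q + 1) * (k * e)                  ∎
    where
    open ℕ.≤-Reasoning
    eq : ∀ q x → x + q * x ≡ (q + 1) * x
    eq = ℕ-solve
    split : ∀ {x} → x ∈ R → F x → (¬ S x × Two x) ⊎ Bad x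
    split {x} _ (xX , ¬s , ¬g) with Two? x | Bad? x
    ... | yes two | _       = inj₁ (¬s , two)
    ... | no _    | yes bad = inj₂ bad
    ... | no ¬two | no ¬bad = contradiction (xX , ¬s , ¬two , ¬bad) ¬g

  -- `Y` has t - u residues and `A` has t - e. Were all new ones in `F`, then e ≤ |F| + u ≤ (q + 2)
  -- k e / M, which is less than e.
  exists-G : ∃[ y ] y ∈ Y × G y
  exists-G with any? G? R
  ... | yes some with find some
  ...   | r , _ , g@((y , y∈ , y≈r) , _) = y , y∈ , G-resp (≈-sym y≈r) g
  exists-G | no none = ⊥-elim (ℕ.<⇒≱ M-large (ℕ.*-cancelʳ-≤ M ((q + 2) * k) e {{>-nonZero e>0}} (begin
    M * e                              ≤⟨ ℕ.*-monoʳ-≤ M e≤ ⟩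
    M * (# F? R + u)                   ≡⟨ ℕ.*-distribˡ-+ M _ u ⟩
    M * # F? R + M * u                 ≤⟨ ℕ.+-mono-≤ M*F≤ M*u≤ke ⟩
    (q + 1) * (k * e) + k * e          ≡⟨ eq q k e ⟩
    (q + 2) * k * e                    ∎)))
    where
    open ℕ.≤-Reasoning
    eq : ∀ q k e → (q + 1) * (k * e) + k * e ≡ (q + 2) * k * e
    eq = ℕ-solve
    χ≤ : χ ≤ # S? R + # F? R
    χ≤ = #-∪ X? S? F? R (λ {x} x∈ xX → case S? x of λ where
      (yes s) → inj₁ s
      (no ¬s) → inj₂ (xX , ¬s , λ g → none (lose x∈ g)))
    e₂ : ∀ s f u → s + f + u ≡ s + (f + u)
    e₂ = ℕ-solve
    e≤ : e ≤ # F? R + u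
    e≤ = ℕ.+-cancelˡ-≤ (# S? R) _ _ (begin
      # S? R + e               ≡⟨ t≡s+e ⟨
      t                        ≡⟨ χ+u≡t ⟨
      χ + u                    ≤⟨ ℕ.+-monoˡ-≤ u χ≤ ⟩
      # S? R + # F? R + u      ≡⟨ e₂ (# S? R) _ u ⟩
      # S? R + (# F? R + u)    ∎)

  Window : ℤ → ℤ → Set
  Window y x = y <′ x ℤ.+ + m × x ℤ.≤ y

  Window? : ∀ y → Decidable (Window y)
  Window? y x = (y <′? (x ℤ.+ + m)) ×-dec (x ℤ.≤? y)

  -- Such a y is the only lift of its residue, so an x that hits it satisfies x + b = y with 0 ≤ b <
  -- m and lies in the window. All other x are misses, and y is not bad.
  outside-Window : ∀ {y} → y ∈ Y → G y → q * # (λ x → ¬? (Window? y x)) A ≤ a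
  outside-Window {y} y∈ (yX , _ , ¬two , ¬bad) = ℕ.≤-trans (ℕ.*-monoʳ-≤ q (#-mono _ _ A missed)) (ℕ.≮⇒≥ ¬bad)
    where
    missed : ∀ {x} → x ∈ A → ¬ Window y x → X y × ¬ Hit y x
    missed {x} _ ¬win = yX , hit
      where
      hit : ¬ Hit y x
      hit (b , b∈ , z∈ , z≈y) with ℤ.<-cmp (x ℤ.+ b) y
      ... | tri< z<y _ _ = ¬two (_ , z∈ , z≈y , y , y∈ , ≈-sym z≈y , ℤ.i<j⇒suc[i]≤j z<y)
      ... | tri> _ _ y<z = ¬two (y , y∈ , ≈-refl , _ , z∈ , z≈y , ℤ.i<j⇒suc[i]≤j y<z)
      ... | tri≈ _ refl _ = ¬win (linℤ (proj₂ (T-range b∈)) (e₁ x b (+ m)) , linℤ (proj₁ (T-range b∈)) (e₂ x b))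
        where
        e₁ : ∀ x b m → 1ℤ ℤ.+ (x ℤ.+ b) ℤ.- (x ℤ.+ m) ≡ 1ℤ ℤ.+ b ℤ.- m
        e₁ = ℤ-solve
        e₂ : ∀ x b → x ℤ.- (x ℤ.+ b) ≡ 0ℤ ℤ.- b
        e₂ = ℤ-solve

  abstract
    lowest : ∃[ y ] y ∈ Y × G y × (∀ {z} → z ∈ Y → G z → y ℤ.≤ z)
    lowest = let y , y∈ , g = exists-G in minimum G? y∈ g

    highest : ∃[ y ] y ∈ Y × G y × (∀ {z} → z ∈ Y → G z → z ℤ.≤ y)
    highest = let y , y∈ , g = exists-G in maximum G? y∈ g

  y⁻ y⁺ : ℤ
  y⁻ = proj₁ lowest
  y⁺ = proj₁ highest

  -- The intersection of the windows of `y⁻` and `y⁺`, hence of the windows of all lifts of `G` to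
  -- `Y`.
  J : ℤ → Set
  J x = y⁺ <′ x ℤ.+ + m × x ℤ.≤ y⁻

  J? : Decidable J
  J? x = (y⁺ <′? (x ℤ.+ + m)) ×-dec (x ℤ.≤? y⁻)

  y⁻≤y⁺ : y⁻ ℤ.≤ y⁺
  y⁻≤y⁺ = let _ , y∈ , g , _ = highest in proj₂ (proj₂ (proj₂ lowest)) y∈ g

  J-inj : ∀ {x x′} → J x → J x′ → x ≈ x′ → x ≡ x′
  J-inj (l , u) (l′ , u′) p = ≈-window p
    (ℤ.≤-trans (ℤ.+-monoʳ-≤ 1ℤ (ℤ.≤-trans u y⁻≤y⁺)) l′)
    (ℤ.≤-trans (ℤ.+-monoʳ-≤ 1ℤ (ℤ.≤-trans u′ y⁻≤y⁺)) l)

  outside-J : q * # (λ x → ¬? (J? x)) A ≤ a + a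
  outside-J with lowest | highest
  ... | l , l∈ , gl , minl | h , h∈ , gh , maxh = begin
    q * # (λ x → ¬? (J′? x)) A                                                          ≤⟨ ℕ.*-monoʳ-≤ q (#-∪ _ (λ x → ¬? (Window? h x)) (λ x → ¬? (Window? l x)) A split) ⟩
    q * (# (λ x → ¬? (Window? h x)) A + # (λ x → ¬? (Window? l x)) A)                   ≡⟨ ℕ.*-distribˡ-+ q _ _ ⟩
    q * # (λ x → ¬? (Window? h x)) A + q * # (λ x → ¬? (Window? l x)) A                 ≤⟨ ℕ.+-mono-≤ (outside-Window h∈ gh) (outside-Window l∈ gl) ⟩
    a + a                                                                               ∎
    where
    open ℕ.≤-Reasoning
    J′? : Decidable (λ x → h <′ x ℤ.+ + m × x ℤ.≤ l)
    J′? x = (h <′? (x ℤ.+ + m)) ×-dec (x ℤ.≤? l)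
    split : ∀ {x} → x ∈ A → ¬ (h <′ x ℤ.+ + m × x ℤ.≤ l) → ¬ Window h x ⊎ ¬ Window l x
    split {x} _ ¬j with h <′? (x ℤ.+ + m)
    ... | no ¬p = inj₁ (¬p ∘ proj₁)
    ... | yes p = inj₂ (λ (_ , x≤l) → ¬j (p , x≤l))

  -- The lift y of z lies between `y⁻` and `y⁺`, and the bounds of `J` put z less than m away from
  -- it. So z = y ≥ y⁻, while z ≤ y⁻.
  J-G : ∀ {z} → J z → G z → z ≡ y⁻
  J-G {z} (y⁺<z+m , z≤y⁻) g@((y , y∈ , y≈z) , _) = ℤ.≤-antisym z≤y⁻ (subst (y⁻ ℤ.≤_) (sym z≡y) y⁻≤y)
    where
    gy : G y
    gy = G-resp (≈-sym y≈z) g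
    y⁻≤y : y⁻ ℤ.≤ y
    y⁻≤y = proj₂ (proj₂ (proj₂ lowest)) y∈ gy
    y≤y⁺ : y ℤ.≤ y⁺
    y≤y⁺ = proj₂ (proj₂ (proj₂ highest)) y∈ gy
    z≡y : z ≡ y
    z≡y = ≈-window (≈-sym y≈z)
      (ℤ.≤-trans (ℤ.+-monoʳ-≤ 1ℤ (ℤ.≤-trans z≤y⁻ y⁻≤y)) (y<y+m y))
      (ℤ.≤-trans (ℤ.+-monoʳ-≤ 1ℤ y≤y⁺) y⁺<z+m)

  M≤ke : M ≤ k * e
  M≤ke = ℕ.≤-trans (ℕ.≤-trans (ℕ.≤-reflexive (sym (ℕ.*-identityʳ M))) (ℕ.*-monoʳ-≤ M (ℕ.≤-<-trans z≤n double<u))) M*u≤ke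

  -- Apart from `F` only `y⁻` can occur, by `J-G`. This single point costs M, which is at most k e
  -- because u ≥ 1 in `M*u≤ke`.
  new-in-J : ∀ {zs} → Unique zs → (∀ {z} → z ∈ zs → J z × X z × ¬ S z) → M * length zs ≤ (q + 2) * (k * e)
  new-in-J {zs} uniq h = begin
    M * length zs                       ≤⟨ ℕ.*-monoʳ-≤ M (ℕ.≤-trans (#-all FG? zs FG) (#-∪ FG? F? (ℤ._≟ y⁻) zs (λ z∈ → id))) ⟩
    M * (# F? zs + # (ℤ._≟ y⁻) zs)      ≤⟨ ℕ.*-monoʳ-≤ M (ℕ.+-mono-≤ inF (#-rel {ys = y⁻ ∷ []} (ℤ._≟ y⁻) (ℤ._≟ y⁻) _≡_ uniq (λ { _ refl → _ , here refl , refl , refl }) (λ { _ _ _ _ refl refl → refl }))) ⟩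
    M * (# F? R + # (ℤ._≟ y⁻) (y⁻ ∷ [])) ≤⟨ ℕ.*-monoʳ-≤ M (ℕ.+-monoʳ-≤ (# F? R) (#-≤length (ℤ._≟ y⁻) (y⁻ ∷ []))) ⟩
    M * (# F? R + 1)                    ≡⟨ e₁ M (# F? R) ⟩
    M * # F? R + M                      ≤⟨ ℕ.+-mono-≤ M*F≤ M≤ke ⟩
    (q + 1) * (k * e) + k * e           ≡⟨ e₂ q (k * e) ⟩
    (q + 2) * (k * e)                   ∎
    where
    open ℕ.≤-Reasoning
    e₁ : ∀ M f → M * (f + 1) ≡ M * f + M
    e₁ = ℕ-solve
    e₂ : ∀ q x → (q + 1) * x + x ≡ (q + 2) * x
    e₂ = ℕ-solve
    FG? : Decidable (λ z → F z ⊎ z ≡ y⁻)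
    FG? z = F? z ⊎-dec (z ℤ.≟ y⁻)
    FG : ∀ {z} → z ∈ zs → F z ⊎ z ≡ y⁻
    FG {z} z∈ with h z∈ | G? z
    ... | j , xX , ¬s | yes g = inj₂ (J-G j g)
    ... | j , xX , ¬s | no ¬g = inj₁ (xX , ¬s , ¬g)
    inF : # F? zs ≤ # F? R
    inF = #-residues F? F? uniq (λ z∈ _ z′∈ _ → J-inj (proj₁ (h z∈)) (proj₁ (h z′∈))) F-resp 0ℤ
      (λ {z} _ → subst F (sym (ℤ.+-identityʳ z)))

  -- Almost periods of T modulo m

  T̃ : ℤ → Set
  T̃ = Res m T

  T̃? : Decidable T̃
  T̃? = Res? m T

  #-R : {P Q : ℤ → Set} (P? : Decidable P) (Q? : Decidable Q) → (∀ {x y} → x ≈ y → Q x → Q y) →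
        ∀ w → (∀ {x} → P x → Q (x ℤ.+ w)) → # P? R ≤ # Q? R
  #-R P? Q? resp w f = #-residues P? Q? (ival-unique 0ℤ m) (λ x∈ _ x′∈ _ → residues-inj x∈ x′∈) resp w (λ _ → f)

  -- Half the size of the symmetric difference of `T` and its translate modulo m; hence it is
  -- symmetric, subadditive and 0 at 0.
  D : ℤ → ℕ
  D w = # (λ b → ¬? (T̃? (b ℤ.+ w))) T

  D-resp : ∀ {v w} → v ≈ w → D v ≤ D w
  D-resp v≈w = #-mono _ _ T (λ {b} _ ¬t → ¬t ∘ Res-resp (≈-+ˡ b (≈-sym v≈w)))

  D-0 : D 0ℤ ≤ 0
  D-0 = ℕ.+-cancelˡ-≤ t _ _ (begin
    t + D 0ℤ                                    ≤⟨ ℕ.+-monoˡ-≤ (D 0ℤ) (#-all _ T (λ {b} b∈ → b , b∈ , subst (b ≈_) (sym (ℤ.+-identityʳ b)) ≈-refl)) ⟩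
    # (λ b → T̃? (b ℤ.+ 0ℤ)) T + D 0ℤ            ≡⟨ #-¬ (λ b → T̃? (b ℤ.+ 0ℤ)) T ⟩
    t                                           ≡⟨ ℕ.+-identityʳ t ⟨
    t + 0                                       ∎)
    where open ℕ.≤-Reasoning

  D-+ : ∀ v w → D (v ℤ.+ w) ≤ D v + D w
  D-+ v w = ℕ.≤-trans
    (#-∪ _ (λ b → ¬? (T̃? (b ℤ.+ v))) (λ b → T̃? (b ℤ.+ v) ×-dec ¬? (T̃? (b ℤ.+ (v ℤ.+ w)))) T split)
    (ℕ.+-monoʳ-≤ (D v) (#-mod {m} _ _ uT (λ b∈ _ b′∈ _ → T-inj b∈ b′∈) v
      (λ { {b} _ ((b′ , b′∈ , b′≈) , ¬t) → b′ , b′∈ ,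
           (λ t → ¬t (Res-resp (subst (b′ ℤ.+ w ≈_) (ℤ.+-assoc b v w) (≈-+ʳ w b′≈)) t)) , b′≈ })))
    where
    split : ∀ {b} → b ∈ T → ¬ T̃ (b ℤ.+ (v ℤ.+ w)) → ¬ T̃ (b ℤ.+ v) ⊎ (T̃ (b ℤ.+ v) × ¬ T̃ (b ℤ.+ (v ℤ.+ w)))
    split {b} _ ¬t with T̃? (b ℤ.+ v)
    ... | yes t′ = inj₂ (t′ , ¬t)
    ... | no ¬t′ = inj₁ ¬t′

  -- Translation by w carries T ∩ (T - w) into T ∩ (T + w), and complements are taken in `T` on both
  -- sides.
  D-neg : ∀ w → D (ℤ.- w) ≤ D w
  D-neg w = ℕ.+-cancelˡ-≤ (# (λ b → T̃? (b ℤ.+ w)) T) _ _ (begin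
    # (λ b → T̃? (b ℤ.+ w)) T + D (ℤ.- w)          ≤⟨ ℕ.+-monoˡ-≤ (D (ℤ.- w)) back ⟩
    # (λ b → T̃? (b ℤ.- w)) T + D (ℤ.- w)          ≡⟨ #-¬ (λ b → T̃? (b ℤ.- w)) T ⟩
    t                                             ≡⟨ #-¬ (λ b → T̃? (b ℤ.+ w)) T ⟨
    # (λ b → T̃? (b ℤ.+ w)) T + D w                ∎)
    where
    open ℕ.≤-Reasoning
    eq : ∀ b b′ w → b ℤ.- (b′ ℤ.- w) ≡ (b ℤ.+ w) ℤ.- b′
    eq = ℤ-solve
    back : # (λ b → T̃? (b ℤ.+ w)) T ≤ # (λ b → T̃? (b ℤ.- w)) T
    back = #-mod {m} _ _ uT (λ b∈ _ b′∈ _ → T-inj b∈ b′∈) w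
      (λ { {b} b∈ (b′ , b′∈ , b′≈) → b′ , b′∈ , (b , b∈ , ≈-by (≈-sym b′≈) (eq b b′ w)) , b′≈ })

  X∖[x+T] : ∀ x → # (λ r → X? r ×-dec ¬? (T̃? (r ℤ.- x))) R ≤ tp x
  X∖[x+T] x = ℕ.+-cancelˡ-≤ (# (λ b → x ℤ.+ b ∈? Y) T) _ _ (begin
    # (λ b → x ℤ.+ b ∈? Y) T + # (λ r → X? r ×-dec ¬? (T̃? (r ℤ.- x))) R              ≤⟨ ℕ.+-monoˡ-≤ _ hits ⟩
    # (λ r → X? r ×-dec T̃? (r ℤ.- x)) R + # (λ r → X? r ×-dec ¬? (T̃? (r ℤ.- x))) R   ≤⟨ #-disjoint _ _ X? R (λ _ → proj₁) (λ _ → proj₁) (λ _ (_ , h) (_ , ¬h) → ¬h h) ⟩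
    χ                                                                                ≤⟨ χ≤t ⟩
    t                                                                                ≡⟨ t≡ x ⟨
    # (λ b → x ℤ.+ b ∈? Y) T + tp x                                                  ∎)
    where
    open ℕ.≤-Reasoning
    eq : ∀ b x → b ≡ b ℤ.+ x ℤ.- x
    eq = ℤ-solve
    hits : # (λ b → x ℤ.+ b ∈? Y) T ≤ # (λ r → X? r ×-dec T̃? (r ℤ.- x)) R
    hits = #-residues _ _ uT (λ b∈ _ b′∈ _ → T-inj b∈ b′∈)
      (λ p (xX , h) → Res-resp p xX , Res-resp (≈-+ʳ (ℤ.- x) p) h) x
      (λ {b} b∈ y∈ → (_ , y∈ , subst (x ℤ.+ b ≈_) (ℤ.+-comm x b) ≈-refl) , (b , b∈ , subst (b ≈_) (eq b x) ≈-refl))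

  [x+T]∖X : ∀ x → # (λ b → ¬? (X? (x ℤ.+ b))) T ≤ tp x
  [x+T]∖X x = #-mono _ _ T (λ _ ¬x y∈ → ¬x (_ , y∈ , ≈-refl))

  -- Up to tp x and tp x₀ elements respectively, x + T and x₀ + T both agree with the residues of
  -- `Y`, and so with each other.
  D-difference : ∀ x x₀ → D (x ℤ.- x₀) ≤ tp x + tp x₀
  D-difference x x₀ = ℕ.≤-trans
    (#-∪ _ (λ b → ¬? (x ℤ.+ b ∈? Y)) (λ b → (x ℤ.+ b ∈? Y) ×-dec ¬? (T̃? (b ℤ.+ (x ℤ.- x₀)))) T split)
    (ℕ.+-monoʳ-≤ (tp x) (ℕ.≤-trans second (X∖[x+T] x₀)))
    where
    split : ∀ {b} → b ∈ T → ¬ T̃ (b ℤ.+ (x ℤ.- x₀)) → x ℤ.+ b ∉ Y ⊎ (x ℤ.+ b ∈ Y × ¬ T̃ (b ℤ.+ (x ℤ.- x₀)))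
    split {b} _ ¬t with x ℤ.+ b ∈? Y
    ... | yes y∈ = inj₂ (y∈ , ¬t)
    ... | no y∉  = inj₁ y∉
    second : # (λ b → (x ℤ.+ b ∈? Y) ×-dec ¬? (T̃? (b ℤ.+ (x ℤ.- x₀)))) T ≤ # (λ r → X? r ×-dec ¬? (T̃? (r ℤ.- x₀))) R
    second = #-residues _ _ uT (λ b∈ _ b′∈ _ → T-inj b∈ b′∈)
      (λ p (xX , ¬h) → Res-resp p xX , ¬h ∘ Res-resp (≈-+ʳ (ℤ.- x₀) (≈-sym p))) x
      (λ {b} b∈ (y∈ , ¬t) → (_ , y∈ , subst (x ℤ.+ b ≈_) (ℤ.+-comm x b) ≈-refl) , ¬t ∘ subst T̃ (ℤ.+-assoc b x (ℤ.- x₀)))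

  -- The scale a / N and the core of A

  instance
    N≢0 : NonZero N
    N≢0 = >-nonZero (ℕ.≤-trans (s≤s z≤n) N-large)

    t≢0 : NonZero t
    t≢0 = >-nonZero t>0

    k≢0 : NonZero k
    k≢0 = ≢-nonZero λ k≡0 → ℕ.<⇒≱ t>0 (subst (λ k → t ≤ k * a) k≡0 t≤ka)

  -- All error terms are measured in units of a / N.
  Tiny : ℕ → Set
  Tiny n = N * n ≤ a

  -- Here the lower bounds on the constants are spent: c is p, q or M, and k′ is the factor lost on
  -- the way to a multiple of a.
  tiny : ∀ {n c} k′ .{{_ : NonZero k′}} → N * k′ ≤ c → c * n ≤ k′ * a → Tiny n
  tiny {n} {c} k′ le le′ = ℕ.*-cancelˡ-≤ k′ (begin
    k′ * (N * n)    ≡⟨ eq N k′ n ⟩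
    N * k′ * n      ≤⟨ ℕ.*-monoˡ-≤ n le ⟩
    c * n             ≤⟨ le′ ⟩
    k′ * a            ∎)
    where
    open ℕ.≤-Reasoning
    eq : ∀ N k n → k * (N * n) ≡ N * k * n
    eq = ℕ-solve

  e≤t : e ≤ t
  e≤t = ℕ.≤-trans (ℕ.m≤n+m e _) (ℕ.≤-reflexive (sym t≡s+e))

  e≤ka : e ≤ k * a
  e≤ka = ℕ.≤-trans e≤t t≤ka

  Typ : ℤ → Set
  Typ x = p * tp x ≤ t

  Typ? : Decidable Typ
  Typ? x = p * tp x ℕ.≤? t

  2^-≥1 : ∀ n → 1 ≤ 2 ^ n
  2^-≥1 n = ℕ.m^n>0 2 n

  Nk≤p : N * k ≤ p
  Nk≤p = ℕ.≤-trans (ℕ.*-monoʳ-≤ N (ℕ.≤-trans (ℕ.≤-reflexive (sym (ℕ.*-identityˡ k))) (ℕ.*-monoˡ-≤ k (2^-≥1 (2 + depth))))) p-large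

  p>0 : 0 < p
  p>0 = ℕ.<-≤-trans (ℕ.*-mono-≤ {1} {N} (ℕ.≤-trans (s≤s z≤n) N-large) (>-nonZero⁻¹ k)) Nk≤p

  instance
    p≢0 : NonZero p
    p≢0 = >-nonZero p>0

  tp-tiny : ∀ {x} → Typ x → Tiny (tp x)
  tp-tiny typ = tiny k Nk≤p (ℕ.≤-trans typ t≤ka)

  gain-tiny : ∀ {b} → b ∈ T → Tiny (gain A Y b)
  gain-tiny b∈ = tiny k (ℕ.≤-trans (ℕ.*-monoʳ-≤ N (ℕ.m≤n*m k p)) M-large₁) (ℕ.≤-trans (saturated b∈) e≤ka)

  kke : (q + 2) * (k * e) ≤ (q + 2) * (k * k) * a
  kke = ℕ.≤-trans (ℕ.*-monoʳ-≤ (q + 2) (ℕ.*-monoʳ-≤ k e≤ka)) (ℕ.≤-reflexive (eq (q + 2) k a))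
    where
    eq : ∀ q k a → q * (k * (k * a)) ≡ q * (k * k) * a
    eq = ℕ-solve

  instance
    qkk≢0 : NonZero ((q + 2) * (k * k))
    qkk≢0 = ℕ.m*n≢0 (q + 2) (k * k) {{≢-nonZero λ z → contradiction (trans (ℕ.+-comm 2 q) z) λ ()}} {{ℕ.m*n≢0 k k}}

  new-tiny : ∀ {zs} → Unique zs → (∀ {z} → z ∈ zs → J z × X z × ¬ S z) → Tiny (length zs)
  new-tiny uniq h = tiny ((q + 2) * (k * k)) M-large₂ (ℕ.≤-trans (new-in-J uniq h) kke)

  1-tiny : Tiny 1
  1-tiny = tiny ((q + 2) * (k * k)) M-large₂ (begin
    M * 1                      ≡⟨ ℕ.*-identityʳ M ⟩
    M                          ≤⟨ M≤ke ⟩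
    k * e                      ≤⟨ ℕ.m≤n*m (k * e) (q + 2) {{≢-nonZero λ z → contradiction (trans (ℕ.+-comm 2 q) z) λ ()}} ⟩
    (q + 2) * (k * e)          ≤⟨ kke ⟩
    (q + 2) * (k * k) * a      ∎)
    where open ℕ.≤-Reasoning

  outside-tiny : Tiny (# (λ x → ¬? (J? x)) A)
  outside-tiny = tiny 2 (ℕ.≤-reflexive (sym q≡2N)) (ℕ.≤-trans outside-J (ℕ.≤-reflexive (cong (_+_ a) (sym (ℕ.+-identityʳ a)))))

  atypical-tiny : Tiny (# (λ x → ¬? (Typ? x)) A)
  atypical-tiny = tiny (p * k) {{ℕ.m*n≢0 p k}} M-large₁ (ℕ.≤-trans
    (ℕ.*-cancelʳ-≤ _ (p * e) t (begin
      M * n * t                       ≡⟨ ℕ.*-assoc M n t ⟩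
      M * (n * t)                     ≤⟨ ℕ.*-monoʳ-≤ M (Σ-# (λ x → ¬? (Typ? x)) (λ x → p * tp x) t A (λ _ → ℕ.≰⇒≥)) ⟩
      M * Σ[ A ] (λ x → p * tp x)     ≡⟨ cong (_*_ M) (Σ-* p tp A) ⟩
      M * (p * error)                 ≡⟨ e₁ M p error ⟩
      p * (M * error)                 ≤⟨ ℕ.*-monoʳ-≤ p M*error≤te ⟩
      p * (t * e)                     ≡⟨ e₂ p t e ⟩
      p * e * t                       ∎))
    (ℕ.≤-trans (ℕ.*-monoʳ-≤ p e≤ka) (ℕ.≤-reflexive (sym (ℕ.*-assoc p k a)))))
    where
    open ℕ.≤-Reasoning
    n = # (λ x → ¬? (Typ? x)) A
    e₁ : ∀ x y z → x * (y * z) ≡ y * (x * z)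
    e₁ = ℕ-solve
    e₂ : ∀ x y z → x * (y * z) ≡ x * z * y
    e₂ = ℕ-solve

  Core? : Decidable (λ x → Typ x × J x)
  Core? x = Typ? x ×-dec J? x

  core : List ℤ
  core = filter Core? A

  core-unique : Unique core
  core-unique = Unique.filter⁺ Core? uA

  ∈-core : ∀ {x} → x ∈ core → x ∈ A × Typ x × J x
  ∈-core = ∈-filter⁻ Core?

  core-large : N * a ≤ N * length core + 2 * a
  core-large = arith N a _ _ _ a≤ atypical-tiny outside-tiny
    where
    a≤ : a ≤ length core + (# (λ x → ¬? (Typ? x)) A + # (λ x → ¬? (J? x)) A)
    a≤ = begin
      a                                                             ≡⟨ #-¬ Core? A ⟨
      # Core? A + # (λ x → ¬? (Core? x)) A                          ≤⟨ ℕ.+-mono-≤ (ℕ.≤-reflexive (#-filter Core? A)) (#-∪ _ (λ x → ¬? (Typ? x)) (λ x → ¬? (J? x)) A split) ⟩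
      length core + (# (λ x → ¬? (Typ? x)) A + # (λ x → ¬? (J? x)) A) ∎
      where
      open ℕ.≤-Reasoning
      split : ∀ {x} → x ∈ A → ¬ (Typ x × J x) → ¬ Typ x ⊎ ¬ J x
      split {x} _ ¬c with Typ? x
      ... | yes typ = inj₂ (λ j → ¬c (typ , j))
      ... | no ¬typ = inj₁ ¬typ
    arith : ∀ N a c x y → a ≤ c + (x + y) → N * x ≤ a → N * y ≤ a → N * a ≤ N * c + 2 * a
    arith N a c x y h₁ h₂ h₃ = lin 0 (ℕ.+-mono-≤ (ℕ.*-monoʳ-≤ N h₁) (ℕ.+-mono-≤ h₂ h₃)) (eq N a c x y)
      where
      eq : ∀ N a c x y → N * a + (N * (c + (x + y)) + (a + a)) + 0 ≡ N * c + 2 * a + (N * a + (N * x + N * y))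
      eq = ℕ-solve

  a≤2core : a ≤ 2 * length core
  a≤2core = ℕ.*-cancelˡ-≤ N (arith N a (length core) core-large (ℕ.*-monoˡ-≤ a (ℕ.≤-trans (ℕ.m≤m+n 8 8) N-large)))
    where
    arith : ∀ N a c → N * a ≤ N * c + 2 * a → 8 * a ≤ N * a → N * a ≤ N * (2 * c)
    arith N a c h₁ h₂ = ℕ.*-cancelˡ-≤ 3 (lin (2 * (N * c)) (ℕ.+-mono-≤ (ℕ.*-monoʳ-≤ 4 h₁) h₂) (eq N a c))
      where
      eq : ∀ N a c → 3 * (N * a) + (4 * (N * c + 2 * a) + N * a) + 2 * (N * c) ≡ 3 * (N * (2 * c)) + (4 * (N * a) + 8 * a)
      eq = ℕ-solve

  abstract
    core-inhabited : ∃[ x ] x ∈ core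
    core-inhabited = inhabited core (ℕ.n≢0⇒n>0 λ z → ℕ.<⇒≱ a>0 (ℕ.≤-trans a≤2core (ℕ.≤-reflexive (cong (2 *_) z))))
      where
      inhabited : (xs : List ℤ) → 0 < length xs → ∃[ x ] x ∈ xs
      inhabited (x ∷ _) _ = x , here refl

  x₀ : ℤ
  x₀ = proj₁ core-inhabited

  x₀-typ : Typ x₀
  x₀-typ = proj₁ (proj₂ (∈-core (proj₂ core-inhabited)))

  core-inj : ∀ {x x′} → x ∈ core → x′ ∈ core → x ≈ x′ → x ≡ x′
  core-inj x∈ x′∈ = J-inj (proj₂ (proj₂ (∈-core x∈))) (proj₂ (proj₂ (∈-core x′∈)))

  W : ℕ → ℤ → Set
  W i w = p * D w ≤ 2 ^ suc i * t

  W? : ∀ i → Decidable (W i)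
  W? i w = p * D w ℕ.≤? 2 ^ suc i * t

  ω : ℕ → ℕ
  ω i = # (W? i) R

  W-resp : ∀ i {v w} → v ≈ w → W i v → W i w
  W-resp i v≈w h = ℕ.≤-trans (ℕ.*-monoʳ-≤ p (D-resp (≈-sym v≈w))) h

  W-0 : ∀ i → W i 0ℤ
  W-0 i = ℕ.≤-trans (ℕ.*-monoʳ-≤ p D-0) (ℕ.≤-trans (ℕ.≤-reflexive (ℕ.*-zeroʳ p)) z≤n)

  W-neg : ∀ i {w} → W i w → W i (ℤ.- w)
  W-neg i {w} h = ℕ.≤-trans (ℕ.*-monoʳ-≤ p (D-neg w)) h

  W-+ : ∀ i {v w} → W i v → W i w → W (suc i) (v ℤ.+ w)
  W-+ i {v} {w} h h′ = begin
    p * D (v ℤ.+ w)                   ≤⟨ ℕ.*-monoʳ-≤ p (D-+ v w) ⟩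
    p * (D v + D w)                   ≡⟨ ℕ.*-distribˡ-+ p (D v) (D w) ⟩
    p * D v + p * D w                 ≤⟨ ℕ.+-mono-≤ h h′ ⟩
    2 ^ suc i * t + 2 ^ suc i * t     ≡⟨ eq (2 ^ suc i) t ⟩
    2 ^ suc (suc i) * t               ∎
    where
    open ℕ.≤-Reasoning
    eq : ∀ x t → x * t + x * t ≡ (x + (x + 0)) * t
    eq = ℕ-solve

  W-typ : ∀ i {x} → Typ x → W i (x ℤ.- x₀)
  W-typ i {x} typ = begin
    p * D (x ℤ.- x₀)           ≤⟨ ℕ.*-monoʳ-≤ p (D-difference x x₀) ⟩
    p * (tp x + tp x₀)         ≡⟨ ℕ.*-distribˡ-+ p _ _ ⟩
    p * tp x + p * tp x₀       ≤⟨ ℕ.+-mono-≤ typ x₀-typ ⟩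
    t + t                      ≡⟨ cong (_+_ t) (ℕ.+-identityʳ t) ⟨
    2 * t                      ≤⟨ ℕ.*-monoˡ-≤ t (ℕ.^-monoʳ-≤ 2 {1} {suc i} (s≤s z≤n)) ⟩
    2 ^ suc i * t              ∎
    where open ℕ.≤-Reasoning

  -- Each w with D w ≤ t / 2 satisfies 2 ∣T ∩ (T - w)∣ ≥ t, and these intersections sum to at most t².
  ω≤2t : ∀ i → 2 ^ (2 + i) ≤ p → ω i ≤ 2 * t
  ω≤2t i 2^≤p = ℕ.*-cancelʳ-≤ (ω i) (2 * t) t (begin
    ω i * t                                             ≤⟨ Σ-# (W? i) _ t R (λ {w} _ → half w) ⟩
    Σ[ R ] (λ w → 2 * # (λ b → T̃? (b ℤ.+ w)) T)         ≡⟨ Σ-* 2 _ R ⟩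
    2 * Σ[ R ] (λ w → # (λ b → T̃? (b ℤ.+ w)) T)         ≡⟨ cong (_*_ 2) (#-swap (λ w b → T̃? (b ℤ.+ w)) R T) ⟩
    2 * Σ[ T ] (λ b → # (λ w → T̃? (b ℤ.+ w)) R)         ≤⟨ ℕ.*-monoʳ-≤ 2 (Σ-mono T (λ {b} _ → translate b)) ⟩
    2 * Σ[ T ] (λ _ → t)                                ≡⟨ cong (_*_ 2) (Σ-const t T) ⟩
    2 * (t * t)                                         ≡⟨ ℕ.*-assoc 2 t t ⟨
    2 * t * t                                           ∎)
    where
    open ℕ.≤-Reasoning
    translate : ∀ b → # (λ w → T̃? (b ℤ.+ w)) R ≤ t
    translate b = ℕ.≤-trans (#-mod {m} (λ w → T̃? (b ℤ.+ w)) T̃? (ival-unique 0ℤ m) (λ x∈ _ x′∈ _ → residues-inj x∈ x′∈) b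
      (λ { {w} _ (b′ , b′∈ , b′≈) → b′ , b′∈ , (b′ , b′∈ , ≈-refl) , subst (b′ ≈_) (ℤ.+-comm b w) b′≈ })) (#-≤length T̃? T)
    half : ∀ w → W i w → t ≤ 2 * # (λ b → T̃? (b ℤ.+ w)) T
    half w h = ℕ.+-cancelʳ-≤ (D w + D w) t _ (begin
      t + (D w + D w)                               ≤⟨ ℕ.+-monoʳ-≤ t 2D≤t ⟩
      t + t                                         ≡⟨ cong₂ _+_ eq eq ⟨
      (n + D w) + (n + D w)                         ≡⟨ e₁ n (D w) ⟩
      2 * n + (D w + D w)                           ∎)
      where
      n = # (λ b → T̃? (b ℤ.+ w)) T
      eq : n + D w ≡ t
      eq = #-¬ (λ b → T̃? (b ℤ.+ w)) T
      e₁ : ∀ n d → (n + d) + (n + d) ≡ 2 * n + (d + d)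
      e₁ = ℕ-solve
      e₂ : ∀ p d → p * (d + d) ≡ 2 * (p * d)
      e₂ = ℕ-solve
      2D≤t : D w + D w ≤ t
      2D≤t = ℕ.*-cancelˡ-≤ p (begin
        p * (D w + D w)       ≡⟨ e₂ p (D w) ⟩
        2 * (p * D w)         ≤⟨ ℕ.*-monoʳ-≤ 2 h ⟩
        2 * (2 ^ suc i * t)   ≡⟨ ℕ.*-assoc 2 (2 ^ suc i) t ⟨
        2 ^ (2 + i) * t       ≤⟨ ℕ.*-monoˡ-≤ t 2^≤p ⟩
        p * t                 ∎)

  2^≤p : ∀ {i} → i ≤ depth → 2 ^ (2 + i) ≤ p
  2^≤p {i} i≤ = begin
    2 ^ (2 + i)                      ≤⟨ ℕ.^-monoʳ-≤ 2 (s≤s (s≤s i≤)) ⟩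
    2 ^ (2 + depth)                  ≤⟨ ℕ.m≤m*n _ k ⟩
    2 ^ (2 + depth) * k              ≤⟨ ℕ.m≤n*m _ N ⟩
    N * (2 ^ (2 + depth) * k)      ≤⟨ p-large ⟩
    p                                ∎
    where open ℕ.≤-Reasoning

  core≤ω : length core ≤ ω 0
  core≤ω = ℕ.≤-trans (#-all Typ? core (λ x∈ → proj₁ (proj₂ (∈-core x∈))))
    (#-residues Typ? (W? 0) core-unique (λ x∈ _ x′∈ _ → core-inj x∈ x′∈) (W-resp 0) (ℤ.- x₀) (λ {x} _ → W-typ 0 {x}))

  ω₀-large : 2 * t ≤ 4 * k * ω 0
  ω₀-large = begin
    2 * t                    ≤⟨ ℕ.*-monoʳ-≤ 2 t≤ka ⟩
    2 * (k * a)              ≤⟨ ℕ.*-monoʳ-≤ 2 (ℕ.*-monoʳ-≤ k a≤2core) ⟩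
    2 * (k * (2 * length core)) ≤⟨ ℕ.*-monoʳ-≤ 2 (ℕ.*-monoʳ-≤ k (ℕ.*-monoʳ-≤ 2 core≤ω)) ⟩
    2 * (k * (2 * ω 0))      ≡⟨ eq k (ω 0) ⟩
    4 * k * ω 0              ∎
    where
    open ℕ.≤-Reasoning
    eq : ∀ k w → 2 * (k * (2 * w)) ≡ 4 * k * w
    eq = ℕ-solve

  ω-growth : ∀ n → (∃[ i ] i < n × 2 * ω (suc i) < 3 * ω i) ⊎ (3 ^ n * ω 0 ≤ 2 ^ n * ω n)
  ω-growth zero    = inj₂ ℕ.≤-refl
  ω-growth (suc n) with ω-growth n
  ... | inj₁ (i , i<n , h) = inj₁ (i , ℕ.m<n⇒m<1+n i<n , h)
  ... | inj₂ h with 2 * ω (suc n) ℕ.<? 3 * ω n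
  ...   | yes h′ = inj₁ (n , ℕ.n<1+n n , h′)
  ...   | no h′  = inj₂ (begin
    3 * 3 ^ n * ω 0              ≡⟨ ℕ.*-assoc 3 (3 ^ n) (ω 0) ⟩
    3 * (3 ^ n * ω 0)            ≤⟨ ℕ.*-monoʳ-≤ 3 h ⟩
    3 * (2 ^ n * ω n)            ≡⟨ e₁ (2 ^ n) (ω n) ⟩
    2 ^ n * (3 * ω n)            ≤⟨ ℕ.*-monoʳ-≤ (2 ^ n) (ℕ.≮⇒≥ h′) ⟩
    2 ^ n * (2 * ω (suc n))      ≡⟨ e₂ (2 ^ n) (ω (suc n)) ⟩
    2 * 2 ^ n * ω (suc n)        ∎)
    where
    open ℕ.≤-Reasoning
    e₁ : ∀ x y → 3 * (x * y) ≡ x * (3 * y)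
    e₁ = ℕ-solve
    e₂ : ∀ x y → x * (2 * y) ≡ 2 * x * y
    e₂ = ℕ-solve

  abstract
    -- The sizes ω start at t / (2k) or more and are at most 2t at level `depth`. Growth by 3/2 at
    -- every level would multiply them by more than 4k.
    stationary : ∃[ i ] i < depth × 2 * ω (suc i) < 3 * ω i
    stationary with ω-growth depth
    ... | inj₁ found = found
    ... | inj₂ h = contradiction (ℕ.*-cancelʳ-≤ (3 ^ depth) (4 * k * 2 ^ depth) (ω 0) {{ω₀≢0}} (begin
      3 ^ depth * ω 0                  ≤⟨ h ⟩
      2 ^ depth * ω depth              ≤⟨ ℕ.*-monoʳ-≤ (2 ^ depth) (ℕ.≤-trans (ω≤2t depth (2^≤p ℕ.≤-refl)) ω₀-large) ⟩
      2 ^ depth * (4 * k * ω 0)        ≡⟨ eq (2 ^ depth) (4 * k) (ω 0) ⟩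
      4 * k * 2 ^ depth * ω 0          ∎)) (ℕ.<⇒≱ depth-large)
      where
      open ℕ.≤-Reasoning
      eq : ∀ x y z → x * (y * z) ≡ y * x * z
      eq = ℕ-solve
      ω₀≢0 : NonZero (ω 0)
      ω₀≢0 = ≢-nonZero λ z → ℕ.<⇒≱ (ℕ.*-mono-≤ {1} {2} (s≤s z≤n) t>0) (subst (λ w → 2 * t ≤ w) (trans (cong (_*_ (4 * k)) z) (ℕ.*-zeroʳ (4 * k))) ω₀-large)

  i : ℕ
  i = proj₁ stationary

  i<depth : i < depth
  i<depth = proj₁ (proj₂ stationary)

  -- The group of differences of W i

  H : ℤ → Set
  H x = ∃[ u ] u ∈ R × W i u × W i (u ℤ.+ x)

  abstract
    H? : Decidable H
    H? x = map′ find (λ (_ , u∈ , h) → lose u∈ h) (any? (λ u → W? i u ×-dec W? i (u ℤ.+ x)) R)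

  H-intro : ∀ u {x} → W i u → W i (u ℤ.+ x) → H x
  H-intro u {x} wu wux with residue m u
  ... | r , r∈ , r≈u = r , r∈ , W-resp i {u} {r} (≈-sym r≈u) wu , W-resp i {u ℤ.+ x} {r ℤ.+ x} (≈-+ʳ x (≈-sym r≈u)) wux

  pairs : ℤ → ℕ
  pairs x = # (λ u → W? i u ×-dec W? i (u ℤ.+ x)) R

  -- Two translates of W i, both contained in the slightly larger W (suc i), overlap in more than half of W i.
  H-popular : ∀ {x} → H x → ω i < 2 * pairs x
  H-popular {x} (u , _ , wu , wux) = arith (ω i) (ω (suc i)) _ _ _ _ (shift u) (shift (u ℤ.+ x)) both back (proj₂ (proj₂ stationary))
    where
    shift : ∀ v → ω i ≤ # (λ z → W? i (z ℤ.+ v)) R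
    shift v = #-R (W? i) (λ z → W? i (z ℤ.+ v)) (λ {y} {y′} p → W-resp i {y ℤ.+ v} {y′ ℤ.+ v} (≈-+ʳ v p)) (ℤ.- v)
      (λ {z} → subst (W i) (eq z v))
      where
      eq : ∀ z v → z ≡ z ℤ.- v ℤ.+ v
      eq = ℤ-solve
    Both? : Decidable (λ z → W i (z ℤ.+ u) × W i (z ℤ.+ (u ℤ.+ x)))
    Both? z = W? i (z ℤ.+ u) ×-dec W? i (z ℤ.+ (u ℤ.+ x))
    inside : ∀ {v z} → W i v → W i (z ℤ.+ v) → W (suc i) z
    inside {v} {z} wv wzv = subst (W (suc i)) (eq z v) (W-+ i {z ℤ.+ v} {ℤ.- v} wzv (W-neg i {v} wv))
      where
      eq : ∀ z v → z ℤ.+ v ℤ.- v ≡ z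
      eq = ℤ-solve
    both : # (λ z → W? i (z ℤ.+ u)) R + # (λ z → W? i (z ℤ.+ (u ℤ.+ x))) R ≤ ω (suc i) + # Both? R
    both = #-∩ _ _ (W? (suc i)) Both? R (λ {z} _ → inside {u} {z} wu) (λ {z} _ → inside {u ℤ.+ x} {z} wux) (λ _ → _,_)
    back : # Both? R ≤ pairs x
    back = #-R Both? (λ u → W? i u ×-dec W? i (u ℤ.+ x))
      (λ {y} {y′} p (w , w′) → W-resp i {y} {y′} p w , W-resp i {y ℤ.+ x} {y′ ℤ.+ x} (≈-+ʳ x p) w′) u
      (λ {z} (w , w′) → w , subst (W i) (sym (ℤ.+-assoc z u x)) w′)
    arith : ∀ w w′ p₁ p₂ b n → w ≤ p₁ → w ≤ p₂ → p₁ + p₂ ≤ w′ + b → b ≤ n → 2 * w′ < 3 * w → w < 2 * n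
    arith w w′ p₁ p₂ b n h₁ h₂ h₃ h₄ h₅ =
      lin 0 (ℕ.+-mono-≤ (ℕ.*-monoʳ-≤ 2 (ℕ.+-mono-≤ (ℕ.+-mono-≤ h₁ h₂) (ℕ.+-mono-≤ h₃ h₄))) h₅) (eq w w′ p₁ p₂ b n)
      where
      eq : ∀ w w′ p₁ p₂ b n → suc w + (2 * ((p₁ + p₂) + ((w′ + b) + n)) + 3 * w) + 0 ≡
                              2 * n + (2 * ((w + w) + ((p₁ + p₂) + b)) + suc (2 * w′))
      eq = ℕ-solve

  H-neg : ∀ {x} → H x → H (ℤ.- x)
  H-neg {x} (u , _ , wu , wux) = H-intro (u ℤ.+ x) wux (subst (W i) (eq u x) wu)
    where
    eq : ∀ u x → u ≡ u ℤ.+ x ℤ.- x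
    eq = ℤ-solve

  -- The u in W i with u + x in W i, and those with u - y in W i, each make up more than half of W
  -- i. A common u gives x + y = (u + x) - (u - y), a difference of elements of W i.
  H-+ : ∀ {x y} → H x → H y → H (x ℤ.+ y)
  H-+ {x} {y} hx hy = from (#-find (λ u → W? i (u ℤ.+ x) ×-dec W? i (u ℤ.- y)) R meet)
    where
    both : pairs x + pairs (ℤ.- y) ≤ ω i + # (λ u → W? i (u ℤ.+ x) ×-dec W? i (u ℤ.- y)) R
    both = #-∩ _ _ (W? i) _ R (λ _ → proj₁) (λ _ → proj₁) (λ _ (_ , w) (_ , w′) → w , w′)
    arith : ∀ w p q n → w < 2 * p → w < 2 * q → p + q ≤ w + n → 1 ≤ n
    arith w p q n h₁ h₂ h₃ = ℕ.*-cancelˡ-≤ 2 (lin 0 (ℕ.+-mono-≤ (ℕ.+-mono-≤ h₁ h₂) (ℕ.*-monoʳ-≤ 2 h₃)) (eq w p q n))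
      where
      eq : ∀ w p q n → 2 + ((2 * p + 2 * q) + 2 * (w + n)) + 0 ≡ 2 * n + ((suc w + suc w) + 2 * (p + q))
      eq = ℕ-solve
    meet : 1 ≤ # (λ u → W? i (u ℤ.+ x) ×-dec W? i (u ℤ.- y)) R
    meet = arith (ω i) (pairs x) (pairs (ℤ.- y)) _ (H-popular hx) (H-popular (H-neg hy)) both
    from : ∃[ u ] u ∈ R × W i (u ℤ.+ x) × W i (u ℤ.- y) → H (x ℤ.+ y)
    from (u , _ , w , w′) = H-intro (u ℤ.- y) w′ (subst (W i) (eq u x y) w)
      where
      eq : ∀ u x y → u ℤ.+ x ≡ u ℤ.- y ℤ.+ (x ℤ.+ y)
      eq = ℤ-solve

  H-W : ∀ {x} → H x → W (suc i) x
  H-W {x} (u , _ , wu , wux) = subst (W (suc i)) (eq u x) (W-+ i {u ℤ.+ x} {ℤ.- u} wux (W-neg i {u} wu))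
    where
    eq : ∀ u x → u ℤ.+ x ℤ.- u ≡ x
    eq = ℤ-solve

  H-resp : ∀ {x x′} → x ≈ x′ → H x → H x′
  H-resp {x} {x′} p (u , u∈ , wu , wux) = u , u∈ , wu , W-resp i {u ℤ.+ x} {u ℤ.+ x′} (≈-+ˡ u p) wux

  H-0 : H 0ℤ
  H-0 = H-intro 0ℤ (W-0 i) (W-0 i)

  H-m : H (+ m)
  H-m = H-resp (≈-sym (≈-m 0ℤ)) H-0

  H-typ : ∀ {x} → Typ x → H (x ℤ.- x₀)
  H-typ {x} typ = H-intro 0ℤ (W-0 i) (subst (W i) (sym (ℤ.+-identityˡ (x ℤ.- x₀))) (W-typ i {x} typ))

  H-*ℕ : ∀ n {x} → H x → H (+ n ℤ.* x)
  H-*ℕ zero    {x} h = subst H (sym (ℤ.*-zeroˡ x)) H-0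
  H-*ℕ (suc n) {x} h = subst H (eq (+ n) x) (H-+ h (H-*ℕ n h))
    where
    eq : ∀ n x → x ℤ.+ n ℤ.* x ≡ (1ℤ ℤ.+ n) ℤ.* x
    eq = ℤ-solve

  H-* : ∀ z {x} → H x → H (z ℤ.* x)
  H-* (+ n)    h     = H-*ℕ n h
  H-* -[1+ n ] {x} h = subst H (ℤ.neg-distribˡ-* (+ suc n) x) (H-neg (H-*ℕ (suc n) h))

  D-tiny : ∀ {x} → H x → Tiny (D x)
  D-tiny {x} h = tiny (2 ^ (2 + depth) * k) {{ℕ.m*n≢0 (2 ^ (2 + depth)) k {{ℕ.m^n≢0 2 (2 + depth)}}}} p-large (begin
    p * D x                        ≤⟨ H-W h ⟩
    2 ^ (2 + i) * t                ≤⟨ ℕ.*-mono-≤ (ℕ.^-monoʳ-≤ 2 (s≤s (s≤s (ℕ.<⇒≤ i<depth)))) t≤ka ⟩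
    2 ^ (2 + depth) * (k * a)      ≡⟨ ℕ.*-assoc (2 ^ (2 + depth)) k a ⟨
    2 ^ (2 + depth) * k * a        ∎)
    where open ℕ.≤-Reasoning

  abstract
    -- Since m belongs to `H`, the least positive element of `H` can be sought in [1, m].
    period : ∃[ n ] H (+ suc n) × (∀ {z} → z ∈ ival 1ℤ m → H z → + suc n ℤ.≤ z)
    period = from (minimum H? (∈-ival⁺ {l = 1ℤ} {n = m} (ℤ.+≤+ (>-nonZero⁻¹ m)) ℤ.≤-refl) H-m)
      where
      from : ∃[ y ] y ∈ ival 1ℤ m × H y × (∀ {z} → z ∈ ival 1ℤ m → H z → y ℤ.≤ z) →
             ∃[ n ] H (+ suc n) × (∀ {z} → z ∈ ival 1ℤ m → H z → + suc n ℤ.≤ z)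
      from (+ suc n , _ , hy , least) = n , hy , least
      from (+ zero , y∈ , _) with ∈-ival⁻ {l = 1ℤ} {n = m} y∈
      ... | ℤ.+≤+ () , _
      from (-[1+ _ ] , y∈ , _) with ∈-ival⁻ {l = 1ℤ} {n = m} y∈
      ... | () , _

  d : ℕ
  d = suc (proj₁ period)

  H-d : H (+ d)
  H-d = proj₁ (proj₂ period)

  d≤m : d ≤ m
  d≤m = ℤ.drop‿+≤+ (proj₂ (proj₂ period) (∈-ival⁺ {l = 1ℤ} {n = m} (ℤ.+≤+ (>-nonZero⁻¹ m)) ℤ.≤-refl) H-m)

  d∣⇒H : ∀ {x} → x ≈ 0ℤ [mod d ] → H x
  d∣⇒H (by z refl) = subst H (sym (ℤ.+-identityˡ (z ℤ.* + d))) (H-* z H-d)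

  H⇒d∣ : ∀ {x} → H x → x ≈ 0ℤ [mod d ]
  H⇒d∣ {x} h = go (x %ℕ d) (n%ℕd<d x d) (a≡a%ℕn+[a/ℕn]*n x d)
    where
    eq : ∀ r z → r ℤ.+ z ℤ.- z ≡ r
    eq = ℤ-solve
    go : ∀ r → r < d → x ≡ + r ℤ.+ (x /ℕ d) ℤ.* + d → x ≈ 0ℤ [mod d ]
    go zero    _   x≡ = by (x /ℕ d) x≡
    go (suc r) r<d x≡ = contradiction (ℤ.drop‿+≤+ (proj₂ (proj₂ period)
        (∈-ival⁺ {l = 1ℤ} {n = m} (ℤ.+≤+ (s≤s z≤n)) (ℤ.+≤+ (s≤s (ℕ.≤-trans (ℕ.<⇒≤ r<d) d≤m))))
        (subst H (trans (cong (ℤ._- (x /ℕ d) ℤ.* + d) x≡) (eq (+ suc r) ((x /ℕ d) ℤ.* + d))) (H-+ h (H-neg (H-* (x /ℕ d) H-d))))))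
      (ℕ.<⇒≱ r<d)

  #-step : ∀ {P Q : ℤ → Set} (P? : Decidable P) (Q? : Decidable Q) xs → # P? xs ≤ # (λ x → P? x ×-dec ¬? (Q? x)) xs + # Q? xs
  #-step P? Q? xs = #-∪ P? _ Q? xs (λ {x} _ p → case Q? x of λ where
    (yes q) → inj₂ q
    (no ¬q) → inj₁ (p , ¬q))

  -- Otherwise a translate of the core by 0 < δ < d would lie in J and consist almost entirely of
  -- residues of Y that are not residues of A.
  d∣T : ∀ {b} → b ∈ T → b ≈ 0ℤ [mod d ]
  d∣T {b} b∈ = go (b %ℕ d) (n%ℕd<d b d) (a≡a%ℕn+[a/ℕn]*n b d)
    where
    -- Seven tiny terms and the 2a / N lost in passing to the core add up to 9a / N, less than a
    -- because N ≥ 16.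
    contra : ∀ N a c g t d n z → 16 ≤ N → 0 < a → N * a ≤ N * c + 2 * a → c ≤ g + (t + (d + (t + (n + (1 + z))))) →
             N * g ≤ a → N * t ≤ a → N * d ≤ a → N * n ≤ a → N * 1 ≤ a → N * z ≤ a → ⊥
    contra N a c g t d n z N≥ a>0 h h₀ h₁ h₂ h₃ h₄ h₅ h₆ = ℕ.<⇒≱ a>0 (ℕ.*-cancelˡ-≤ 7 (lin 0
      (ℕ.+-mono-≤ (ℕ.*-monoˡ-≤ a N≥) (ℕ.+-mono-≤ h (ℕ.+-mono-≤ (ℕ.*-monoʳ-≤ N h₀) (ℕ.+-mono-≤ h₁ (ℕ.+-mono-≤ h₂ (ℕ.+-mono-≤ h₂ (ℕ.+-mono-≤ h₃ (ℕ.+-mono-≤ h₄ (ℕ.+-mono-≤ h₅ h₆)))))))))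
      (eq N a c g t d n z)))
      where
      eq : ∀ N a c g t d n z →
        7 * a + (N * a + ((N * c + 2 * a) + (N * (g + (t + (d + (t + (n + (1 + z)))))) + (a + (a + (a + (a + (a + (a + a))))))))) + 0 ≡
        7 * 0 + (16 * a + (N * a + (N * c + (N * g + (N * t + (N * t + (N * d + (N * n + (N * 1 + N * z)))))))))
      eq = ℕ-solve
    go : ∀ r → r < d → b ≡ + r ℤ.+ (b /ℕ d) ℤ.* + d → b ≈ 0ℤ [mod d ]
    go zero    _   b≡ = by (b /ℕ d) b≡
    go (suc r) r<d b≡ = ⊥-elim (contra N a (length core) (gain A Y b) (tp x₀) (D h) (# (λ x → ¬? (Typ? x)) A) (length zs)
        N-large a>0 core-large core≤ (gain-tiny b∈) (tp-tiny {x₀} x₀-typ) (D-tiny H-h) atypical-tiny 1-tiny (new-tiny zs-unique zs-new))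
      where
      δ h : ℤ
      δ = + suc r
      h = δ ℤ.- b
      b≈δ : b ≈ δ [mod d ]
      b≈δ = by (b /ℕ d) b≡
      H-h : H h
      H-h = d∣⇒H (≈-by (≈-sym b≈δ) (eq δ b))
        where
        eq : ∀ δ b → δ ℤ.- b ℤ.- 0ℤ ≡ δ ℤ.- b
        eq = ℤ-solve
      ¬H-δ : ¬ H δ
      ¬H-δ hδ with ≈-window (H⇒d∣ hδ) (ℤ.+≤+ r<d) (ℤ.+≤+ (s≤s z≤n))
      ... | ()
      -- Modulo m, the element x is followed through the conditions: x + b is in Y; x + b is in x₀ +
      -- T; x + δ is in x₀ + T; x + δ is in X; it is not in S; it is in J. Each passage loses few x.
      P₁? : Decidable (λ x → x ℤ.+ b ∈ Y)
      P₁? x = x ℤ.+ b ∈? Y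
      P₂? : Decidable (λ x → T̃ (x ℤ.+ b ℤ.- x₀))
      P₂? x = T̃? (x ℤ.+ b ℤ.- x₀)
      P₃? : Decidable (λ x → T̃ (x ℤ.+ δ ℤ.- x₀))
      P₃? x = T̃? (x ℤ.+ δ ℤ.- x₀)
      P₄? : Decidable (λ x → X (x ℤ.+ δ))
      P₄? x = X? (x ℤ.+ δ)
      P₅? : Decidable (λ x → X (x ℤ.+ δ) × ¬ S (x ℤ.+ δ))
      P₅? x = X? (x ℤ.+ δ) ×-dec ¬? (S? (x ℤ.+ δ))
      P₆? : Decidable (λ x → J (x ℤ.+ δ) × X (x ℤ.+ δ) × ¬ S (x ℤ.+ δ))
      P₆? x = J? (x ℤ.+ δ) ×-dec P₅? x
      inj : ∀ {P : ℤ → Set} {x x′} → x ∈ core → P x → x′ ∈ core → P x′ → x ≈ x′ → x ≡ x′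
      inj x∈ _ x′∈ _ = core-inj x∈ x′∈
      zs : List ℤ
      zs = map (ℤ._+ δ) (filter P₆? core)
      zs-unique : Unique zs
      zs-unique = Unique.map⁺ (λ {x} {y} → ∙-cancelʳ δ x y) (Unique.filter⁺ P₆? core-unique)
      zs-new : ∀ {z} → z ∈ zs → J z × X z × ¬ S z
      zs-new z∈ with ∈-map⁻ (ℤ._+ δ) z∈
      ... | x , x∈ , refl = proj₂ (∈-filter⁻ P₆? {xs = core} x∈)
      c₁ : # (λ x → ¬? (P₁? x)) core ≤ gain A Y b
      c₁ = #-rel _ _ _≡_ core-unique (λ x∈ p → _ , proj₁ (∈-core x∈) , p , refl) (λ { _ _ _ _ refl refl → refl })
      c₂ : # (λ x → P₁? x ×-dec ¬? (P₂? x)) core ≤ tp x₀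
      c₂ = ℕ.≤-trans (#-residues _ (λ r → X? r ×-dec ¬? (T̃? (r ℤ.- x₀))) core-unique inj
        (λ p (xX , ¬h) → Res-resp p xX , ¬h ∘ Res-resp (≈-+ʳ (ℤ.- x₀) (≈-sym p))) b
        (λ _ (y∈ , ¬t) → (_ , y∈ , ≈-refl) , ¬t)) (X∖[x+T] x₀)
      c₃ : # (λ x → P₂? x ×-dec ¬? (P₃? x)) core ≤ D h
      c₃ = #-mod {m} _ (λ b → ¬? (T̃? (b ℤ.+ h))) core-unique inj (b ℤ.- x₀)
        (λ { {x} _ ((b′ , b′∈ , b′≈) , ¬t) → b′ , b′∈ , (λ t → ¬t (Res-resp (≈-by b′≈ (e₁ b b′ x δ x₀)) t)) , ≈-by b′≈ (e₂ b b′ x x₀) })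
        where
        e₁ : ∀ b b′ x δ x₀ → b′ ℤ.+ (δ ℤ.- b) ℤ.- (x ℤ.+ δ ℤ.- x₀) ≡ b′ ℤ.- (x ℤ.+ b ℤ.- x₀)
        e₁ = ℤ-solve
        e₂ : ∀ b b′ x x₀ → b′ ℤ.- (x ℤ.+ (b ℤ.- x₀)) ≡ b′ ℤ.- (x ℤ.+ b ℤ.- x₀)
        e₂ = ℤ-solve
      c₄ : # (λ x → P₃? x ×-dec ¬? (P₄? x)) core ≤ tp x₀
      c₄ = ℕ.≤-trans (#-mod {m} _ (λ b → ¬? (X? (x₀ ℤ.+ b))) core-unique inj (δ ℤ.- x₀)
        (λ { {x} _ ((b′ , b′∈ , b′≈) , ¬x) → b′ , b′∈ , (λ xX → ¬x (Res-resp (≈-by b′≈ (e₁ b′ x δ x₀)) xX)) , ≈-by b′≈ (e₂ δ b′ x x₀) }))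
        ([x+T]∖X x₀)
        where
        e₁ : ∀ b′ x δ x₀ → x₀ ℤ.+ b′ ℤ.- (x ℤ.+ δ) ≡ b′ ℤ.- (x ℤ.+ δ ℤ.- x₀)
        e₁ = ℤ-solve
        e₂ : ∀ b b′ x x₀ → b′ ℤ.- (x ℤ.+ (b ℤ.- x₀)) ≡ b′ ℤ.- (x ℤ.+ b ℤ.- x₀)
        e₂ = ℤ-solve
      -- If x + δ is congruent to a typical x′ in A, then x′ - x is in H, and so is δ, against 0 < δ
      -- < d. Hence x′ is atypical.
      c₅ : # (λ x → P₄? x ×-dec ¬? (P₅? x)) core ≤ # (λ x → ¬? (Typ? x)) A
      c₅ = #-mod {m} _ (λ x → ¬? (Typ? x)) core-unique inj δ
        (λ {x} x∈ (xX , ¬new) → case S? (x ℤ.+ δ) of λ where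
          (no ¬s) → contradiction (xX , ¬s) ¬new
          (yes (x′ , x′∈ , x′≈)) → x′ , x′∈ ,
            (λ typ → ¬H-δ (H-resp (≈-by x′≈ (e₁ δ x x′ x₀)) (H-+ (H-typ {x′} typ) (H-neg (H-typ {x} (proj₁ (proj₂ (∈-core x∈)))))))) , x′≈)
        where
        e₁ : ∀ δ x x′ x₀ → (x′ ℤ.- x₀ ℤ.- (x ℤ.- x₀)) ℤ.- δ ≡ x′ ℤ.- (x ℤ.+ δ)
        e₁ = ℤ-solve
      -- The translate can leave J only at its upper end, past y⁻. Then y⁻ - d < x ≤ y⁻, and
      -- elements of the core agree modulo d, so there is at most one such x.
      c₆ : # (λ x → P₅? x ×-dec ¬? (P₆? x)) core ≤ 1
      c₆ = ℕ.≤-trans (#-rel {ys = 0ℤ ∷ []} _ (λ (_ : ℤ) → yes 0<1) (λ _ _ → 0 < 1) core-unique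
        (λ _ _ → 0ℤ , here refl , 0<1 , 0<1)
        (λ {x} {x′} x∈ p x′∈ p′ _ _ → ≈-window {d} (≈-by (H⇒d∣ (H-+ (H-typ′ x∈) (H-neg (H-typ′ x′∈)))) (e₁ x x′ x₀)) (close x∈ p x′∈ p′) (close x′∈ p′ x∈ p)))
        (#-≤length _ (0ℤ ∷ []))
        where
        0<1 : 0 < 1
        0<1 = s≤s z≤n
        e₁ : ∀ x x′ x₀ → x ℤ.- x′ ≡ (x ℤ.- x₀ ℤ.- (x′ ℤ.- x₀)) ℤ.- 0ℤ
        e₁ = ℤ-solve
        H-typ′ : ∀ {x} → x ∈ core → H (x ℤ.- x₀)
        H-typ′ {x} x∈ = H-typ {x} (proj₁ (proj₂ (∈-core x∈)))
        close : ∀ {x x′} → x ∈ core → (X (x ℤ.+ δ) × ¬ S (x ℤ.+ δ)) × ¬ (J (x ℤ.+ δ) × X (x ℤ.+ δ) × ¬ S (x ℤ.+ δ)) →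
                x′ ∈ core → (X (x′ ℤ.+ δ) × ¬ S (x′ ℤ.+ δ)) × ¬ (J (x′ ℤ.+ δ) × X (x′ ℤ.+ δ) × ¬ S (x′ ℤ.+ δ)) → x <′ x′ ℤ.+ + d
        close {x} {x′} x∈ _ x′∈ (new , ¬p) = ℤ.≤-trans (ℤ.+-monoʳ-≤ 1ℤ (proj₂ (proj₂ (proj₂ (∈-core x∈)))))
          (ℤ.≤-trans (≰⇒<′ (λ le → ¬p ((lower , le) , new))) (ℤ.+-monoʳ-≤ x′ (ℤ.+≤+ (ℕ.<⇒≤ r<d))))
          where
          lower : y⁺ <′ x′ ℤ.+ δ ℤ.+ + m
          lower = ℤ.≤-trans (proj₁ (proj₂ (proj₂ (∈-core x′∈)))) (ℤ.+-monoˡ-≤ (+ m) (ℤ.i≤i+j x′ δ))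
      c₇ : # P₆? core ≤ length zs
      c₇ = ℕ.≤-reflexive (trans (#-filter P₆? core) (sym (List.length-map (ℤ._+ δ) (filter P₆? core))))
      core≤ : length core ≤ gain A Y b + (tp x₀ + (D h + (tp x₀ + (# (λ x → ¬? (Typ? x)) A + (1 + length zs)))))
      core≤ = begin
        length core                                     ≡⟨ #-¬ P₁? core ⟨
        # P₁? core + # (λ x → ¬? (P₁? x)) core          ≡⟨ ℕ.+-comm (# P₁? core) _ ⟩
        # (λ x → ¬? (P₁? x)) core + # P₁? core          ≤⟨ ℕ.+-mono-≤ c₁ (chain P₁? P₂? c₂ (chain P₂? P₃? c₃ (chain P₃? P₄? c₄ (chain P₄? P₅? c₅ (chain P₅? P₆? c₆ c₇))))) ⟩
        gain A Y b + (tp x₀ + (D h + (tp x₀ + (# (λ x → ¬? (Typ? x)) A + (1 + length zs))))) ∎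
        where
        open ℕ.≤-Reasoning
        chain : ∀ {P Q : ℤ → Set} (P? : Decidable P) (Q? : Decidable Q) {x y} →
                # (λ x → P? x ×-dec ¬? (Q? x)) core ≤ x → # Q? core ≤ y → # P? core ≤ x + y
        chain P? Q? h h′ = ℕ.≤-trans (#-step P? Q? core) (ℕ.+-mono-≤ h h′)

  -- The progressions filled by T and by A

  L : List ℤ
  L = filter H? R

  gaps : ℕ
  gaps = # (λ x → H? x ×-dec ¬? (T̃? x)) R

  ∣L∣≤2t : length L ≤ 2 * t
  ∣L∣≤2t = begin
    length L       ≡⟨ #-filter H? R ⟨
    # H? R         ≤⟨ #-mono H? (W? (suc i)) R (λ {x} _ → H-W {x}) ⟩
    ω (suc i)      ≤⟨ ω≤2t (suc i) (2^≤p i<depth) ⟩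
    2 * t          ∎
    where open ℕ.≤-Reasoning

  ∣L∣≤t+gaps : length L ≤ t + gaps
  ∣L∣≤t+gaps = begin
    length L               ≡⟨ #-filter H? R ⟨
    # H? R                 ≤⟨ #-step H? T̃? R ⟩
    gaps + # T̃? R          ≤⟨ ℕ.+-monoʳ-≤ gaps (ℕ.≤-trans T̃≤ (#-≤length T̃? T)) ⟩
    gaps + t               ≡⟨ ℕ.+-comm gaps t ⟩
    t + gaps               ∎
    where
    open ℕ.≤-Reasoning
    T̃≤ : # T̃? R ≤ # T̃? T
    T̃≤ = #-mod {m} T̃? T̃? (ival-unique 0ℤ m) (λ x∈ _ x′∈ _ → residues-inj x∈ x′∈) 0ℤ
      (λ { {x} _ (b , b∈ , b≈) → b , b∈ , (b , b∈ , ≈-refl) , subst (b ≈_) (sym (ℤ.+-identityʳ x)) b≈ })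

  -- For every b in `T` and every gap x, the element x - b of `H` moves b out of `T`. Thus t times
  -- the number of gaps is at most the sum of `D` over the residues in `H`, of which there are at
  -- most 2t.
  gaps-tiny : Tiny gaps
  gaps-tiny = tiny (2 ^ (2 + depth) * k) {{ℕ.m*n≢0 (2 ^ (2 + depth)) k {{ℕ.m^n≢0 2 (2 + depth)}}}} p-large
    (ℕ.*-cancelʳ-≤ (p * gaps) (2 ^ (2 + depth) * k * a) t (begin
      p * gaps * t                          ≡⟨ e₁ p gaps t ⟩
      p * (t * gaps)                        ≡⟨ cong (p *_) (Σ-const gaps T) ⟨
      p * Σ[ T ] (λ _ → gaps)               ≤⟨ ℕ.*-monoʳ-≤ p (Σ-mono T (λ b∈ → translate b∈)) ⟩
      p * Σ[ T ] (λ b → # (λ h → ¬? (T̃? (b ℤ.+ h))) L)   ≡⟨ cong (p *_) (#-swap (λ b h → ¬? (T̃? (b ℤ.+ h))) T L) ⟩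
      p * Σ[ L ] D                          ≡⟨ Σ-* p D L ⟨
      Σ[ L ] (λ h → p * D h)                ≤⟨ Σ-mono L (λ {x} x∈ → H-W {x} (proj₂ (∈-filter⁻ H? {xs = R} x∈))) ⟩
      Σ[ L ] (λ _ → 2 ^ (2 + i) * t)        ≡⟨ Σ-const (2 ^ (2 + i) * t) L ⟩
      length L * (2 ^ (2 + i) * t)          ≤⟨ ℕ.*-monoˡ-≤ (2 ^ (2 + i) * t) ∣L∣≤2t ⟩
      2 * t * (2 ^ (2 + i) * t)             ≡⟨ e₂ t (2 ^ (2 + i)) ⟩
      2 * 2 ^ (2 + i) * t * t               ≤⟨ ℕ.*-monoˡ-≤ t (ℕ.*-mono-≤ {2 ^ (3 + i)} {2 ^ (2 + depth)} (ℕ.^-monoʳ-≤ 2 (s≤s (s≤s i<depth))) t≤ka) ⟩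
      2 ^ (2 + depth) * (k * a) * t         ≡⟨ cong (_* t) (ℕ.*-assoc (2 ^ (2 + depth)) k a) ⟨
      2 ^ (2 + depth) * k * a * t           ∎))
    where
    open ℕ.≤-Reasoning
    e₁ : ∀ p g t → p * g * t ≡ p * (t * g)
    e₁ = ℕ-solve
    e₂ : ∀ t x → 2 * t * (x * t) ≡ 2 * x * t * t
    e₂ = ℕ-solve
    translate : ∀ {b} → b ∈ T → gaps ≤ # (λ h → ¬? (T̃? (b ℤ.+ h))) L
    translate {b} b∈ = #-mod {m} _ _ (ival-unique 0ℤ m) (λ x∈ _ x′∈ _ → residues-inj x∈ x′∈) (ℤ.- b)
      (λ {x} _ (hx , ¬t) → target x hx ¬t (residue m (x ℤ.- b)))
      where
      eq : ∀ b r x → b ℤ.+ r ℤ.- x ≡ r ℤ.- (x ℤ.- b)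
      eq = ℤ-solve
      target : ∀ x → H x → ¬ T̃ x → ∃[ r ] r ∈ R × r ≈ x ℤ.- b → ∃[ r ] r ∈ L × ¬ T̃ (b ℤ.+ r) × r ≈ x ℤ.- b
      target x hx ¬t (r , r∈ , r≈) = r , ∈-filter⁺ H? r∈ (H-resp (≈-sym r≈) (H-+ hx (H-neg (d∣⇒H (d∣T b∈))))) ,
        ¬t ∘ Res-resp (≈-by r≈ (eq b r x)) , r≈

  abstract
    divisor : ∃[ n ] m ≡ n * d
    divisor = from (H⇒d∣ H-m)
      where
      from : + m ≈ 0ℤ [mod d ] → ∃[ n ] m ≡ n * d
      from (by z m≡) = ℤ.∣ z ∣ , trans (cong ℤ.∣_∣ (trans m≡ (ℤ.+-identityˡ (z ℤ.* + d)))) (ℤ.abs-* z (+ d))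

  m′ : ℕ
  m′ = proj₁ divisor

  m≡m′d : m ≡ m′ * d
  m≡m′d = proj₂ divisor

  m′≤∣L∣ : m′ ≤ length L
  m′≤∣L∣ = subst (_≤ length L) (List.length-upTo m′) (length-rel {R = λ n y → y ≡ + (n * d)} (Unique.upTo⁺ m′)
    (λ {n} n∈ → + (n * d) , ∈-filter⁺ H? (∈-ival⁺ {l = 0ℤ} {n = m} (ℤ.+≤+ z≤n)
        (ℤ.+≤+ (subst (n * d <_) (sym m≡m′d) (ℕ.*-monoˡ-< d (∈-upTo⁻ n∈)))))
        (subst H (sym (ℤ.pos-* n d)) (H-* (+ n) H-d)) , refl)
    (λ { {x} {x′} _ _ refl eq → ℕ.*-cancelʳ-≡ x x′ d (ℤ.+-injective eq) }))

  -- As z - x₀ is a multiple of d, z is usually in x₀ + T, hence in X, and hence in S since `J`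
  -- contains few new residues. An element of `A` congruent to z differs from z and therefore lies
  -- outside `J`. Each of the four losses is tiny.
  holes-tiny : ∀ {zs} → Unique zs → (∀ {z} → z ∈ zs → J z × z ≈ x₀ [mod d ] × z ∉ A) → N * length zs ≤ 4 * a
  holes-tiny {zs} uniq h = arith N a (length zs) gaps (tp x₀) (# (λ x → ¬? (J? x)) A) (length news)
      total gaps-tiny (tp-tiny {x₀} x₀-typ) outside-tiny (new-tiny (Unique.filter⁺ New? uniq) new)
    where
    open ℕ.≤-Reasoning
    inj : ∀ {P : ℤ → Set} {z z′} → z ∈ zs → P z → z′ ∈ zs → P z′ → z ≈ z′ → z ≡ z′
    inj z∈ _ z′∈ _ = J-inj (proj₁ (h z∈)) (proj₁ (h z′∈))
    New? : Decidable (λ z → X z × ¬ S z)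
    New? z = X? z ×-dec ¬? (S? z)
    T̃₀? : Decidable (λ z → T̃ (z ℤ.- x₀))
    T̃₀? z = T̃? (z ℤ.- x₀)
    news : List ℤ
    news = filter New? zs
    new : ∀ {z} → z ∈ news → J z × X z × ¬ S z
    new z∈ = let z∈zs , n = ∈-filter⁻ New? {xs = zs} z∈ in proj₁ (h z∈zs) , n
    c₁ : # (λ z → ¬? (T̃₀? z)) zs ≤ gaps
    c₁ = #-residues _ _ uniq inj (λ p (hx , ¬t) → H-resp p hx , ¬t ∘ Res-resp (≈-sym p)) (ℤ.- x₀)
      (λ {z} z∈ ¬t → d∣⇒H (≈-by (proj₁ (proj₂ (h z∈))) (eq z x₀)) , ¬t)
      where
      eq : ∀ z x → z ℤ.- x ℤ.- 0ℤ ≡ z ℤ.- x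
      eq = ℤ-solve
    c₂ : # (λ z → T̃₀? z ×-dec ¬? (X? z)) zs ≤ tp x₀
    c₂ = ℕ.≤-trans (#-mod {m} _ (λ b → ¬? (X? (x₀ ℤ.+ b))) uniq inj (ℤ.- x₀)
      (λ { {z} _ ((b , b∈ , b≈) , ¬x) → b , b∈ , (λ xX → ¬x (Res-resp (≈-by b≈ (eq b z x₀)) xX)) , b≈ }))
      ([x+T]∖X x₀)
      where
      eq : ∀ b z x₀ → x₀ ℤ.+ b ℤ.- z ≡ b ℤ.- (z ℤ.- x₀)
      eq = ℤ-solve
    c₃ : # (λ z → X? z ×-dec ¬? (New? z)) zs ≤ # (λ x → ¬? (J? x)) A
    c₃ = #-mod {m} _ (λ x → ¬? (J? x)) uniq inj 0ℤ (λ {z} z∈ (xX , ¬new) → case S? z of λ where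
      (no ¬s) → contradiction (xX , ¬s) ¬new
      (yes (x , x∈ , x≈)) → x , x∈ ,
        (λ j → proj₂ (proj₂ (h z∈)) (subst (_∈ A) (J-inj j (proj₁ (h z∈)) x≈) x∈)) ,
        subst (x ≈_) (sym (ℤ.+-identityʳ z)) x≈)
    total : length zs ≤ gaps + (tp x₀ + (# (λ x → ¬? (J? x)) A + length news))
    total = begin
      length zs                                       ≡⟨ #-¬ T̃₀? zs ⟨
      # T̃₀? zs + # (λ z → ¬? (T̃₀? z)) zs              ≡⟨ ℕ.+-comm (# T̃₀? zs) _ ⟩
      # (λ z → ¬? (T̃₀? z)) zs + # T̃₀? zs              ≤⟨ ℕ.+-mono-≤ c₁ (ℕ.≤-trans (#-step T̃₀? X? zs)
                                                           (ℕ.+-mono-≤ c₂ (ℕ.≤-trans (#-step X? New? zs)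
                                                             (ℕ.+-mono-≤ c₃ (ℕ.≤-reflexive (#-filter New? zs)))))) ⟩
      gaps + (tp x₀ + (# (λ x → ¬? (J? x)) A + length news)) ∎
    arith : ∀ N a z g t o n → z ≤ g + (t + (o + n)) → N * g ≤ a → N * t ≤ a → N * o ≤ a → N * n ≤ a → N * z ≤ 4 * a
    arith N a z g t o n h₀ h₁ h₂ h₃ h₄ = lin 0 (ℕ.+-mono-≤ (ℕ.*-monoʳ-≤ N h₀) (ℕ.+-mono-≤ h₁ (ℕ.+-mono-≤ h₂ (ℕ.+-mono-≤ h₃ h₄)))) (eq N a z g t o n)
      where
      eq : ∀ N a z g t o n → N * z + (N * (g + (t + (o + n))) + (a + (a + (a + a)))) + 0 ≡
                             4 * a + (N * z + (N * g + (N * t + (N * o + N * n))))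
      eq = ℕ-solve

  position : ℤ → ℤ
  position z = x₀ ℤ.+ z ℤ.* + d

  position-mono : ∀ {z z′} → z ℤ.≤ z′ → position z ℤ.≤ position z′
  position-mono le = ℤ.+-monoʳ-≤ x₀ (ℤ.*-monoʳ-≤-nonNeg (+ d) le)

  position-reflects : ∀ {z z′} → position z ℤ.≤ position z′ → z ℤ.≤ z′
  position-reflects {z} {z′} le = ℤ.*-cancelʳ-≤-pos z z′ (+ d) (linℤ le (eq x₀ _ _))
    where
    eq : ∀ x y z → y ℤ.- z ≡ x ℤ.+ y ℤ.- (x ℤ.+ z)
    eq = ℤ-solve

  position-injective : ∀ {z z′} → position z ≡ position z′ → z ≡ z′
  position-injective eq = ℤ.≤-antisym (position-reflects (ℤ.≤-reflexive eq)) (position-reflects (ℤ.≤-reflexive (sym eq)))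

  core-position : ∀ {x} → x ∈ core → ∃[ z ] x ≡ position z
  core-position {x} x∈ = from (H⇒d∣ (H-typ {x} (proj₁ (proj₂ (∈-core x∈)))))
    where
    eq : ∀ x y z → x ≡ y ℤ.+ (x ℤ.- y)
    eq = ℤ-solve
    from : x ℤ.- x₀ ≈ 0ℤ [mod d ] → ∃[ z ] x ≡ position z
    from (by z x≡) = z , trans (eq x x₀ z) (cong (λ y → x₀ ℤ.+ y) (trans x≡ (ℤ.+-identityˡ _)))

  Interval : Set
  Interval = ∃[ l ] ∃[ n ] n ≤ m′ ×
    N * a ≤ N * # (λ z → position z ∈? A) (ival l n) + 2 * a ×
    N * # (λ z → ¬? (position z ∈? A)) (ival l n) ≤ 4 * a

  -- `J` is an interval, so the whole hull of the core lies in it and `holes-tiny` applies; its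
  -- length is at most m, which gives n ≤ m′.
  core-hull : ∀ l r → position l ∈ core → position r ∈ core →
    (∀ {y} → y ∈ core → position l ℤ.≤ y) → (∀ {y} → y ∈ core → y ℤ.≤ position r) → Interval
  core-hull l r l∈ r∈ least greatest = l , n , n≤m′ ,
    ℕ.≤-trans core-large (ℕ.+-monoˡ-≤ (2 * a) (ℕ.*-monoʳ-≤ N many)) ,
    ℕ.≤-trans (ℕ.≤-reflexive (cong (N *_) (trans (#-filter Hole? (ival l n)) (sym (List.length-map position (filter Hole? (ival l n)))))))
      (holes-tiny (Unique.map⁺ (λ {z} {z′} → position-injective {z} {z′}) (Unique.filter⁺ Hole? (ival-unique l n))) hole)
    where
    l≤r : l ℤ.≤ r
    l≤r = position-reflects (least r∈)
    n : ℕ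
    n = suc ℤ.∣ r ℤ.- l ∣
    +n≡ : + n ≡ 1ℤ ℤ.+ (r ℤ.- l)
    +n≡ = cong (λ z → 1ℤ ℤ.+ z) (ℤ.0≤i⇒+∣i∣≡i (ℤ.i≤j⇒0≤j-i l≤r))
    l+n≡ : l ℤ.+ + n ≡ 1ℤ ℤ.+ r
    l+n≡ = trans (cong (λ z → l ℤ.+ z) +n≡) (eq l r)
      where
      eq : ∀ l r → l ℤ.+ (1ℤ ℤ.+ (r ℤ.- l)) ≡ 1ℤ ℤ.+ r
      eq = ℤ-solve
    Jl : J (position l)
    Jl = proj₂ (proj₂ (∈-core l∈))
    Jr : J (position r)
    Jr = proj₂ (proj₂ (∈-core r∈))
    n≤m′ : n ≤ m′
    n≤m′ = ℤ.drop‿+≤+ (subst (ℤ._≤ + m′) (sym +n≡) (ℤ.i<j⇒suc[i]≤j (ℤ.*-cancelʳ-<-nonNeg {r ℤ.- l} {+ m′} (+ d)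
      (ℤ.suc[i]≤j⇒i<j (linℤ {1ℤ ℤ.+ position r} {position l ℤ.+ + m} spread
        (trans (cong (λ y → (1ℤ ℤ.+ (r ℤ.- l) ℤ.* + d) ℤ.- y) m≡) (eq x₀ l r (+ d) (+ m))))))))
      where
      spread : 1ℤ ℤ.+ position r ℤ.≤ position l ℤ.+ + m
      spread = ℤ.≤-trans (ℤ.+-monoʳ-≤ 1ℤ (ℤ.≤-trans (proj₂ Jr) y⁻≤y⁺)) (proj₁ Jl)
      m≡ : + m′ ℤ.* + d ≡ + m
      m≡ = trans (sym (ℤ.pos-* m′ d)) (cong (λ y → + y) (sym m≡m′d))
      eq : ∀ x l r d m → (1ℤ ℤ.+ (r ℤ.- l) ℤ.* d) ℤ.- m ≡ 1ℤ ℤ.+ (x ℤ.+ r ℤ.* d) ℤ.- (x ℤ.+ l ℤ.* d ℤ.+ m)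
      eq = ℤ-solve
    In? : Decidable (λ z → position z ∈ A)
    In? z = position z ∈? A
    Hole? : Decidable (λ z → position z ∉ A)
    Hole? z = ¬? (In? z)
    many : length core ≤ # In? (ival l n)
    many = ℕ.≤-trans (#-all (_∈? A) core (λ x∈ → proj₁ (∈-core x∈))) (#-rel (_∈? A) In? (λ x z → x ≡ position z) core-unique
      (λ {y} y∈ y∈A → found y∈ y∈A (core-position y∈)) (λ { _ _ _ _ refl refl → refl }))
      where
      found : ∀ {y} → y ∈ core → y ∈ A → ∃[ z ] y ≡ position z → ∃[ z ] z ∈ ival l n × position z ∈ A × y ≡ position z
      found y∈ y∈A (z , refl) = z , ∈-ival⁺ {l = l} {n = n} (position-reflects (least y∈))
        (subst (z <′_) (sym l+n≡) (ℤ.+-monoʳ-≤ 1ℤ (position-reflects {z} {r} (greatest y∈)))) , y∈A , refl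
    hole : ∀ {y} → y ∈ map position (filter Hole? (ival l n)) → J y × y ≈ x₀ [mod d ] × y ∉ A
    hole y∈ = from (∈-map⁻ position y∈)
      where
      eq : ∀ z r → z ℤ.- r ≡ 1ℤ ℤ.+ z ℤ.- (1ℤ ℤ.+ r)
      eq = ℤ-solve
      from : ∀ {y} → ∃[ z ] z ∈ filter Hole? (ival l n) × y ≡ position z → J y × y ≈ x₀ [mod d ] × y ∉ A
      from (z , z∈ , refl) = let z∈ival , ∉A = ∈-filter⁻ Hole? {xs = ival l n} z∈
                                 l≤z , z<l+n = ∈-ival⁻ {l = l} {n = n} z∈ival
                                 z≤r = linℤ {c = z} {d = r} (subst (z <′_) l+n≡ z<l+n) (eq z r)
        in (ℤ.≤-trans (proj₁ Jl) (ℤ.+-monoˡ-≤ (+ m) (position-mono {l} {z} l≤z)) , ℤ.≤-trans (position-mono {z} {r} z≤r) (proj₂ Jr)) , by z refl , ∉A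

  abstract
    interval : Interval
    interval = from (minimum always? (proj₂ core-inhabited) (s≤s z≤n)) (maximum always? (proj₂ core-inhabited) (s≤s z≤n))
      where
      Always : ℤ → Set
      Always _ = 0 < 1
      always? : Decidable Always
      always? _ = yes (s≤s z≤n)
      from : ∃[ x ] x ∈ core × 0 < 1 × (∀ {y} → y ∈ core → 0 < 1 → x ℤ.≤ y) →
             ∃[ x ] x ∈ core × 0 < 1 × (∀ {y} → y ∈ core → 0 < 1 → y ℤ.≤ x) → Interval
      from (x , x∈ , _ , least) (x′ , x′∈ , _ , greatest) = hull (core-position x∈) (core-position x′∈)
        where
        hull : ∃[ z ] x ≡ position z → ∃[ z ] x′ ≡ position z → Interval
        hull (l , x≡) (r , x′≡) = core-hull l r (subst (_∈ core) x≡ x∈) (subst (_∈ core) x′≡ x′∈)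
          (λ {y} y∈ → subst (ℤ._≤ y) x≡ (least y∈ (s≤s z≤n))) (λ {y} y∈ → subst (y ℤ.≤_) x′≡ (greatest y∈ (s≤s z≤n)))

  structure : ArithmeticStructure N k m A T
  structure = record
    { d           = d
    ; m≡m′d       = m≡m′d
    ; x₀          = x₀
    ; l           = proj₁ interval
    ; n           = proj₁ (proj₂ interval)
    ; d∣T         = d∣T
    ; m′≤2t       = ℕ.≤-trans m′≤∣L∣ ∣L∣≤2t
    ; m′≤t+gaps   = ℕ.≤-trans m′≤∣L∣ ∣L∣≤t+gaps
    ; gaps-small  = gaps-tiny
    ; 1-small     = 1-tiny
    ; n≤m′        = proj₁ (proj₂ (proj₂ interval))
    ; many        = proj₁ (proj₂ (proj₂ (proj₂ interval)))
    ; few         = proj₂ (proj₂ (proj₂ (proj₂ interval)))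
    }

-- Dense sets of integers

Hit : List ℤ → List ℤ → ℤ → Set
Hit A bs x = ∃[ b ] b ∈ bs × x ℤ.- b ∈ A

abstract
  Hit? : ∀ A bs → Decidable (Hit A bs)
  Hit? A bs x = map′ find (λ (_ , b∈ , h) → lose b∈ h) (any? (λ b → x ℤ.- b ∈? A) bs)

Hit-mono : ∀ {A bs bs′ x} → bs ⊆ bs′ → Hit A bs x → Hit A bs′ x
Hit-mono bs⊆ (b , b∈ , h) = b , bs⊆ b∈ , h

Hit-sums : ∀ {A bs x} → Hit A bs x → x ∈ sums A bs
Hit-sums {A} {bs} {x} (b , b∈ , h) = subst (_∈ sums A bs) (eq x b) (∈-sums⁺ h b∈)
  where
  eq : ∀ x b → x ℤ.- b ℤ.+ b ≡ x
  eq = ℤ-solve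

Σ-max-∈ : ∀ (f : ℤ → ℕ) {x xs} → x ∈ xs → ∃[ y ] y ∈ xs × Σ[ xs ] f ≤ length xs * f y
Σ-max-∈ f {xs = x ∷ xs} _ = Σ-max f x xs

-- By averaging, some element of C hits an eighth of any given part of Q.
module Cover (A C Q : List ℤ) {b₁ : ℤ} (b₁∈ : b₁ ∈ C)
             (popular : ∀ {x} → x ∈ Q → length C ≤ 8 * # (λ b → x ℤ.- b ∈? A) C) where

  missed : List ℤ → ℕ
  missed bs = # (λ x → ¬? (Hit? A bs x)) Q

  cover-step : ∀ bs → ∃[ b ] b ∈ C × 8 * missed (b ∷ bs) ≤ 7 * missed bs
  cover-step bs = from (Σ-max-∈ f b₁∈)
    where
    open ℕ.≤-Reasoning
    instance
      C≢0 : NonZero (length C)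
      C≢0 = >-nonZero (∈-length b₁∈)
    New? : ∀ b → Decidable (λ x → ¬ Hit A bs x × x ℤ.- b ∈ A)
    New? b x = ¬? (Hit? A bs x) ×-dec (x ℤ.- b ∈? A)
    f : ℤ → ℕ
    f b = # (New? b) Q
    total : missed bs * length C ≤ 8 * Σ[ C ] f
    total = begin
      missed bs * length C                                ≤⟨ Σ-# (λ x → ¬? (Hit? A bs x)) (λ x → 8 * # (λ b → New? b x) C) (length C) Q
                                                               (λ x∈ ¬h → ℕ.≤-trans (popular x∈) (ℕ.*-monoʳ-≤ 8 (#-mono _ _ C (λ _ h → ¬h , h)))) ⟩
      Σ[ Q ] (λ x → 8 * # (λ b → New? b x) C)             ≡⟨ Σ-* 8 _ Q ⟩
      8 * Σ[ Q ] (λ x → # (λ b → New? b x) C)             ≡⟨ cong (8 *_) (#-swap (λ x b → New? b x) Q C) ⟩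
      8 * Σ[ C ] f                                        ∎
    from : ∃[ b ] b ∈ C × Σ[ C ] f ≤ length C * f b → ∃[ b ] b ∈ C × 8 * missed (b ∷ bs) ≤ 7 * missed bs
    from (b , b∈ , le) = b , b∈ , lin 0 (ℕ.+-mono-≤ (ℕ.*-monoʳ-≤ 8 split) many) (eq (missed (b ∷ bs)) (f b) (missed bs))
      where
      split : missed (b ∷ bs) + f b ≤ missed bs
      split = #-disjoint _ _ _ Q (λ {x} _ ¬h h → ¬h (Hit-mono {x = x} there h)) (λ _ → proj₁) (λ _ ¬h (_ , h) → ¬h (b , here refl , h))
      e₁ : ∀ c f → 8 * (c * f) ≡ 8 * f * c
      e₁ = ℕ-solve
      many : missed bs ≤ 8 * f b
      many = ℕ.*-cancelʳ-≤ (missed bs) (8 * f b) (length C) (begin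
        missed bs * length C       ≤⟨ total ⟩
        8 * Σ[ C ] f               ≤⟨ ℕ.*-monoʳ-≤ 8 le ⟩
        8 * (length C * f b)       ≡⟨ e₁ (length C) (f b) ⟩
        8 * f b * length C         ∎)
      eq : ∀ x f y → 8 * x + (8 * y + 8 * f) + 0 ≡ 7 * y + (8 * (x + f) + y)
      eq = ℕ-solve

  cover : ∀ K bs → bs ⊆ C → ∃[ bs′ ] bs′ ⊆ C × length bs′ ≤ K + length bs × 8 ^ K * missed bs′ ≤ 7 ^ K * missed bs
  cover zero    bs bs⊆ = bs , bs⊆ , ℕ.≤-refl , ℕ.≤-refl
  cover (suc K) bs bs⊆ = from (cover-step bs)
    where
    open ℕ.≤-Reasoning
    eq : ∀ x y → 8 * x * y ≡ x * y * 8
    eq = ℕ-solve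
    e₁ : ∀ x y → x * y * 8 ≡ x * (8 * y)
    e₁ = ℕ-solve
    e₂ : ∀ x y → x * (7 * y) ≡ 7 * x * y
    e₂ = ℕ-solve
    from : ∃[ b ] b ∈ C × 8 * missed (b ∷ bs) ≤ 7 * missed bs →
           ∃[ bs′ ] bs′ ⊆ C × length bs′ ≤ suc K + length bs × 8 ^ suc K * missed bs′ ≤ 7 ^ suc K * missed bs
    from (b , b∈ , le) = let bs′ , sub , len , le′ = cover K (b ∷ bs) (λ { (here refl) → b∈ ; (there p) → bs⊆ p }) in
      bs′ , sub , ℕ.≤-trans len (ℕ.≤-reflexive (ℕ.+-suc K (length bs))) , (begin
        8 * 8 ^ K * missed bs′           ≡⟨ eq (8 ^ K) (missed bs′) ⟩
        8 ^ K * missed bs′ * 8           ≤⟨ ℕ.*-monoˡ-≤ 8 le′ ⟩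
        7 ^ K * missed (b ∷ bs) * 8      ≡⟨ e₁ (7 ^ K) (missed (b ∷ bs)) ⟩
        7 ^ K * (8 * missed (b ∷ bs))    ≤⟨ ℕ.*-monoʳ-≤ (7 ^ K) le ⟩
        7 ^ K * (7 * missed bs)          ≡⟨ e₂ (7 ^ K) (missed bs) ⟩
        7 * 7 ^ K * missed bs            ∎)

-- Bernoulli's inequality (8/7)^K ≥ 1 + K / 7 without fractions. With K = 7c, averaging K times
-- divides the missed set by at least c.
bernoulli : ∀ K → (7 + K) * 7 ^ K ≤ 7 * 8 ^ K
bernoulli zero    = ℕ.≤-refl
bernoulli (suc K) = lin (K * 7 ^ K) (ℕ.*-monoʳ-≤ 8 (bernoulli K)) (eq K (7 ^ K) (8 ^ K))
  where
  eq : ∀ K x y → (7 + suc K) * (7 * x) + 8 * (7 * y) + K * x ≡ 7 * (8 * y) + 8 * ((7 + K) * x)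
  eq = ℕ-solve

8^≥c*7^ : ∀ c → c * 7 ^ (7 * c) ≤ 8 ^ (7 * c)
8^≥c*7^ c = ℕ.*-cancelˡ-≤ 7 (ℕ.≤-trans (lin (7 * 7 ^ (7 * c)) ℕ.≤-refl (eq c (7 ^ (7 * c)))) (bernoulli (7 * c)))
  where
  eq : ∀ c x → 7 * (c * x) + 0 + 7 * x ≡ (7 + 7 * c) * x + 0
  eq = ℕ-solve

∈-ival-ℕ : ∀ {l o len y} → o ≤ y → y < o + len → l ℤ.+ + y ∈ ival (l ℤ.+ + o) len
∈-ival-ℕ {l} {o} {len} {y} o≤y y< = ∈-ival⁺ (ℤ.+-monoʳ-≤ l (ℤ.+≤+ o≤y)) (linℤ (ℤ.+≤+ y<) (eq l (+ o) (+ len) (+ y)))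
  where
  eq : ∀ l o len y → 1ℤ ℤ.+ (l ℤ.+ y) ℤ.- (l ℤ.+ o ℤ.+ len) ≡ 1ℤ ℤ.+ y ℤ.- (o ℤ.+ len)
  eq = ℤ-solve

∈-ival-ℕ⁻ : ∀ {l n x} → x ∈ ival l n → ∃[ y ] y < n × x ≡ l ℤ.+ + y
∈-ival-ℕ⁻ x∈ = let y , y∈ , eq = ∈-map⁻ _ x∈ in y , ∈-upTo⁻ y∈ , eq

module _ (A : List ℤ) where

  inside holes : ℤ → ℕ → ℕ
  inside l n = # (_∈? A) (ival l n)
  holes l n = # (λ x → ¬? (x ∈? A)) (ival l n)

  inside+holes : ∀ l n → inside l n + holes l n ≡ n
  inside+holes l n = trans (#-¬ (_∈? A) (ival l n)) (length-ival l n)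

  inside-+ : ∀ l x y → inside l (x + y) ≤ inside l x + inside (l ℤ.+ + x) y
  inside-+ l x y = ℕ.≤-trans
    (#-rel {ys = ival l x ++ ival (l ℤ.+ + x) y} (_∈? A) (_∈? A) _≡_ (ival-unique l (x + y))
      (λ {z} z∈ p → z , member z∈ , p , refl) (λ { _ _ _ _ refl refl → refl }))
    (ℕ.≤-reflexive (#-++ (_∈? A) (ival l x) (ival (l ℤ.+ + x) y)))
    where
    member : ∀ {z} → z ∈ ival l (x + y) → z ∈ ival l x ++ ival (l ℤ.+ + x) y
    member z∈ with ∈-ival-ℕ⁻ {l} {x + y} z∈
    ... | i , i< , refl with i ℕ.<? x
    ...   | yes i<x = ∈-++⁺ˡ (∈-map⁺ _ (∈-upTo⁺ i<x))
    ...   | no i≮x  = ∈-++⁺ʳ (ival l x) (∈-ival-ℕ {l} (ℕ.≮⇒≥ i≮x) i<)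

  Dense : ℤ → ℕ → Set
  Dense l n = 16 * holes l n ≤ inside l n

  Dense? : ∀ l n → Dec (Dense l n)
  Dense? l n = 16 * holes l n ℕ.≤? inside l n

  DenseEnds : ℤ → ℕ → Set
  DenseEnds l n = ∀ {x y} → x + y ≡ n → Dense l x × Dense (l ℤ.+ + x) y

  -- The inequality inside - 16 holes ≥ a / 2, freed of subtraction and fractions. The 16 is that of
  -- `Dense`, so a discarded sparse segment contributes at most 0 to the left side.
  Rich : ℕ → ℤ → ℕ → Set
  Rich a l n = a + 32 * holes l n ≤ 2 * inside l n

  rich-suffix : ∀ {a l} x y → ¬ Dense l x → Rich a l (x + y) → Rich a (l ℤ.+ + x) y
  rich-suffix {a} {l} x y ¬dense rich = arith a _ _ _ _ _ _ x y (inside+holes l (x + y)) (inside+holes l x) (inside+holes (l ℤ.+ + x) y) (inside-+ l x y) (ℕ.≰⇒≥ ¬dense) rich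
    where
    arith : ∀ a c h c₁ h₁ c₂ h₂ x y → c + h ≡ x + y → c₁ + h₁ ≡ x → c₂ + h₂ ≡ y → c ≤ c₁ + c₂ → c₁ ≤ 16 * h₁ →
            a + 32 * h ≤ 2 * c → a + 32 * h₂ ≤ 2 * c₂
    arith a c h c₁ h₁ c₂ h₂ x y e refl refl p q r = lin 0
      (ℕ.+-mono-≤ (ℕ.+-mono-≤ (ℕ.*-monoʳ-≤ 34 p) (ℕ.*-monoʳ-≤ 2 q)) (ℕ.+-mono-≤ r (ℕ.*-monoʳ-≤ 32 (ℕ.≤-reflexive (sym e)))))
      (eq a c h c₁ h₁ c₂ h₂)
      where
      eq : ∀ a c h c₁ h₁ c₂ h₂ →
        a + 32 * h₂ + ((34 * (c₁ + c₂) + 2 * (16 * h₁)) + (2 * c + 32 * (c + h))) + 0 ≡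
        2 * c₂ + ((34 * c + 2 * c₁) + ((a + 32 * h) + 32 * (c₁ + h₁ + (c₂ + h₂))))
      eq = ℕ-solve

  rich-prefix : ∀ {a l} x y → ¬ Dense (l ℤ.+ + x) y → Rich a l (x + y) → Rich a l x
  rich-prefix {a} {l} x y ¬dense rich = arith a _ _ _ _ _ _ x y (inside+holes l (x + y)) (inside+holes l x) (inside+holes (l ℤ.+ + x) y) (inside-+ l x y) (ℕ.≰⇒≥ ¬dense) rich
    where
    arith : ∀ a c h c₁ h₁ c₂ h₂ x y → c + h ≡ x + y → c₁ + h₁ ≡ x → c₂ + h₂ ≡ y → c ≤ c₁ + c₂ → c₂ ≤ 16 * h₂ →
            a + 32 * h ≤ 2 * c → a + 32 * h₁ ≤ 2 * c₁
    arith a c h c₁ h₁ c₂ h₂ x y e refl refl p q r = lin 0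
      (ℕ.+-mono-≤ (ℕ.+-mono-≤ (ℕ.*-monoʳ-≤ 34 p) (ℕ.*-monoʳ-≤ 2 q)) (ℕ.+-mono-≤ r (ℕ.*-monoʳ-≤ 32 (ℕ.≤-reflexive (sym e)))))
      (eq a c h c₁ h₁ c₂ h₂)
      where
      eq : ∀ a c h c₁ h₁ c₂ h₂ →
        a + 32 * h₁ + ((34 * (c₁ + c₂) + 2 * (16 * h₂)) + (2 * c + 32 * (c + h))) + 0 ≡
        2 * c₁ + ((34 * c + 2 * c₂) + ((a + 32 * h) + 32 * (c₁ + h₁ + (c₂ + h₂))))
      eq = ℕ-solve

  dense-0 : ∀ l → Dense l 0
  dense-0 l = ℕ.≤-trans (ℕ.*-monoʳ-≤ 16 (ℕ.m+n≤o⇒n≤o (inside l 0) (ℕ.≤-reflexive (inside+holes l 0)))) z≤n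

  -- Cutting off a sparse initial or final segment increases inside − 16 holes.
  trim : ∀ {a} f l n → n ≤ f → Rich a l n → ∃[ l′ ] ∃[ n′ ] n′ ≤ n × Rich a l′ n′ × DenseEnds l′ n′
  trim zero    l zero z≤n rich = l , zero , z≤n , rich , ends
    where
    ends : DenseEnds l 0
    ends {zero} {zero} refl = dense-0 l , dense-0 (l ℤ.+ + 0)
  trim {a} (suc f) l n n≤f rich = search (any? Sparse? (upTo (suc n)))
    where
    Sparse : ℕ → Set
    Sparse x = ¬ (Dense l x × Dense (l ℤ.+ + x) (n ∸ x))
    Sparse? : Decidable Sparse
    Sparse? x = ¬? (Dense? l x ×-dec Dense? (l ℤ.+ + x) (n ∸ x))
    Result : Set
    Result = ∃[ l′ ] ∃[ n′ ] n′ ≤ n × Rich a l′ n′ × DenseEnds l′ n′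
    cut : ∀ x → x < suc n → Sparse x → Result
    cut x (s≤s x≤n) ¬dense with Dense? l x
    ... | no ¬dense₁ = let l′ , n′ , n′≤ , r = trim {a} f (l ℤ.+ + x) (n ∸ x) (shorter x x≤n ¬dense₁) (rich-suffix {a} {l} x (n ∸ x) ¬dense₁ (subst (Rich a l) (sym (ℕ.m+[n∸m]≡n x≤n)) rich))
      in l′ , n′ , ℕ.≤-trans n′≤ (ℕ.m∸n≤m n x) , r
      where
      -- The empty segment is dense, so a sparse one is non-empty and cutting it off pays for one
      -- unit of f.
      shorter : ∀ x → x ≤ n → ¬ Dense l x → n ∸ x ≤ f
      shorter zero    _   ¬d = contradiction (dense-0 l) ¬d
      shorter (suc x) x≤n ¬d = ℕ.≤-trans (ℕ.∸-monoˡ-≤ (suc x) n≤f) (ℕ.m∸n≤m f x)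
    ... | yes dense₁ = let l′ , n′ , n′≤ , r = trim {a} f l x (shorter (n ∸ x) (ℕ.m+[n∸m]≡n x≤n) ¬dense₂) (rich-prefix {a} {l} x (n ∸ x) ¬dense₂ (subst (Rich a l) (sym (ℕ.m+[n∸m]≡n x≤n)) rich))
      in l′ , n′ , ℕ.≤-trans n′≤ x≤n , r
      where
      ¬dense₂ : ¬ Dense (l ℤ.+ + x) (n ∸ x)
      ¬dense₂ d = ¬dense (dense₁ , d)
      shorter : ∀ y → x + y ≡ n → ¬ Dense (l ℤ.+ + x) y → x ≤ f
      shorter zero    _  ¬d = contradiction (dense-0 (l ℤ.+ + x)) ¬d
      shorter (suc y) eq _  = s≤s⁻¹ (ℕ.≤-trans (ℕ.≤-trans (s≤s (ℕ.m≤m+n x y)) (ℕ.≤-reflexive (trans (sym (ℕ.+-suc x y)) eq))) n≤f)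
    search : Dec (Any.Any Sparse (upTo (suc n))) → Result
    search (yes p) = let x , x∈ , sparse = find p in cut x (∈-upTo⁻ x∈) sparse
    search (no ¬p) = l , n , ℕ.≤-refl , rich , ends
      where
      ends : DenseEnds l n
      ends {x} {y} refl = subst (λ w → Dense l x × Dense (l ℤ.+ + x) w) (ℕ.m+n∸m≡n x y)
        (decidable-stable (Dense? l x ×-dec Dense? (l ℤ.+ + x) (x + y ∸ x)) (λ ¬d → ¬p (lose (∈-upTo⁺ (s≤s (ℕ.m≤m+n x y))) ¬d)))

-- Covering a stretch plus [0, m]

record Stretch (k a m g : ℕ) (A B : List ℤ) (l : ℤ) (n : ℕ) : Set where
  field
    uA       : Unique A
    uB       : Unique B
    B-range  : ∀ {b} → b ∈ B → 0ℤ ℤ.≤ b × b ℤ.≤ + m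
    0∈B      : 0ℤ ∈ B
    m∈B      : + m ∈ B
    ∣B∣+g≡   : length B + g ≡ suc m
    n≤m      : n ≤ m
    rich     : Rich A a l n
    ends     : DenseEnds A l n
    a>0      : 0 < a
    a-large  : 16 * g + 4 ≤ a
    m≤2ka    : m ≤ 2 * k * a

module Finish {k a m g A B l n} (φ : Stretch k a m g A B l n) where

  open Stretch φ

  -- The targets l + y with y < m + n are cut at y = v, z, m + s and m + s + v′. The outer pieces
  -- use 0 or m alone, their neighbours a block at an end of [0, m], and the middle is divided into
  -- pieces of length s. A block is z = 4 (h + g) + 1 consecutive integers, of which g gaps of `B`
  -- and h holes of `A` spoil only a fraction.
  h z v v′ s : ℕ
  h = holes A l n
  v = 2 * (h + g)
  v′ = suc (2 * (h + g))
  z = v + v′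
  s = n ∸ z

  -- Richness pays for the h in z, and the 16 g + 4 of `a-large` is the rest of 4z. It follows that
  -- s ≥ a / 4, so boundedly many pieces of length s cross [0, m].
  4z+a≤4n : 4 * z + a ≤ 4 * n
  4z+a≤4n = arith a g h (inside A l n) n (inside+holes A l n) rich a-large
    where
    arith : ∀ a g h c n → c + h ≡ n → a + 32 * h ≤ 2 * c → 16 * g + 4 ≤ a →
            4 * (2 * (h + g) + suc (2 * (h + g))) + a ≤ 4 * n
    arith a g h c n refl p q = lin (52 * h) (ℕ.+-mono-≤ (ℕ.*-monoʳ-≤ 2 p) q) (eq a g h c)
      where
      eq : ∀ a g h c → 4 * (2 * (h + g) + suc (2 * (h + g))) + a + (2 * (2 * c) + a) + 52 * h ≡
                       4 * (c + h) + (2 * (a + 32 * h) + (16 * g + 4))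
      eq = ℕ-solve

  z-small : z ≤ n
  z-small = ℕ.*-cancelˡ-≤ 4 (ℕ.≤-trans (ℕ.m≤m+n (4 * z) a) 4z+a≤4n)

  z≤m : z ≤ m
  z≤m = ℕ.≤-trans z-small n≤m

  z+s≡n : z + s ≡ n
  z+s≡n = ℕ.m+[n∸m]≡n z-small

  a≤4s : a ≤ 4 * s
  a≤4s = ℕ.+-cancelˡ-≤ (4 * z) a (4 * s) (ℕ.≤-trans 4z+a≤4n (ℕ.≤-reflexive (trans (cong (4 *_) (sym z+s≡n)) (ℕ.*-distribˡ-+ 4 z s))))

  s>0 : 0 < s
  s>0 = ℕ.n≢0⇒n>0 λ s≡0 → ℕ.<⇒≱ a>0 (subst (λ s → a ≤ 4 * s) s≡0 a≤4s)

  instance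
    s≢0 : NonZero s
    s≢0 = >-nonZero s>0

  m≤8ks : m ≤ 8 * k * s
  m≤8ks = ℕ.≤-trans m≤2ka (ℕ.≤-trans (ℕ.*-monoʳ-≤ (2 * k) a≤4s) (ℕ.≤-reflexive (eq k s)))
    where
    eq : ∀ k s → 2 * k * (4 * s) ≡ 8 * k * s
    eq = ℕ-solve

  B-gaps : ∀ o Y → o + Y ≤ suc m → # (λ b → ¬? (b ∈? B)) (ival (+ o) Y) ≤ g
  B-gaps o Y o+Y≤ = ℕ.≤-trans sub (ℕ.+-cancelˡ-≤ (length B) _ _ (begin
    length B + # (λ b → ¬? (b ∈? B)) all               ≤⟨ ℕ.+-monoˡ-≤ _ B≤ ⟩
    # (_∈? B) all + # (λ b → ¬? (b ∈? B)) all          ≡⟨ #-¬ (_∈? B) all ⟩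
    length all                                         ≡⟨ length-ival 0ℤ (suc m) ⟩
    suc m                                              ≡⟨ ∣B∣+g≡ ⟨
    length B + g                                       ∎))
    where
    open ℕ.≤-Reasoning
    all : List ℤ
    all = ival 0ℤ (suc m)
    B≤ : length B ≤ # (_∈? B) all
    B≤ = ℕ.≤-trans (#-all (_∈? B) B id) (#-rel (_∈? B) (_∈? B) _≡_ uB
      (λ b∈ _ → _ , ∈-ival⁺ {l = 0ℤ} {n = suc m} (proj₁ (B-range b∈)) (ℤ.+-monoʳ-≤ 1ℤ (proj₂ (B-range b∈))) , b∈ , refl)
      (λ { _ _ _ _ refl refl → refl }))
    sub : # (λ b → ¬? (b ∈? B)) (ival (+ o) Y) ≤ # (λ b → ¬? (b ∈? B)) all
    sub = #-rel _ _ _≡_ (ival-unique (+ o) Y)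
      (λ x∈ ∉B → let l≤ , <u = ∈-ival⁻ {l = + o} {n = Y} x∈ in
        _ , ∈-ival⁺ {l = 0ℤ} {n = suc m} (ℤ.≤-trans (ℤ.+≤+ z≤n) l≤) (ℤ.≤-trans <u (ℤ.+≤+ o+Y≤)) , ∉B , refl)
      (λ { _ _ _ _ refl refl → refl })

  block : ℕ → ℕ → List ℤ
  block o Y = filter (_∈? B) (ival (+ o) Y)

  block⊆B : ∀ o Y → block o Y ⊆ B
  block⊆B o Y x∈ = proj₂ (∈-filter⁻ (_∈? B) {xs = ival (+ o) Y} x∈)

  block-length : ∀ o Y → length (block o Y) + # (λ b → ¬? (b ∈? B)) (ival (+ o) Y) ≡ Y
  block-length o Y = trans (cong (_+ # (λ b → ¬? (b ∈? B)) (ival (+ o) Y)) (sym (#-filter (_∈? B) (ival (+ o) Y))))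
    (trans (#-¬ (_∈? B) (ival (+ o) Y)) (length-ival (+ o) Y))

  -- The reflection b ↦ x - b exchanges [o, o + Y) and [ω, ω + Y), and B misses at most g points of the former.
  common-points : ∀ ω o Y x → ω ℤ.+ + (o + Y) ≡ 1ℤ ℤ.+ x → o + Y ≤ suc m →
            inside A ω Y ≤ g + # (λ b → (b ∈? B) ×-dec (x ℤ.- b ∈? A)) (ival (+ o) Y)
  common-points ω o Y x eq o+Y≤ = arith _ _ _ _ _ Y meet (trans (#-¬ (_∈? B) I) (length-ival (+ o) Y)) (B-gaps o Y o+Y≤) reflect
    where
    I : List ℤ
    I = ival (+ o) Y
    meet : # (_∈? B) I + # (λ b → x ℤ.- b ∈? A) I ≤ Y + # (λ b → (b ∈? B) ×-dec (x ℤ.- b ∈? A)) I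
    meet = ℕ.≤-trans (#-∩ (_∈? B) (λ b → x ℤ.- b ∈? A) (λ _ → yes (s≤s {0} {0} z≤n)) _ I (λ _ _ → s≤s z≤n) (λ _ _ → s≤s z≤n) (λ _ → _,_))
      (ℕ.+-monoˡ-≤ _ (ℕ.≤-trans (#-≤length _ I) (ℕ.≤-reflexive (length-ival (+ o) Y))))
    e₁ : ∀ x w → x ℤ.- (x ℤ.- w) ≡ w
    e₁ = ℤ-solve
    e₂ : ∀ x w ω o Y → o ℤ.- (x ℤ.- w) ≡ (1ℤ ℤ.+ w) ℤ.- (ω ℤ.+ Y) ℤ.+ (ω ℤ.+ (o ℤ.+ Y) ℤ.- (1ℤ ℤ.+ x))
    e₂ = ℤ-solve
    e₃ : ∀ x w ω o Y → 1ℤ ℤ.+ (x ℤ.- w) ℤ.- (o ℤ.+ Y) ≡ ω ℤ.- w ℤ.- (ω ℤ.+ (o ℤ.+ Y) ℤ.- (1ℤ ℤ.+ x))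
    e₃ = ℤ-solve
    zero-diff : ω ℤ.+ + (o + Y) ℤ.- (1ℤ ℤ.+ x) ≡ 0ℤ
    zero-diff = ℤ.i≡j⇒i-j≡0 eq
    reflect : inside A ω Y ≤ # (λ b → x ℤ.- b ∈? A) I
    reflect = #-rel (_∈? A) (λ b → x ℤ.- b ∈? A) (λ w b → b ≡ x ℤ.- w) (ival-unique ω Y)
      (λ {w} w∈ wA → let lo , hi = ∈-ival⁻ {l = ω} {n = Y} w∈ in
        x ℤ.- w , ∈-ival⁺ {l = + o} {n = Y}
          (linℤ hi (trans (e₂ x w ω (+ o) (+ Y)) (trans (cong (λ y → 1ℤ ℤ.+ w ℤ.- (ω ℤ.+ + Y) ℤ.+ y) zero-diff) (ℤ.+-identityʳ _))))
          (linℤ lo (trans (e₃ x w ω (+ o) (+ Y)) (trans (cong (λ y → ω ℤ.- w ℤ.- y) zero-diff) (ℤ.+-identityʳ _)))) ,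
        subst (_∈ A) (sym (e₁ x w)) wA , refl)
      (λ {w} {w′} _ _ _ _ r r′ → trans (sym (e₁ x w)) (trans (cong (λ y → x ℤ.- y) (trans (sym r) r′)) (e₁ x w′)))
    arith : ∀ b r n f i Y → b + r ≤ Y + n → b + f ≡ Y → f ≤ g → i ≤ r → i ≤ g + n
    arith b r n f i Y p refl q t = lin 0 (ℕ.+-mono-≤ p (ℕ.+-mono-≤ q t)) (e b r n f i g)
      where
      e : ∀ b r n f i g → i + (b + f + n + (g + r)) + 0 ≡ g + n + (b + r + (f + i))
      e = ℕ-solve

  -- `P` middle pieces suffice because m ≤ 8ks. With the two end pieces there are P + 2 clusters;
  -- each may leave h / (4 (P + 2)) points uncovered, together at most h / 4. `K` is the number of
  -- averaging steps that achieves this.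
  P c′ K : ℕ
  P  = suc (8 * k)
  c′ = (P + 2) * 4
  K  = 7 * c′

  Covers : List ℤ → List ℤ → List ℤ → Set
  Covers bs U Q = ∀ {x} → x ∈ Q → Hit A bs x ⊎ x ∈ U

  -- Already b₁ leaves at most h points of Q, one for each hole, because x - b₁ stays in the
  -- stretch; K averaging steps divide this by c′.
  cluster : ∀ o Y Q {b₁} → b₁ ∈ block o Y → Unique Q →
            (∀ {x} → x ∈ Q → x ℤ.- b₁ ∈ ival l n) →
            (∀ {x} → x ∈ Q → length (block o Y) ≤ 8 * # (λ b → x ℤ.- b ∈? A) (block o Y)) →
            ∃[ bs ] ∃[ U ] bs ⊆ B × length bs ≤ suc K × c′ * length U ≤ h × Covers bs U Q
  cluster o Y Q {b₁} b₁∈ uQ near popular = from (cover K (b₁ ∷ []) (λ { (here refl) → b₁∈ }))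
    where
    open Cover A (block o Y) Q b₁∈ popular
    open ℕ.≤-Reasoning
    first : missed (b₁ ∷ []) ≤ h
    first = #-rel _ (λ x → ¬? (x ∈? A)) (λ x y → y ≡ x ℤ.- b₁) uQ
      (λ {x} x∈ ¬h → x ℤ.- b₁ , near x∈ , (λ p → ¬h (b₁ , here refl , p)) , refl)
      (λ {x} {x′} _ _ _ _ r r′ → ∙-cancelʳ (ℤ.- b₁) x x′ (trans (sym r) r′))
    from : ∃[ bs ] bs ⊆ block o Y × length bs ≤ K + 1 × 8 ^ K * missed bs ≤ 7 ^ K * missed (b₁ ∷ []) →
           ∃[ bs ] ∃[ U ] bs ⊆ B × length bs ≤ suc K × c′ * length U ≤ h × Covers bs U Q
    from (bs , sub , len , le) = bs , U , block⊆B o Y ∘ sub , ℕ.≤-trans len (ℕ.≤-reflexive (ℕ.+-comm K 1)) , few , covers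
      where
      Un? : Decidable (λ x → ¬ Hit A bs x)
      Un? x = ¬? (Hit? A bs x)
      U : List ℤ
      U = filter Un? Q
      e : ∀ x y z → x * (y * z) ≡ y * x * z
      e = ℕ-solve
      few : c′ * length U ≤ h
      few = ℕ.*-cancelˡ-≤ (7 ^ K) {{ℕ.m^n≢0 7 K}} (begin
        7 ^ K * (c′ * length U)         ≡⟨ e (7 ^ K) c′ (length U) ⟩
        c′ * 7 ^ K * length U           ≤⟨ ℕ.*-monoˡ-≤ (length U) (8^≥c*7^ c′) ⟩
        8 ^ K * length U                ≡⟨ cong (8 ^ K *_) (#-filter Un? Q) ⟨
        8 ^ K * missed bs               ≤⟨ le ⟩
        7 ^ K * missed (b₁ ∷ [])        ≤⟨ ℕ.*-monoʳ-≤ (7 ^ K) first ⟩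
        7 ^ K * h                       ∎)
      covers : Covers bs U Q
      covers {x} x∈ = case Hit? A bs x of λ where
        (yes hit) → inj₁ hit
        (no ¬hit) → inj₂ (∈-filter⁺ Un? x∈ ¬hit)

  -- Clipped so that the last block stays within [0, m]; the clipped piece has offsets [m, m + s).
  middle-offset : ℕ → ℕ
  middle-offset i = (i * s) ⊓ (m ∸ z)

  middle : ℕ → List ℤ
  middle i = ival (l ℤ.+ + (middle-offset i + z)) s

  -- Away from the ends, x - b is in the stretch for every b in the block. So x fails for at most h
  -- of the at least z - g elements that `B` has there.
  middle-cluster : ∀ i → ∃[ bs ] ∃[ U ] bs ⊆ B × length bs ≤ suc K × c′ * length U ≤ h × Covers bs U (middle i)
  middle-cluster i = from (#-find (_∈? B) (ival (+ p) z) (ℕ.≤-trans block>0 (ℕ.≤-reflexive (sym (#-filter (_∈? B) (ival (+ p) z))))))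
    where
    p : ℕ
    p = middle-offset i
    p+z≤m : p + z ≤ m
    p+z≤m = ℕ.≤-trans (ℕ.+-monoˡ-≤ z (ℕ.m⊓n≤n (i * s) (m ∸ z))) (ℕ.≤-reflexive (ℕ.m∸n+n≡m z≤m))
    z≤block+g : z ≤ length (block p z) + g
    z≤block+g = ℕ.≤-trans (ℕ.≤-reflexive (sym (block-length p z))) (ℕ.+-monoʳ-≤ (length (block p z)) (B-gaps p z (ℕ.m≤n⇒m≤1+n p+z≤m)))
    block>0 : 0 < length (block p z)
    block>0 = arith (length (block p z)) h g z≤block+g
      where
      arith : ∀ b h g → 2 * (h + g) + suc (2 * (h + g)) ≤ b + g → 1 ≤ b
      arith b h g le = lin (4 * h + 3 * g) le (e b h g)
        where
        e : ∀ b h g → 1 + (b + g) + (4 * h + 3 * g) ≡ b + (2 * (h + g) + suc (2 * (h + g)))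
        e = ℕ-solve
    near : ∀ {b x} → b ∈ ival (+ p) z → x ∈ middle i → x ℤ.- b ∈ ival l n
    near {b} {x} b∈ x∈ =
      let b≥ , b< = ∈-ival⁻ {l = + p} {n = z} b∈
          x≥ , x< = ∈-ival⁻ {l = l ℤ.+ + (p + z)} {n = s} x∈
      in ∈-ival⁺ {l = l} {n = n} (linℤ (ℤ.+-mono-≤ (ℤ.+-mono-≤ x≥ b<) (ℤ.+≤+ (z≤n {1}))) (e₁ l x b (+ p) (+ z)))
           (subst (λ n → x ℤ.- b <′ l ℤ.+ + n) z+s≡n (linℤ (ℤ.+-mono-≤ x< b≥) (e₂ l x b (+ p) (+ z) (+ s))))
      where
      e₁ : ∀ l x b p z → l ℤ.- (x ℤ.- b) ≡ (l ℤ.+ (p ℤ.+ z)) ℤ.+ (1ℤ ℤ.+ b) ℤ.+ 0ℤ ℤ.- (x ℤ.+ (p ℤ.+ z) ℤ.+ 1ℤ)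
      e₁ = ℤ-solve
      e₂ : ∀ l x b p z s → 1ℤ ℤ.+ (x ℤ.- b) ℤ.- (l ℤ.+ (z ℤ.+ s)) ≡ (1ℤ ℤ.+ x ℤ.+ p) ℤ.- (l ℤ.+ (p ℤ.+ z) ℤ.+ s ℤ.+ b)
      e₂ = ℤ-solve
    popular : ∀ {x} → x ∈ middle i → length (block p z) ≤ 8 * # (λ b → x ℤ.- b ∈? A) (block p z)
    popular {x} x∈ = arith (length (block p z)) (# (λ b → x ℤ.- b ∈? A) (block p z)) (# (λ b → ¬? (x ℤ.- b ∈? A)) (block p z)) h g
        (#-¬ (λ b → x ℤ.- b ∈? A) (block p z)) few z≤block+g
      where
      few : # (λ b → ¬? (x ℤ.- b ∈? A)) (block p z) ≤ h
      few = #-rel _ _ (λ b y → y ≡ x ℤ.- b) (Unique.filter⁺ (_∈? B) (ival-unique (+ p) z))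
        (λ {b} b∈ ∉A → x ℤ.- b , near (proj₁ (∈-filter⁻ (_∈? B) {xs = ival (+ p) z} b∈)) x∈ , ∉A , refl)
        (λ {b} {b′} _ _ _ _ r r′ → ℤ.neg-injective (∙-cancelˡ x (ℤ.- b) (ℤ.- b′) (trans (sym r) r′)))
      arith : ∀ C p₁ p₂ h g → p₁ + p₂ ≡ C → p₂ ≤ h → 2 * (h + g) + suc (2 * (h + g)) ≤ C + g → C ≤ 8 * p₁
      arith C p₁ p₂ h g refl q r = lin (5 * (p₁ + p₂) + 6 * g + 2) (ℕ.+-mono-≤ (ℕ.*-monoʳ-≤ 8 q) (ℕ.*-monoʳ-≤ 2 r)) (e p₁ p₂ h g)
        where
        e : ∀ p₁ p₂ h g → p₁ + p₂ + (8 * h + 2 * (p₁ + p₂ + g)) + (5 * (p₁ + p₂) + 6 * g + 2) ≡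
                          8 * p₁ + (8 * p₂ + 2 * (2 * (h + g) + suc (2 * (h + g))))
        e = ℕ-solve
    from : ∃[ b ] b ∈ ival (+ p) z × b ∈ B → ∃[ bs ] ∃[ U ] bs ⊆ B × length bs ≤ suc K × c′ * length U ≤ h × Covers bs U (middle i)
    from (b , b∈ , b∈B) = cluster p z (middle i) (∈-filter⁺ (_∈? B) b∈ b∈B) (ival-unique (l ℤ.+ + (middle-offset i + z)) s) (near b∈) popular

  -- Near an end only the differences from a part of the block are used. That part has at least v +
  -- 1 > z / 2 points and reflects onto an initial or final segment, whose density outweighs the g ≤
  -- v / 2 gaps of `B`.
  end-popular : ∀ ω Y → Dense A ω Y → suc v ≤ Y → ∀ o x {o′ Y′} → ω ℤ.+ + (o + Y) ≡ 1ℤ ℤ.+ x → o + Y ≤ suc m →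
                (∀ {b} → b ∈ ival (+ o) Y → b ∈ ival (+ o′) Y′) → Y′ ≡ z →
                length (block o′ Y′) ≤ 8 * # (λ b → x ℤ.- b ∈? A) (block o′ Y′)
  end-popular ω Y dense v<Y o x {o′} {Y′} eq o+Y≤ sub refl = ℕ.≤-trans (ℕ.m+n≤o⇒m≤o (length (block o′ z)) (ℕ.≤-reflexive (block-length o′ z)))
    (arith h g (inside A ω Y) (holes A ω Y) Y _ (inside+holes A ω Y) dense v<Y (ℕ.≤-trans (common-points ω o Y x eq o+Y≤) (ℕ.+-monoʳ-≤ g into)))
    where
    into : # (λ b → (b ∈? B) ×-dec (x ℤ.- b ∈? A)) (ival (+ o) Y) ≤ # (λ b → x ℤ.- b ∈? A) (block o′ z)
    into = #-rel _ _ _≡_ (ival-unique (+ o) Y) (λ b∈ (b∈B , p) → _ , ∈-filter⁺ (_∈? B) (sub b∈) b∈B , p , refl) (λ { _ _ _ _ refl refl → refl })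
    arith : ∀ h g c hh Y p → c + hh ≡ Y → 16 * hh ≤ c → suc (2 * (h + g)) ≤ Y → c ≤ g + p → 2 * (h + g) + suc (2 * (h + g)) ≤ 8 * p
    arith h g c hh Y p refl q r t = lin (8 * h + 26 * hh + 5) (ℕ.+-mono-≤ (ℕ.*-monoʳ-≤ 2 q) (ℕ.+-mono-≤ (ℕ.*-monoʳ-≤ 6 r) (ℕ.*-monoʳ-≤ 8 t))) (e h g c hh p)
      where
      e : ∀ h g c hh p → 2 * (h + g) + suc (2 * (h + g)) + (2 * c + (6 * (c + hh) + 8 * (g + p))) + (8 * h + 26 * hh + 5) ≡
                         8 * p + (2 * (16 * hh) + (6 * suc (2 * (h + g)) + 8 * c))
      e = ℕ-solve

  left right : List ℤ
  left  = ival (l ℤ.+ + v) v′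
  right = ival (l ℤ.+ + (m + s)) v′

  Cluster : List ℤ → Set
  Cluster Q = ∃[ bs ] ∃[ U ] bs ⊆ B × length bs ≤ suc K × c′ * length U ≤ h × Covers bs U Q

  left-cluster : Cluster left
  left-cluster = cluster 0 z left (∈-filter⁺ (_∈? B) (∈-ival⁺ {l = 0ℤ} {n = z} ℤ.≤-refl (ℤ.+≤+ (ℕ.m≤n⇒m≤o+n v (s≤s z≤n)))) 0∈B)
      (ival-unique (l ℤ.+ + v) v′) near popular
    where
    near : ∀ {x} → x ∈ left → x ℤ.- 0ℤ ∈ ival l n
    near {x} x∈ with ∈-ival-ℕ⁻ {l ℤ.+ + v} {v′} x∈
    ... | j , j<v′ , refl = subst (_∈ ival l n) (eq l (+ v) (+ j))
          (∈-ival⁺ {l = l} {n = n} (ℤ.i≤i+j l (+ (v + j))) (linℤ (ℤ.+≤+ (ℕ.<-≤-trans (ℕ.+-monoʳ-< v j<v′) z-small)) (e l (+ (v + j)) (+ n))))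
      where
      eq : ∀ l v j → l ℤ.+ (v ℤ.+ j) ≡ l ℤ.+ v ℤ.+ j ℤ.- 0ℤ
      eq = ℤ-solve
      e : ∀ l y n → 1ℤ ℤ.+ (l ℤ.+ y) ℤ.- (l ℤ.+ n) ≡ 1ℤ ℤ.+ y ℤ.- n
      e = ℤ-solve
    popular : ∀ {x} → x ∈ left → length (block 0 z) ≤ 8 * # (λ b → x ℤ.- b ∈? A) (block 0 z)
    popular x∈ with ∈-ival-ℕ⁻ {l ℤ.+ + v} {v′} x∈
    ... | j , j<v′ , refl = end-popular l Y (proj₁ (ends (ℕ.m+[n∸m]≡n (ℕ.≤-trans Y≤z z-small)))) (s≤s (ℕ.m≤m+n v j)) 0 (l ℤ.+ + v ℤ.+ + j) {0} {z}
          (eq l (+ v) (+ j)) (ℕ.m≤n⇒m≤1+n (ℕ.≤-trans Y≤z z≤m))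
          (λ b∈ → let lo , hi = ∈-ival⁻ {l = 0ℤ} {n = Y} b∈ in ∈-ival⁺ {l = 0ℤ} {n = z} lo (ℤ.≤-trans hi (ℤ.+≤+ Y≤z))) refl
      where
      Y : ℕ
      Y = suc (v + j)
      Y≤z : Y ≤ z
      Y≤z = ℕ.+-monoʳ-< v j<v′
      eq : ∀ l v j → l ℤ.+ (1ℤ ℤ.+ (v ℤ.+ j)) ≡ 1ℤ ℤ.+ (l ℤ.+ v ℤ.+ j)
      eq = ℤ-solve

  right-cluster : Cluster right
  right-cluster = cluster (suc m ∸ z) z right (∈-filter⁺ (_∈? B) m∈block m∈B) (ival-unique (l ℤ.+ + (m + s)) v′) near popular
    where
    o : ℕ
    o = suc m ∸ z
    o+z≡ : o + z ≡ suc m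
    o+z≡ = ℕ.m∸n+n≡m (ℕ.m≤n⇒m≤1+n z≤m)
    m∈block : + m ∈ ival (+ o) z
    m∈block = ∈-ival⁺ {l = + o} {n = z} (ℤ.+≤+ (s≤s⁻¹ (ℕ.≤-trans (ℕ.≤-trans (ℕ.≤-reflexive (ℕ.+-comm 1 o)) (ℕ.+-monoʳ-≤ o (ℕ.m≤n⇒m≤o+n v (s≤s (z≤n {2 * (h + g)}))))) (ℕ.≤-reflexive o+z≡))))
      (ℤ.+≤+ (ℕ.≤-reflexive (sym o+z≡)))
    near : ∀ {x} → x ∈ right → x ℤ.- + m ∈ ival l n
    near {x} x∈ with ∈-ival-ℕ⁻ {l ℤ.+ + (m + s)} {v′} x∈
    ... | j , j<v′ , refl = subst (_∈ ival l n) (eq l (+ m) (+ s) (+ j))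
          (∈-ival⁺ {l = l} {n = n} (ℤ.i≤i+j l (+ (s + j))) (linℤ (ℤ.+≤+ s+j<n) (e l (+ (s + j)) (+ n))))
      where
      eq : ∀ l m s j → l ℤ.+ (s ℤ.+ j) ≡ l ℤ.+ (m ℤ.+ s) ℤ.+ j ℤ.- m
      eq = ℤ-solve
      e : ∀ l y n → 1ℤ ℤ.+ (l ℤ.+ y) ℤ.- (l ℤ.+ n) ≡ 1ℤ ℤ.+ y ℤ.- n
      e = ℤ-solve
      s+j<n : s + j < n
      s+j<n = ℕ.<-≤-trans (ℕ.+-monoʳ-< s (ℕ.<-≤-trans j<v′ (ℕ.m≤n+m v′ v))) (ℕ.≤-reflexive (trans (ℕ.+-comm s z) z+s≡n))
    popular : ∀ {x} → x ∈ right → length (block o z) ≤ 8 * # (λ b → x ℤ.- b ∈? A) (block o z)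
    popular x∈ with ∈-ival-ℕ⁻ {l ℤ.+ + (m + s)} {v′} x∈
    ... | j , s≤s j≤v , refl = end-popular (l ℤ.+ + n₁) Y (proj₂ (ends n₁+Y≡)) v<Y (suc m₁) (l ℤ.+ + (m + s) ℤ.+ + j) {o} {z}
          (trans (eq l (+ n₁) (+ m₁) (+ Y)) (trans (cong (λ y → 1ℤ ℤ.+ (l ℤ.+ + y)) total) (eq′ l (+ (m + s)) (+ j))))
          (ℕ.≤-reflexive (cong suc m₁+Y≡)) sub refl
      where
      Y n₁ m₁ : ℕ
      Y  = z ∸ j
      n₁ = n ∸ Y
      m₁ = m ∸ Y
      Y≤z : Y ≤ z
      Y≤z = ℕ.m∸n≤m z j
      j+Y≡ : j + Y ≡ z
      j+Y≡ = ℕ.m+[n∸m]≡n (ℕ.≤-trans j≤v (ℕ.m≤m+n v v′))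
      n₁+Y≡ : n₁ + Y ≡ n
      n₁+Y≡ = ℕ.m∸n+n≡m (ℕ.≤-trans Y≤z z-small)
      m₁+Y≡ : m₁ + Y ≡ m
      m₁+Y≡ = ℕ.m∸n+n≡m (ℕ.≤-trans Y≤z z≤m)
      v<Y : suc v ≤ Y
      v<Y = ℕ.+-cancelˡ-≤ j v′ Y (ℕ.≤-trans (ℕ.+-monoˡ-≤ v′ j≤v) (ℕ.≤-reflexive (sym j+Y≡)))
      total : n₁ + m₁ + Y ≡ m + s + j
      total = ℕ.+-cancelʳ-≡ Y _ _ (trans (e₁ n₁ m₁ Y) (trans (cong₂ _+_ (trans n₁+Y≡ (trans (sym z+s≡n) (cong (_+ s) (sym j+Y≡)))) m₁+Y≡) (e₂ j Y s m)))
        where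
        e₁ : ∀ n m y → n + m + y + y ≡ (n + y) + (m + y)
        e₁ = ℕ-solve
        e₂ : ∀ j y s m → (j + y + s) + m ≡ m + s + j + y
        e₂ = ℕ-solve
      eq : ∀ l n m y → l ℤ.+ n ℤ.+ (1ℤ ℤ.+ m ℤ.+ y) ≡ 1ℤ ℤ.+ (l ℤ.+ (n ℤ.+ m ℤ.+ y))
      eq = ℤ-solve
      eq′ : ∀ l x j → 1ℤ ℤ.+ (l ℤ.+ (x ℤ.+ j)) ≡ 1ℤ ℤ.+ (l ℤ.+ x ℤ.+ j)
      eq′ = ℤ-solve
      sub : ∀ {b} → b ∈ ival (+ suc m₁) Y → b ∈ ival (+ o) z
      sub b∈ = let lo , hi = ∈-ival⁻ {l = + suc m₁} {n = Y} b∈ in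
        ∈-ival⁺ {l = + o} {n = z} (ℤ.≤-trans (ℤ.+≤+ o≤) lo) (ℤ.≤-trans hi (ℤ.+≤+ (ℕ.≤-reflexive (trans (cong suc m₁+Y≡) (sym o+z≡)))))
        where
        o≤ : o ≤ suc m₁
        o≤ = ℕ.+-cancelʳ-≤ Y o (suc m₁) (ℕ.≤-trans (ℕ.+-monoʳ-≤ o Y≤z) (ℕ.≤-reflexive (trans o+z≡ (sym (cong suc m₁+Y≡)))))

  middle-clusters : ∀ p → ∃[ bs ] ∃[ U ] bs ⊆ B × length bs ≤ p * suc K × c′ * length U ≤ p * h ×
                    (∀ {i} → i < p → Covers bs U (middle i))
  middle-clusters zero    = [] , [] , (λ ()) , z≤n , ℕ.≤-reflexive (ℕ.*-zeroʳ c′) , λ ()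
  middle-clusters (suc p) =
    let bs , U , sub , len , few , cov = middle-clusters p
        bs₁ , U₁ , sub₁ , len₁ , few₁ , cov₁ = middle-cluster p
    in bs₁ ++ bs , U₁ ++ U ,
       (λ b∈ → [ sub₁ , sub ]′ (∈-++⁻ bs₁ b∈)) ,
       ℕ.≤-trans (ℕ.≤-reflexive (List.length-++ bs₁)) (ℕ.+-mono-≤ len₁ len) ,
       ℕ.≤-trans (ℕ.≤-reflexive (trans (cong (c′ *_) (List.length-++ U₁)) (ℕ.*-distribˡ-+ c′ (length U₁) (length U)))) (ℕ.+-mono-≤ few₁ few) ,
       λ {i} i<1+p → extend bs₁ U₁ bs U cov₁ (λ i<p → cov {i} i<p) (ℕ.m<1+n⇒m<n∨m≡n i<1+p)
    where
    extend : ∀ bs₁ U₁ bs U {i} → Covers bs₁ U₁ (middle p) → (i < p → Covers bs U (middle i)) →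
             i < p ⊎ i ≡ p → Covers (bs₁ ++ bs) (U₁ ++ U) (middle i)
    extend bs₁ U₁ bs U cov₁ cov (inj₂ refl) {x} x∈ = [ inj₁ ∘ Hit-mono {x = x} ∈-++⁺ˡ , inj₂ ∘ ∈-++⁺ˡ ]′ (cov₁ x∈)
    extend bs₁ U₁ bs U cov₁ cov (inj₁ i<p) {x} x∈ = [ inj₁ ∘ Hit-mono {x = x} (∈-++⁺ʳ bs₁) , inj₂ ∘ ∈-++⁺ʳ U₁ ]′ (cov i<p x∈)

  -- Below m the index (y - z) / s is not affected by clipping. From m on, the index 8k serves: as m
  -- ≤ 8ks, it is clipped to the piece [m, m + s).
  find-middle : ∀ {y} → z ≤ y → y < m + s → ∃[ i ] i < P × middle-offset i + z ≤ y × y < middle-offset i + z + s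
  find-middle {y} z≤y y<m+s with y ℕ.<? m
  ... | no y≮m = 8 * k , ℕ.≤-refl , subst (_≤ y) (sym off) (ℕ.≮⇒≥ y≮m) , subst (λ o → y < o + s) (sym off) y<m+s
    where
    off : middle-offset (8 * k) + z ≡ m
    off = trans (cong (_+ z) (ℕ.m≥n⇒m⊓n≡n (ℕ.≤-trans (ℕ.m∸n≤m m z) m≤8ks))) (ℕ.m∸n+n≡m z≤m)
  ... | yes y<m = i , s≤s (ℕ.*-cancelʳ-≤ i (8 * k) s (ℕ.≤-trans is≤ (ℕ.≤-trans (ℕ.m∸n≤m y z) (ℕ.≤-trans (ℕ.<⇒≤ y<m) m≤8ks)))) ,
        subst (λ o → o + z ≤ y) (sym off) (ℕ.≤-trans (ℕ.+-monoˡ-≤ z is≤) (ℕ.≤-reflexive (ℕ.m∸n+n≡m z≤y))) ,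
        subst (λ o → y < o + z + s) (sym off) y<
    where
    i : ℕ
    i = (y ∸ z) / s
    is≤ : i * s ≤ y ∸ z
    is≤ = m/n*n≤m (y ∸ z) s
    off : middle-offset i ≡ i * s
    off = ℕ.m≤n⇒m⊓n≡m (ℕ.≤-trans is≤ (ℕ.∸-monoˡ-≤ z (ℕ.<⇒≤ y<m)))
    y< : y < i * s + z + s
    y< = begin-strict
      y                                    ≡⟨ ℕ.m∸n+n≡m z≤y ⟨
      y ∸ z + z                            ≡⟨ cong (_+ z) (m≡m%n+[m/n]*n (y ∸ z) s) ⟩
      (y ∸ z) % s + i * s + z              <⟨ ℕ.+-monoˡ-< z (ℕ.+-monoˡ-< (i * s) (m%n<n (y ∸ z) s)) ⟩
      s + i * s + z                        ≡⟨ e s (i * s) z ⟩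
      i * s + z + s                        ∎
      where
      open ℕ.≤-Reasoning
      e : ∀ x y z → x + y + z ≡ y + z + x
      e = ℕ-solve

  w : ℕ
  w = s + v′

  w+v≡n : w + v ≡ n
  w+v≡n = trans (e s v v′) z+s≡n
    where
    e : ∀ s v v′ → s + v′ + v ≡ v + v′ + s
    e = ℕ-solve

  Out? : Decidable (λ x → x ∉ A)
  Out? x = ¬? (x ∈? A)

  left-holes right-holes : List ℤ
  left-holes  = filter Out? (ival l v)
  right-holes = filter Out? (ival (l ℤ.+ + w) v)

  -- Density allows at most one hole in 17 points, and the segment has v = 2 (h + g) points.
  end-holes : ∀ ω → Dense A ω v → 4 * length (filter Out? (ival ω v)) ≤ h + g
  end-holes ω dense = arith _ _ (h + g) (inside+holes A ω v) dense (ℕ.≤-reflexive (sym (#-filter Out? (ival ω v))))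
    where
    arith : ∀ c x y {u} → c + x ≡ 2 * y → 16 * x ≤ c → u ≤ x → 4 * u ≤ y
    arith c x y {u} e p q = ℕ.*-cancelˡ-≤ 2 (lin (9 * x) (ℕ.+-mono-≤ (ℕ.*-monoʳ-≤ 8 q) (ℕ.+-mono-≤ p (ℕ.≤-reflexive e))) (eq c x y u))
      where
      eq : ∀ c x y u → 2 * (4 * u) + (8 * x + (c + 2 * y)) + 9 * x ≡ 2 * y + (8 * u + (16 * x + (c + x)))
      eq = ℕ-solve

  finish : ∃[ bs ] bs ⊆ B × length bs ≤ 2 + (P + 2) * suc K × length A + length B ≤ suc (length (sums A bs))
  finish = from left-cluster (middle-clusters P) right-cluster
    where
    Result : Set
    Result = ∃[ bs ] bs ⊆ B × length bs ≤ 2 + (P + 2) * suc K × length A + length B ≤ suc (length (sums A bs))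
    from : Cluster left → (∃[ bs ] ∃[ U ] bs ⊆ B × length bs ≤ P * suc K × c′ * length U ≤ P * h × (∀ {i} → i < P → Covers bs U (middle i))) →
           Cluster right → Result
    from (bs₁ , U₁ , sub₁ , len₁ , few₁ , cov₁) (bs₂ , U₂ , sub₂ , len₂ , few₂ , cov₂) (bs₃ , U₃ , sub₃ , len₃ , few₃ , cov₃) =
      bs , sub , len , count
      where
      bs : List ℤ
      bs = 0ℤ ∷ + m ∷ bs₁ ++ bs₂ ++ bs₃
      into₁ : bs₁ ⊆ bs
      into₁ b∈ = there (there (∈-++⁺ˡ b∈))
      into₂ : bs₂ ⊆ bs
      into₂ b∈ = there (there (∈-++⁺ʳ bs₁ (∈-++⁺ˡ b∈)))
      into₃ : bs₃ ⊆ bs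
      into₃ b∈ = there (there (∈-++⁺ʳ bs₁ (∈-++⁺ʳ bs₂ b∈)))
      sub : bs ⊆ B
      sub (here refl) = 0∈B
      sub (there (here refl)) = m∈B
      sub (there (there b∈)) = [ sub₁ , (λ b∈ → [ sub₂ , sub₃ ]′ (∈-++⁻ bs₂ b∈)) ]′ (∈-++⁻ bs₁ b∈)
      len : length bs ≤ 2 + (P + 2) * suc K
      len = s≤s (s≤s (ℕ.≤-trans (ℕ.≤-reflexive (trans (List.length-++ bs₁) (cong (_+_ (length bs₁)) (List.length-++ bs₂))))
        (ℕ.≤-trans (ℕ.+-mono-≤ len₁ (ℕ.+-mono-≤ len₂ len₃)) (ℕ.≤-reflexive (e P (suc K))))))
        where
        e : ∀ p q → q + (p * q + q) ≡ (p + 2) * q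
        e = ℕ-solve
      shifted : List ℤ
      shifted = map (ℤ._+ + m) right-holes
      U : List ℤ
      U = left-holes ++ U₁ ++ U₂ ++ U₃ ++ shifted
      hit-0 : ∀ {x} → x ∈ A → Hit A bs x
      hit-0 {x} x∈ = 0ℤ , here refl , subst (_∈ A) (sym (ℤ.+-identityʳ x)) x∈
      covered : Covers bs U (ival l (m + n))
      covered x∈ with ∈-ival-ℕ⁻ {l} {m + n} x∈
      ... | y , y<m+n , refl = place (y ℕ.<? v) (y ℕ.<? z) (y ℕ.<? m + s) (y ℕ.<? m + s + v′)
        where
        x : ℤ
        x = l ℤ.+ + y
        Placed : Set
        Placed = Hit A bs x ⊎ x ∈ U
        lift : ∀ {bs′ U′} → bs′ ⊆ bs → U′ ⊆ U → Hit A bs′ x ⊎ x ∈ U′ → Placed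
        lift p q = [ inj₁ ∘ Hit-mono {x = x} p , inj₂ ∘ q ]′
        place : Dec (y < v) → Dec (y < z) → Dec (y < m + s) → Dec (y < m + s + v′) → Placed
        place (yes y<v) _ _ _ = case x ∈? A of λ where
          (yes x∈A) → inj₁ (hit-0 x∈A)
          (no x∉A)  → inj₂ (∈-++⁺ˡ (∈-filter⁺ Out? (∈-map⁺ (λ i → l ℤ.+ + i) (∈-upTo⁺ y<v)) x∉A))
        place (no y≮v) (yes y<z) _ _ = lift into₁ (∈-++⁺ʳ left-holes ∘ ∈-++⁺ˡ) (cov₁ (∈-ival-ℕ {l} {v} {v′} (ℕ.≮⇒≥ y≮v) y<z))
        place _ (no y≮z) (yes y<) _ =
          let i , i<P , lo , hi = find-middle (ℕ.≮⇒≥ y≮z) y<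
          in lift into₂ (∈-++⁺ʳ left-holes ∘ ∈-++⁺ʳ U₁ ∘ ∈-++⁺ˡ) (cov₂ i<P (∈-ival-ℕ {l} {middle-offset i + z} {s} lo hi))
        place _ _ (no y≮) (yes y<) = lift into₃ (∈-++⁺ʳ left-holes ∘ ∈-++⁺ʳ U₁ ∘ ∈-++⁺ʳ U₂ ∘ ∈-++⁺ˡ) (cov₃ (∈-ival-ℕ {l} {m + s} {v′} (ℕ.≮⇒≥ y≮) y<))
        place _ _ _ (no y≮) = last (x ℤ.- + m ∈? A)
          where
          e₁ : ∀ x m → x ℤ.- m ℤ.+ m ≡ x
          e₁ = ℤ-solve
          y₁ : ℕ
          y₁ = y ∸ m
          y₁+m≡ : y₁ + m ≡ y
          y₁+m≡ = ℕ.m∸n+n≡m (ℕ.≤-trans (ℕ.m≤m+n m s) (ℕ.≤-trans (ℕ.m≤m+n (m + s) v′) (ℕ.≮⇒≥ y≮)))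
          inside-suffix : x ℤ.- + m ∈ ival (l ℤ.+ + w) v
          inside-suffix = subst (_∈ ival (l ℤ.+ + w) v) (trans (e₂ l (+ y₁) (+ m)) (cong (λ y → l ℤ.+ + y ℤ.- + m) y₁+m≡))
            (∈-ival-ℕ {l} {w} {v} {y₁}
              (ℕ.+-cancelʳ-≤ m w y₁ (ℕ.≤-trans (ℕ.≤-reflexive (e₃ s v′ m)) (ℕ.≤-trans (ℕ.≮⇒≥ y≮) (ℕ.≤-reflexive (sym y₁+m≡)))))
              (ℕ.+-cancelʳ-< m y₁ (w + v) (subst₂ _<_ (sym y₁+m≡) (trans (ℕ.+-comm m n) (cong (_+ m) (sym w+v≡n))) y<m+n)))
            where
            e₂ : ∀ l y m → l ℤ.+ y ≡ l ℤ.+ (y ℤ.+ m) ℤ.- m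
            e₂ = ℤ-solve
            e₃ : ∀ s v m → s + v + m ≡ m + s + v
            e₃ = ℕ-solve
          last : Dec (x ℤ.- + m ∈ A) → Placed
          last (yes p) = inj₁ (+ m , there (here refl) , p)
          last (no p)  = inj₂ (∈-++⁺ʳ left-holes (∈-++⁺ʳ U₁ (∈-++⁺ʳ U₂ (∈-++⁺ʳ U₃
                           (subst (_∈ shifted) (e₁ x (+ m)) (∈-map⁺ (ℤ._+ + m) (∈-filter⁺ Out? inside-suffix p)))))))
      lost : ℕ
      lost = # (λ x → ¬? (Hit? A bs x)) (ival l (m + n))
      lost≤∣U∣ : lost ≤ length U
      lost≤∣U∣ = subst (_≤ length U) (sym (#-filter Un? (ival l (m + n)))) (⊆-length (Unique.filter⁺ Un? (ival-unique l (m + n))) unhit)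
        where
        Un? : Decidable (λ x → ¬ Hit A bs x)
        Un? x = ¬? (Hit? A bs x)
        unhit : filter Un? (ival l (m + n)) ⊆ U
        unhit x∈ = let x∈ival , ¬hit = ∈-filter⁻ Un? {xs = ival l (m + n)} x∈ in [ (λ hit → contradiction hit ¬hit) , id ]′ (covered x∈ival)
      -- Four times the loss is at most h + g for each outer piece and h for all clusters together,
      -- which is less than the 4 (h + g) available.
      lost≤h+g : lost ≤ h + g
      lost≤h+g = ℕ.≤-trans lost≤∣U∣ (arith (length left-holes) (length U₁) (length U₂) (length U₃) (length right-holes) lengths
          (end-holes l (proj₁ (ends (trans (ℕ.+-comm v w) w+v≡n)))) (end-holes (l ℤ.+ + w) (proj₂ (ends w+v≡n)))
          four)
        where
        lengths : length U ≡ length left-holes + (length U₁ + (length U₂ + (length U₃ + length right-holes)))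
        lengths = trans (List.length-++ left-holes) (cong (_+_ (length left-holes)) (trans (List.length-++ U₁) (cong (_+_ (length U₁))
          (trans (List.length-++ U₂) (cong (_+_ (length U₂)) (trans (List.length-++ U₃) (cong (_+_ (length U₃)) (List.length-map (ℤ._+ + m) right-holes))))))))
        four : 4 * (length U₁ + (length U₂ + length U₃)) ≤ h
        four = ℕ.*-cancelˡ-≤ (P + 2) (ℕ.≤-trans (ℕ.≤-reflexive (e₁ (P + 2) (length U₁) (length U₂) (length U₃)))
          (ℕ.≤-trans (ℕ.+-mono-≤ few₁ (ℕ.+-mono-≤ few₂ few₃)) (ℕ.≤-reflexive (e₂ P h))))
          where
          e₁ : ∀ p x y z → p * (4 * (x + (y + z))) ≡ p * 4 * x + (p * 4 * y + p * 4 * z)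
          e₁ = ℕ-solve
          e₂ : ∀ p h → h + (p * h + h) ≡ (p + 2) * h
          e₂ = ℕ-solve
        arith : ∀ a b c d e {u} → u ≡ a + (b + (c + (d + e))) → 4 * a ≤ h + g → 4 * e ≤ h + g → 4 * (b + (c + d)) ≤ h → u ≤ h + g
        arith a b c d e refl p q r = ℕ.*-cancelˡ-≤ 4 (lin (h + 2 * g) (ℕ.+-mono-≤ p (ℕ.+-mono-≤ q r)) (eq a b c d e h g))
          where
          eq : ∀ a b c d e h g → 4 * (a + (b + (c + (d + e)))) + (h + g + (h + g + h)) + (h + 2 * g) ≡
                                 4 * (h + g) + (4 * a + (4 * e + 4 * (b + (c + d))))
          eq = ℕ-solve
      Below? : Decidable (_<′ l)
      Below? x = x <′? l
      Above? : Decidable (λ x → l ℤ.+ + n ℤ.≤ x)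
      Above? x = l ℤ.+ + n ℤ.≤? x
      Y : List ℤ
      Y = sums A bs
      A≤ : length A ≤ # Below? A + (# Above? A + inside A l n)
      A≤ = ℕ.≤-trans (#-all Any? A (λ {x} _ → locate x))
        (ℕ.≤-trans (#-∪ Any? Below? Rest? A (λ _ → id)) (ℕ.+-monoʳ-≤ (# Below? A) (ℕ.≤-trans (#-∪ Rest? Above? Mid? A (λ _ → id)) (ℕ.+-monoʳ-≤ (# Above? A) mid))))
        where
        Mid? : Decidable (λ x → x ∈ ival l n)
        Mid? x = x ∈? ival l n
        Rest? : Decidable (λ x → l ℤ.+ + n ℤ.≤ x ⊎ x ∈ ival l n)
        Rest? x = Above? x ⊎-dec Mid? x
        Any? : Decidable (λ x → x <′ l ⊎ l ℤ.+ + n ℤ.≤ x ⊎ x ∈ ival l n)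
        Any? x = Below? x ⊎-dec Rest? x
        locate : ∀ x → x <′ l ⊎ l ℤ.+ + n ℤ.≤ x ⊎ x ∈ ival l n
        locate x with l ℤ.≤? x | l ℤ.+ + n ℤ.≤? x
        ... | no l≰x  | _      = inj₁ (≰⇒<′ l≰x)
        ... | yes _   | yes u≤x = inj₂ (inj₁ u≤x)
        ... | yes l≤x | no u≰x = inj₂ (inj₂ (∈-ival⁺ l≤x (≰⇒<′ u≰x)))
        mid : # Mid? A ≤ inside A l n
        mid = #-rel Mid? (_∈? A) _≡_ uA (λ x∈ x∈I → _ , x∈I , x∈ , refl) (λ { _ _ _ _ refl refl → refl })
      Y≥ : # Below? A + (# Above? A + # (Hit? A bs) (ival l (m + n))) ≤ length Y
      Y≥ = begin
        # Below? A + (# Above? A + # (Hit? A bs) (ival l (m + n)))        ≤⟨ ℕ.+-mono-≤ below (ℕ.+-mono-≤ above mid) ⟩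
        # Below? Y + (# Top? Y + # Mid? Y)                                ≤⟨ ℕ.+-monoʳ-≤ (# Below? Y) (#-disjoint Top? Mid? (λ x → ¬? (Below? x)) Y
                                                                               (λ _ u≤x x<l → <′-irrefl x<l (ℤ.≤-trans (ℤ.i≤i+j l (+ (m + n))) u≤x))
                                                                               (λ _ x∈ x<l → <′-irrefl x<l (proj₁ (∈-ival⁻ {l = l} {n = m + n} x∈)))
                                                                               (λ _ u≤x x∈ → <′-irrefl (proj₂ (∈-ival⁻ {l = l} {n = m + n} x∈)) u≤x)) ⟩
        # Below? Y + # (λ x → ¬? (Below? x)) Y                            ≡⟨ #-¬ Below? Y ⟩
        length Y                                                          ∎
        where
        open ℕ.≤-Reasoning
        Mid? : Decidable (λ x → x ∈ ival l (m + n))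
        Mid? x = x ∈? ival l (m + n)
        Top? : Decidable (λ x → l ℤ.+ + (m + n) ℤ.≤ x)
        Top? x = l ℤ.+ + (m + n) ℤ.≤? x
        below : # Below? A ≤ # Below? Y
        below = #-rel Below? Below? _≡_ uA (λ x∈ x< → _ , Hit-sums (hit-0 x∈) , x< , refl) (λ { _ _ _ _ refl refl → refl })
        above : # Above? A ≤ # Top? Y
        above = #-rel Above? Top? (λ x y → y ≡ x ℤ.+ + m) uA
          (λ {x} x∈ u≤x → x ℤ.+ + m , ∈-sums⁺ x∈ (there (here refl)) , linℤ u≤x (e x l (+ m) (+ n)) , refl)
          (λ {x} {x′} _ _ _ _ r r′ → ∙-cancelʳ (+ m) x x′ (trans (sym r) r′))
          where
          e : ∀ x l m n → l ℤ.+ (m ℤ.+ n) ℤ.- (x ℤ.+ m) ≡ l ℤ.+ n ℤ.- x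
          e = ℤ-solve
        mid : # (Hit? A bs) (ival l (m + n)) ≤ # Mid? Y
        mid = #-rel (Hit? A bs) Mid? _≡_ (ival-unique l (m + n)) (λ x∈ hit → _ , Hit-sums hit , x∈ , refl) (λ { _ _ _ _ refl refl → refl })
      -- A has n - h points in the stretch and B has m + 1 - g points, so losing h + g of the m + n
      -- targets is exactly affordable. Elements of A below the stretch are kept by 0, those above
      -- it are moved by m.
      count : length A + length B ≤ suc (length Y)
      count = arith (# Below? A) (# Above? A) (inside A l n) h n (length B) g m (# (Hit? A bs) (ival l (m + n))) lost
          A≤ (inside+holes A l n) ∣B∣+g≡ Y≥ (trans (#-¬ (Hit? A bs) (ival l (m + n))) (length-ival l (m + n))) lost≤h+g
        where
        arith : ∀ b t c h n B g m H d {A Y} → A ≤ b + (t + c) → c + h ≡ n → B + g ≡ suc m → b + (t + H) ≤ Y → H + d ≡ m + n → d ≤ h + g →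
                A + B ≤ suc Y
        arith b t c h n B g m H d {A} {Y} p refl e q e′ r = lin 0
          (ℕ.+-mono-≤ p (ℕ.+-mono-≤ (ℕ.≤-reflexive e) (ℕ.+-mono-≤ q (ℕ.+-mono-≤ (ℕ.≤-reflexive (sym e′)) r))))
          (eq b t c h B g m H d A Y)
          where
          eq : ∀ b t c h B g m H d A Y →
               A + B + (b + (t + c) + (suc m + (Y + (H + d + (h + g))))) + 0 ≡
               suc Y + (A + (B + g + (b + (t + H) + (m + (c + h) + d))))
          eq = ℕ-solve

-- The general case

div-exact : ∀ d .{{_ : NonZero d}} x → x ≈ 0ℤ [mod d ] → x ≡ (x /ℕ d) ℤ.* + d
div-exact d x x≈0 = trans (a≡a%ℕn+[a/ℕn]*n x d) (trans (cong (ℤ._+ (x /ℕ d) ℤ.* + d) r≡0) (ℤ.+-identityˡ _))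
  where
  r≡0 : + (x %ℕ d) ≡ 0ℤ
  r≡0 = ≈-window (≈-trans (≈-sym (by (x /ℕ d) (a≡a%ℕn+[a/ℕn]*n x d))) x≈0)
    (ℤ.+≤+ (n%ℕd<d x d)) (ℤ.+≤+ (ℕ.m≤n⇒m≤o+n (x %ℕ d) (>-nonZero⁻¹ d)))

-- If d divides every element of B, the residue classes of A modulo d do not interact in A + B, and
-- only the class of x₀ has to grow.
module Rescale (d : ℕ) .{{_ : NonZero d}} (x₀ : ℤ) (A B : List ℤ) (uA : Unique A) (uB : Unique B)
               (d∣B : ∀ {b} → b ∈ B → b ≈ 0ℤ [mod d ]) (0∈B : 0ℤ ∈ B) where

  embed : ℤ → ℤ
  embed z = x₀ ℤ.+ z ℤ.* + d

  embed-injective : ∀ {z z′} → embed z ≡ embed z′ → z ≡ z′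
  embed-injective {z} {z′} eq = ℤ.*-cancelʳ-≡ z z′ (+ d) {{ℤ.≢-nonZero (λ d≡0 → ≢-nonZero⁻¹ d (ℤ.+-injective d≡0))}} (∙-cancelˡ x₀ _ _ eq)

  Class? : Decidable (λ x → x ≈ x₀ [mod d ])
  Class? x = ≈-dec d x x₀

  A° B° : List ℤ
  A° = deduplicate ℤ._≟_ (map (λ x → (x ℤ.- x₀) /ℕ d) (filter Class? A))
  B° = deduplicate ℤ._≟_ (map (_/ℕ d) B)

  A°-unique : Unique A°
  A°-unique = deduplicate-! _

  B°-unique : Unique B°
  B°-unique = deduplicate-! _

  embed-quotient : ∀ {x} → x ≈ x₀ [mod d ] → x ≡ embed ((x ℤ.- x₀) /ℕ d)
  embed-quotient {x} x≈ = trans (e₁ x x₀) (cong (λ y → x₀ ℤ.+ y) (div-exact d (x ℤ.- x₀) (≈-by x≈ (e₂ x x₀))))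
    where
    e₁ : ∀ x y → x ≡ y ℤ.+ (x ℤ.- y)
    e₁ = ℤ-solve
    e₂ : ∀ x y → x ℤ.- y ℤ.- 0ℤ ≡ x ℤ.- y
    e₂ = ℤ-solve

  ∈-A°⁺ : ∀ {z} → embed z ∈ A → z ∈ A°
  ∈-A°⁺ {z} z∈ = subst (_∈ A°) (sym (embed-injective (embed-quotient class)))
    (∈-deduplicate⁺ ℤ._≟_ (∈-map⁺ _ (∈-filter⁺ Class? z∈ class)))
    where
    class : embed z ≈ x₀ [mod d ]
    class = by z refl

  ∈-A°⁻ : ∀ {z} → z ∈ A° → embed z ∈ A
  ∈-A°⁻ z∈ with ∈-map⁻ _ (∈-deduplicate⁻ ℤ._≟_ _ z∈)
  ... | x , x∈ , refl = let x∈A , x≈ = ∈-filter⁻ Class? {xs = A} x∈ in subst (_∈ A) (embed-quotient x≈) x∈A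

  ∈-B°⁺ : ∀ {b} → b ∈ B → b /ℕ d ∈ B°
  ∈-B°⁺ b∈ = ∈-deduplicate⁺ ℤ._≟_ (∈-map⁺ (_/ℕ d) b∈)

  ∈-B°⁻ : ∀ {z} → z ∈ B° → z ℤ.* + d ∈ B
  ∈-B°⁻ z∈ with ∈-map⁻ (_/ℕ d) (∈-deduplicate⁻ ℤ._≟_ _ z∈)
  ... | b , b∈ , refl = subst (_∈ B) (div-exact d b (d∣B b∈)) b∈

  ∣B∣≤∣B°∣ : length B ≤ length B°
  ∣B∣≤∣B°∣ = length-rel {R = λ b z → b ≡ z ℤ.* + d} uB (λ {b} b∈ → b /ℕ d , ∈-B°⁺ b∈ , div-exact d b (d∣B b∈)) (λ { _ _ refl refl → refl })

  rescale : ∀ bs° → bs° ⊆ B° → length A° + length B° ≤ suc (length (sums A° bs°)) →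
            ∃[ bs ] bs ⊆ B × length bs ≤ suc (length bs°) × length A + length B ≤ suc (length (sums A bs))
  rescale bs° sub le = bs , bs⊆B , s≤s (ℕ.≤-reflexive (List.length-map (ℤ._* + d) bs°)) ,
      arith _ _ _ _ _ _ A≤ ∣B∣≤∣B°∣ le Y≥
    where
    open ℕ.≤-Reasoning
    bs : List ℤ
    -- The extra 0 keeps the other residue classes of A in the sumset.
    bs = 0ℤ ∷ map (ℤ._* + d) bs°
    bs⊆B : bs ⊆ B
    bs⊆B (here refl) = 0∈B
    bs⊆B (there b∈) with ∈-map⁻ (ℤ._* + d) b∈
    ... | z , z∈ , refl = ∈-B°⁻ (sub z∈)
    Other? : Decidable (λ x → ¬ (x ≈ x₀ [mod d ]))
    Other? x = ¬? (Class? x)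
    Y : List ℤ
    Y = sums A bs
    A≤ : length A ≤ length A° + # Other? A
    A≤ = ℕ.≤-trans (ℕ.≤-reflexive (sym (#-¬ Class? A))) (ℕ.+-monoˡ-≤ (# Other? A) (ℕ.≤-trans class (#-≤length (_∈? A°) A°)))
      where
      class : # Class? A ≤ # (_∈? A°) A°
      class = #-rel Class? (_∈? A°) (λ x z → x ≡ embed z) uA
        (λ {x} x∈ x≈ → let z∈ = ∈-A°⁺ (subst (_∈ A) (embed-quotient x≈) x∈) in (x ℤ.- x₀) /ℕ d , z∈ , z∈ , embed-quotient x≈)
        (λ { _ _ _ _ refl refl → refl })
    Y≥ : length (sums A° bs°) + # Other? A ≤ length Y
    Y≥ = ℕ.≤-trans (ℕ.+-mono-≤ same other) (ℕ.≤-reflexive (#-¬ Class? Y))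
      where
      same : length (sums A° bs°) ≤ # Class? Y
      same = ℕ.≤-trans (#-all (_∈? sums A° bs°) (sums A° bs°) id)
        (#-rel _ Class? (λ z x → x ≡ embed z) (sums-unique A° bs°) (λ z∈ _ → image z∈) (λ _ _ _ _ r r′ → embed-injective (trans (sym r) r′)))
        where
        e : ∀ x a b d → (x ℤ.+ a ℤ.* d) ℤ.+ b ℤ.* d ≡ x ℤ.+ (a ℤ.+ b) ℤ.* d
        e = ℤ-solve
        image : ∀ {z} → z ∈ sums A° bs° → ∃[ x ] x ∈ Y × x ≈ x₀ [mod d ] × x ≡ embed z
        image z∈ with ∈-sums⁻ A° bs° z∈
        ... | a , b , a∈ , b∈ , refl = embed (a ℤ.+ b) ,
              subst (_∈ Y) (e x₀ a b (+ d)) (∈-sums⁺ (∈-A°⁻ a∈) (there (∈-map⁺ (ℤ._* + d) b∈))) , by (a ℤ.+ b) refl , refl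
      other : # Other? A ≤ # Other? Y
      other = #-rel Other? Other? _≡_ uA (λ {x} x∈ ¬c → x , subst (_∈ Y) (ℤ.+-identityʳ x) (∈-sums⁺ x∈ (here refl)) , ¬c , refl)
        (λ { _ _ _ _ refl refl → refl })
    arith : ∀ a b a° b° o y° {y} → a ≤ a° + o → b ≤ b° → a° + b° ≤ suc y° → y° + o ≤ y → a + b ≤ suc y
    arith a b a° b° o y° {y} p q r t = lin 0 (ℕ.+-mono-≤ p (ℕ.+-mono-≤ q (ℕ.+-mono-≤ r t))) (eq a b a° b° o y° y)
      where
      eq : ∀ a b a° b° o y° y → a + b + (a° + o + (b° + (suc y° + y))) + 0 ≡ suc y + (a + (b + (a° + b° + (y° + o))))
      eq = ℕ-solve

-- Choice of the constants and the normalised case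

depth-bound : ∀ n → (n + 2) * 2 ^ n ≤ 2 * 3 ^ n
depth-bound zero    = ℕ.≤-refl
depth-bound (suc n) = lin (n * 2 ^ n) (ℕ.*-monoʳ-≤ 3 (depth-bound n)) (eq n (2 ^ n) (3 ^ n))
  where
  eq : ∀ n x y → (suc n + 2) * (2 * x) + 3 * (2 * y) + n * x ≡ 2 * (3 * y) + 3 * ((n + 2) * x)
  eq = ℕ-solve

-- Bernoulli's (3/2)^n ≥ 1 + n / 2 at n = 8k.
depth-large : ∀ k → 4 * k * 2 ^ (8 * k) < 3 ^ (8 * k)
depth-large k = ℕ.*-cancelˡ-≤ 2 (ℕ.≤-trans (ℕ.≤-trans (ℕ.*-monoʳ-≤ 2 (ℕ.+-monoˡ-≤ (4 * k * 2 ^ (8 * k)) (ℕ.m^n>0 2 (8 * k))))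
    (ℕ.≤-reflexive (eq k (2 ^ (8 * k))))) (depth-bound (8 * k)))
  where
  eq : ∀ k x → 2 * (x + 4 * k * x) ≡ (8 * k + 2) * x
  eq = ℕ-solve

FewTranslates : ℕ → List ℤ → List ℤ → Set
FewTranslates c A B = ∃[ bs ] bs ⊆ B × length bs ≤ c × length A + length B ≤ suc (length (sums A bs))

-- The constants are variables subject to inequalities, so that no large numeral is ever evaluated.
-- Here f counts the elements used by `Finish`, and `Rescale` adds one more; M + 2 is what M greedy
-- steps after 0 and m may use.
module Bounded
  (N k p depth M f c : ℕ) .{{k≢0 : NonZero k}} .{{M≢0 : NonZero M}}
  (N-large : 33 * 4 ≤ N)
  (depth-large : 4 * k * 2 ^ depth < 3 ^ depth)
  (p-large : N * (2 ^ (2 + depth) * k) ≤ p)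
  (M-large : (N * 2 + 2) * k < M)
  (M-large₁ : N * (p * k) ≤ M)
  (M-large₂ : N * ((N * 2 + 2) * (k * k)) ≤ M)
  (f≡ : f ≡ 2 + (suc (8 * k) + 2) * suc (7 * ((suc (8 * k) + 2) * 4)))
  (c-large₁ : suc f ≤ c)
  (c-large₂ : M + 2 ≤ c)
  where

  Goal : List ℤ → List ℤ → Set
  Goal = FewTranslates c

  module _ (m : ℕ) {{m≢0 : NonZero m}} (A B : List ℤ) (uA : Unique A) (uB : Unique B)
           (B-range : ∀ {b} → b ∈ B → 0ℤ ℤ.≤ b × b ℤ.≤ + m) (0∈B : 0ℤ ∈ B) (m∈B : + m ∈ B)
           (B≤kA : length B ≤ k * length A) where

    Inner? : Decidable (_≢ + m)
    Inner? b = ¬? (b ℤ.≟ + m)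

    T : List ℤ
    T = filter Inner? B

    uT : Unique T
    uT = Unique.filter⁺ Inner? uB

    T⊆B : T ⊆ B
    T⊆B b∈ = proj₁ (∈-filter⁻ Inner? {xs = B} b∈)

    0∈T : 0ℤ ∈ T
    0∈T = ∈-filter⁺ Inner? 0∈B (λ 0≡m → ≢-nonZero⁻¹ m (sym (ℤ.+-injective 0≡m)))

    T-range : ∀ {b} → b ∈ T → 0ℤ ℤ.≤ b × b <′ + m
    T-range b∈ = let b∈B , b≢m = ∈-filter⁻ Inner? {xs = B} b∈
                     lo , hi = B-range b∈B
                 in lo , ℤ.i<j⇒suc[i]≤j (ℤ.≤∧≢⇒< hi b≢m)

    split : # (ℤ._≟ + m) B + length T ≡ length B
    split = trans (cong (_+_ (# (ℤ._≟ + m) B)) (sym (#-filter Inner? B))) (#-¬ (ℤ._≟ + m) B)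

    ∣B∣≤1+∣T∣ : length B ≤ suc (length T)
    ∣B∣≤1+∣T∣ = ℕ.≤-trans (ℕ.≤-reflexive (sym split)) (ℕ.+-monoˡ-≤ (length T) (ℕ.≤-trans
      (#-rel {ys = + m ∷ []} (ℤ._≟ + m) (ℤ._≟ + m) _≡_ uB (λ { _ refl → _ , here refl , refl , refl }) (λ { _ _ _ _ refl refl → refl }))
      (#-≤length (ℤ._≟ + m) (+ m ∷ []))))

    1+∣T∣≤∣B∣ : suc (length T) ≤ length B
    1+∣T∣≤∣B∣ = ℕ.≤-trans (ℕ.+-monoˡ-≤ (length T) (ℕ.≤-trans (#-all (ℤ._≟ + m) (+ m ∷ []) (λ { (here refl) → refl }))
      (#-rel {xs = + m ∷ []} (ℤ._≟ + m) (ℤ._≟ + m) _≡_ ([] ∷ []) (λ { (here refl) _ → _ , m∈B , refl , refl }) (λ { _ _ _ _ refl refl → refl }))))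
      (ℕ.≤-reflexive split)

    t≤ka : length T ≤ k * length A
    t≤ka = ℕ.≤-trans (ℕ.<⇒≤ 1+∣T∣≤∣B∣) B≤kA

    ends : List ℤ
    ends = 0ℤ ∷ + m ∷ []

    s : ℕ
    s = # (Res? m A) (residues m)

    A⊆sums : ∀ {bs} → ends ⊆ bs → ∀ {x} → x ∈ A → x ∈ sums A bs
    A⊆sums {bs} sub {x} x∈ = subst (_∈ sums A bs) (ℤ.+-identityʳ x) (∈-sums⁺ x∈ (sub (here refl)))

    A+m⊆sums : ∀ {bs} → ends ⊆ bs → ∀ {x} → x ∈ A → x ℤ.+ + m ∈ sums A bs
    A+m⊆sums sub x∈ = ∈-sums⁺ x∈ (sub (there (here refl)))

    a+s≤ : length A + s ≤ length (sums A ends)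
    a+s≤ = ℕ.≤-trans (ℕ.+-monoʳ-≤ (length A) (ℕ.≤-trans S≤X (ℕ.m≤m+n _ _))) L.a+χ+double≤∣Y∣
      where
      module L = Lifts m A (sums A ends) uA (A⊆sums id) (A+m⊆sums id)
      S≤X : s ≤ L.χ
      S≤X = #-mono _ _ (residues m) (λ _ (x , x∈ , x≈) → x , A⊆sums id x∈ , x≈)

    enough : ∀ {bs} → bs ⊆ B → length bs ≤ c → length A + length T ≤ length (sums A bs) → Goal A B
    enough sub len le = _ , sub , len , ℕ.≤-trans (ℕ.+-monoʳ-≤ (length A) ∣B∣≤1+∣T∣) (ℕ.≤-trans (ℕ.≤-reflexive (ℕ.+-suc _ _)) (s≤s le))

    ends⊆B : ends ⊆ B
    ends⊆B (here refl) = 0∈B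
    ends⊆B (there (here refl)) = m∈B

    module Structured (structure : ArithmeticStructure N k m A T) where

      open ArithmeticStructure structure

      d∣B : ∀ {b} → b ∈ B → b ≈ 0ℤ [mod d ]
      d∣B {b} b∈ = case b ℤ.≟ + m of λ where
        (yes refl) → by (+ m′) (trans (trans (cong (λ y → + y) m≡m′d) (ℤ.pos-* m′ d)) (sym (ℤ.+-identityˡ _)))
        (no b≢m)   → d∣T (∈-filter⁺ Inner? b∈ b≢m)

      open Rescale d x₀ A B uA uB d∣B 0∈B

      instance
        N≢0 : NonZero N
        N≢0 = >-nonZero (ℕ.≤-trans (s≤s z≤n) N-large)

        d-positive : ℤ.Positive (+ d)
        d-positive = ℤ.positive (ℤ.+<+ (>-nonZero⁻¹ d))

        +d≢0 : ℤ.NonZero (+ d)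
        +d≢0 = ℤ.≢-nonZero (λ d≡0 → ≢-nonZero⁻¹ d (ℤ.+-injective d≡0))

      B°-range : ∀ {z} → z ∈ B° → 0ℤ ℤ.≤ z × z ℤ.≤ + m′
      B°-range {z} z∈ = let lo , hi = B-range (∈-B°⁻ z∈) in
        ℤ.*-cancelʳ-≤-pos 0ℤ z (+ d) lo ,
        ℤ.*-cancelʳ-≤-pos z (+ m′) (+ d) (subst (z ℤ.* + d ℤ.≤_) (trans (cong (λ y → + y) m≡m′d) (ℤ.pos-* m′ d)) hi)

      z*d∈B⇒z∈B° : ∀ z → z ℤ.* + d ∈ B → z ∈ B°
      z*d∈B⇒z∈B° z z∈ = subst (_∈ B°) (ℤ.*-cancelʳ-≡ _ z (+ d) (sym (div-exact d (z ℤ.* + d) (d∣B z∈)))) (∈-B°⁺ z∈)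

      0∈B° : 0ℤ ∈ B°
      0∈B° = z*d∈B⇒z∈B° 0ℤ 0∈B

      m′∈B° : + m′ ∈ B°
      m′∈B° = z*d∈B⇒z∈B° (+ m′) (subst (_∈ B) (trans (cong (λ y → + y) m≡m′d) (ℤ.pos-* m′ d)) m∈B)

      ∣B°∣≤ : length B° ≤ suc m′
      ∣B°∣≤ = ℕ.≤-trans (⊆-length B°-unique (λ z∈ → let lo , hi = B°-range z∈ in ∈-ival⁺ {l = 0ℤ} {n = suc m′} lo (ℤ.+-monoʳ-≤ 1ℤ hi)))
        (ℕ.≤-reflexive (length-ival 0ℤ (suc m′)))

      g : ℕ
      g = suc m′ ∸ length B°

      g≤gaps : g ≤ gaps
      g≤gaps = ℕ.m≤n+o⇒m∸n≤o (suc m′) (length B°) (ℕ.≤-trans (s≤s m′≤t+gaps) (ℕ.+-monoˡ-≤ gaps (ℕ.≤-trans 1+∣T∣≤∣B∣ ∣B∣≤∣B°∣)))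

      -- In units of |A| / N, the terms 16 g and 4 cost 16 and 4, so N ≥ 20 suffices.
      a-large : 16 * g + 4 ≤ length A
      a-large = ℕ.*-cancelˡ-≤ N (arith N (length A) g gaps g≤gaps gaps-small 1-small (ℕ.*-monoˡ-≤ (length A) (ℕ.≤-trans (ℕ.m≤m+n 20 112) N-large)))
        where
        arith : ∀ N a g γ → g ≤ γ → N * γ ≤ a → N * 1 ≤ a → 20 * a ≤ N * a → N * (16 * g + 4) ≤ N * a
        arith N a g γ h₀ h₁ h₂ h₃ = lin 0 (ℕ.+-mono-≤ (ℕ.*-monoʳ-≤ 16 (ℕ.≤-trans (ℕ.*-monoʳ-≤ N h₀) h₁)) (ℕ.+-mono-≤ (ℕ.*-monoʳ-≤ 4 h₂) h₃)) (eq N a g)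
          where
          eq : ∀ N a g → N * (16 * g + 4) + (16 * a + (4 * a + N * a)) + 0 ≡ N * a + (16 * (N * g) + (4 * (N * 1) + 20 * a))
          eq = ℕ-solve

      m′≤2ka : m′ ≤ 2 * k * length A
      m′≤2ka = ℕ.≤-trans m′≤2t (ℕ.≤-trans (ℕ.*-monoʳ-≤ 2 t≤ka) (ℕ.≤-reflexive (sym (ℕ.*-assoc 2 k (length A)))))

      -- The scale is the size of all of `A`, although `A°` is a single class of it. The origin of
      -- 132 = 4 + 32 · 4: twice the 2|A| / N lost from the stretch, and 32 times the 4|A| / N
      -- holes.
      rich : Rich A° (length A) l n
      rich = ℕ.≤-trans (ℕ.+-monoʳ-≤ (length A) (ℕ.*-monoʳ-≤ 32 (#-mono _ _ (ival l n) (λ _ ∉A° z∈ → ∉A° (∈-A°⁺ z∈)))))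
        (ℕ.≤-trans (ℕ.*-cancelˡ-≤ N (arith N (length A) _ _ many few (ℕ.≤-trans (ℕ.≤-reflexive (sym (ℕ.*-assoc 33 4 (length A)))) (ℕ.*-monoˡ-≤ (length A) N-large))))
          (ℕ.*-monoʳ-≤ 2 (#-mono _ _ (ival l n) (λ _ → ∈-A°⁺))))
        where
        arith : ∀ N a c h → N * a ≤ N * c + 2 * a → N * h ≤ 4 * a → 33 * (4 * a) ≤ N * a → N * (a + 32 * h) ≤ N * (2 * c)
        arith N a c h p q r = lin 0 (ℕ.+-mono-≤ (ℕ.*-monoʳ-≤ 2 p) (ℕ.+-mono-≤ (ℕ.*-monoʳ-≤ 32 q) r)) (eq N a c h)
          where
          eq : ∀ N a c h → N * (a + 32 * h) + (2 * (N * c + 2 * a) + (32 * (4 * a) + N * a)) + 0 ≡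
                           N * (2 * c) + (2 * (N * a) + (32 * (N * h) + 33 * (4 * a)))
          eq = ℕ-solve

      a>0 : 0 < length A
      a>0 = ℕ.<-≤-trans (ℕ.m≤n⇒m≤o+n (16 * g) (s≤s z≤n)) a-large

      conclude : Goal A B
      conclude = finishing (trim A° {length A} n l n ℕ.≤-refl rich)
        where
        finishing : ∃[ l ] ∃[ n′ ] n′ ≤ n × Rich A° (length A) l n′ × DenseEnds A° l n′ → Goal A B
        finishing (l′ , n′ , n′≤n , r , dense) =
          let bs° , sub° , len° , le° = Finish.finish {k} {length A} {m′} {g} {A°} {B°} {l′} {n′} record
                { uA = A°-unique ; uB = B°-unique ; B-range = B°-range ; 0∈B = 0∈B° ; m∈B = m′∈B° ; ∣B∣+g≡ = ℕ.m+[n∸m]≡n ∣B°∣≤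
                ; n≤m = ℕ.≤-trans n′≤n n≤m′ ; rich = r ; ends = dense ; a>0 = a>0 ; a-large = a-large ; m≤2ka = m′≤2ka }
              bs′ , sub′ , len′ , le′ = rescale bs° sub° le°
          in bs′ , sub′ , ℕ.≤-trans len′ (ℕ.≤-trans (s≤s (subst (length bs° ≤_) (sym f≡) len°)) c-large₁) , le′

    bounded : Goal A B
    bounded = case length T ℕ.≤? s of λ where
        (yes t≤s) → enough ends⊆B (ℕ.≤-trans (ℕ.m≤n+m 2 M) c-large₂) (ℕ.≤-trans (ℕ.+-monoʳ-≤ (length A) t≤s) a+s≤)
        (no t≰s)  → grow (length T ∸ s) (sym (ℕ.m+[n∸m]≡n (ℕ.≰⇒≥ t≰s))) (ℕ.m<n⇒0<n∸m (ℕ.≰⇒> t≰s))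
      where
      grow : ∀ e → length T ≡ s + e → 0 < e → Goal A B
      grow e t≡s+e e>0 = from (greedy uA B M e M ends ends⊆B)
        where
        from : (∃[ bs ] bs ⊆ B × ends ⊆ bs × length bs ≤ M + 2 ×
                 (M * length (sums A ends) + M * e ≤ M * length (sums A bs) ⊎ (∀ {b} → b ∈ B → M * gain A (sums A bs) b ≤ e))) → Goal A B
        from (bs , sub , sup , len , inj₁ le) = enough sub short (begin
            length A + length T                ≡⟨ cong (_+_ (length A)) t≡s+e ⟩
            length A + (s + e)                 ≡⟨ ℕ.+-assoc (length A) s e ⟨
            length A + s + e                   ≤⟨ ℕ.+-monoˡ-≤ e a+s≤ ⟩
            length (sums A ends) + e           ≤⟨ ℕ.*-cancelˡ-≤ M (ℕ.≤-trans (ℕ.≤-reflexive (ℕ.*-distribˡ-+ M _ e)) le) ⟩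
            length (sums A bs)                 ∎)
          where
          open ℕ.≤-Reasoning
          short : length bs ≤ c
          short = ℕ.≤-trans len c-large₂
        from (bs , sub , sup , len , inj₂ sat) = case length A + length T ℕ.≤? length (sums A bs) of λ where
          (yes le) → enough sub (ℕ.≤-trans len c-large₂) le
          (no ¬le) → Structured.conclude
            (Saturated.structure record
              { m = m ; m≢0 = m≢0 ; k = k ; N = N ; p = p ; depth = depth ; M = M ; q = N * 2 ; e = e ; A = A ; T = T ; Y = sums A bs
              ; uA = uA ; uT = uT ; T-range = T-range ; 0∈T = 0∈T ; A⊆Y = A⊆sums sup ; A+m⊆Y = A+m⊆sums sup
              ; t≡s+e = t≡s+e ; e>0 = e>0 ; small = ℕ.≰⇒> ¬le ; saturated = λ b∈ → sat (T⊆B b∈) ; t≤ka = t≤ka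
              ; q≡2N = refl ; N-large = ℕ.≤-trans (ℕ.m≤m+n 16 116) N-large ; depth-large = depth-large ; p-large = p-large
              ; M-large = M-large ; M-large₁ = M-large₁ ; M-large₂ = M-large₂ })

Normalised : ℕ → ℕ → Set
Normalised k c = ∀ m {{_ : NonZero m}} A B → Unique A → Unique B →
  (∀ {b} → b ∈ B → 0ℤ ℤ.≤ b × b ℤ.≤ + m) → 0ℤ ∈ B → + m ∈ B → length B ≤ k * length A → FewTranslates c A B

bounded-translates : ∀ k .{{_ : NonZero k}} → ∃[ c ] 0 < c × Normalised k c
bounded-translates k = choose (33 * 4) ℕ.≤-refl
  where
  choose : ∀ N → 33 * 4 ≤ N → ∃[ c ] 0 < c × Normalised k c
  choose N N-large = from p M f (suc f + (M + 2)) {{_}} (s≤s z≤n) ℕ.≤-refl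
      (ℕ.m≤m+n (suc ((N * 2 + 2) * k)) (x + y))
      (ℕ.≤-trans (ℕ.m≤m+n x y) (ℕ.m≤n+m (x + y) (suc ((N * 2 + 2) * k))))
      (ℕ.≤-trans (ℕ.m≤n+m y x) (ℕ.m≤n+m (x + y) (suc ((N * 2 + 2) * k))))
      refl (ℕ.m≤m+n (suc f) (M + 2)) (ℕ.m≤n+m (M + 2) (suc f))
    where
    p x y M f : ℕ
    p = N * (2 ^ (2 + 8 * k) * k)
    x = N * (p * k)
    y = N * ((N * 2 + 2) * (k * k))
    -- A sum instead of a maximum: each of the three lower bounds required of M is one summand.
    M = suc ((N * 2 + 2) * k) + (x + y)
    f = 2 + (suc (8 * k) + 2) * suc (7 * ((suc (8 * k) + 2) * 4))
    from : ∀ p M f c {{_ : NonZero M}} → 0 < c → N * (2 ^ (2 + 8 * k) * k) ≤ p → (N * 2 + 2) * k < M → N * (p * k) ≤ M →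
           N * ((N * 2 + 2) * (k * k)) ≤ M → f ≡ 2 + (suc (8 * k) + 2) * suc (7 * ((suc (8 * k) + 2) * 4)) → suc f ≤ c → M + 2 ≤ c → ∃[ c ] 0 < c × Normalised k c
    from p M f c c>0 p-large M-large M-large₁ M-large₂ f≡ c-large₁ c-large₂ = c , c>0 ,
      Bounded.bounded N k p (8 * k) M f c N-large (depth-large k) p-large M-large M-large₁ M-large₂ f≡ c-large₁ c-large₂

few-translates : ∀ k .{{_ : NonZero k}} →
  ∃[ c ] 0 < c × (∀ A B → Unique A → Unique B → B ≢ [] → length B ≤ k * length A → FewTranslates c A B)
few-translates k = from (bounded-translates k)
  where
  from : (∃[ c ] 0 < c × Normalised k c) →
         ∃[ c ] 0 < c × (∀ A B → Unique A → Unique B → B ≢ [] → length B ≤ k * length A → FewTranslates c A B)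
  from (c , c>0 , normalised) = c , c>0 , general
    where
    general : ∀ A B → Unique A → Unique B → B ≢ [] → length B ≤ k * length A → FewTranslates c A B
    general A []      uA uB B≢[] le = contradiction refl B≢[]
    general A (b ∷ B′) uA uB _ le = extremes (minimum always? (here refl) (s≤s z≤n)) (maximum always? (here refl) (s≤s z≤n))
      where
      B : List ℤ
      B = b ∷ B′
      Always : ℤ → Set
      Always _ = 0 < 1
      always? : Decidable Always
      always? _ = yes (s≤s z≤n)
      Result : Set
      Result = FewTranslates c A B
      translate : ∀ x₀ m → x₀ ∈ B → x₀ ℤ.+ + m ∈ B → (∀ {x} → x ∈ B → x₀ ℤ.≤ x × x ℤ.≤ x₀ ℤ.+ + m) → Result
      -- The normalised case needs m as a modulus, so a one-point B is treated apart; its single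
      -- translate fits because 0 < c.
      translate x₀ zero x₀∈ _ range = x₀ ∷ [] , (λ { (here refl) → x₀∈ }) , c>0 ,
        ℕ.≤-trans (ℕ.+-mono-≤ ∣A∣≤ ∣B∣≤1) (ℕ.≤-reflexive (ℕ.+-comm _ 1))
        where
        ∣B∣≤1 : length B ≤ 1
        ∣B∣≤1 = ⊆-length {ys = x₀ ∷ []} uB (λ {x} x∈ → let lo , hi = range x∈ in here (ℤ.≤-antisym (subst (x ℤ.≤_) (ℤ.+-identityʳ x₀) hi) lo))
        ∣A∣≤ : length A ≤ length (sums A (x₀ ∷ []))
        ∣A∣≤ = length-rel {R = λ x y → y ≡ x ℤ.+ x₀} uA (λ x∈ → _ , ∈-sums⁺ x∈ (here refl) , refl)
          (λ {x} {x′} _ _ r r′ → ∙-cancelʳ x₀ x x′ (trans (sym r) r′))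
      translate x₀ (suc m) x₀∈ x₁∈ range = back (normalised (suc m) A B₀ uA
          (Unique.map⁺ (λ {x} {y} → ∙-cancelʳ (ℤ.- x₀) x y) uB) range₀
          (subst (_∈ B₀) (ℤ.+-inverseʳ x₀) (∈-map⁺ (ℤ._- x₀) x₀∈))
          (subst (_∈ B₀) (e x₀ (+ suc m)) (∈-map⁺ (ℤ._- x₀) x₁∈))
          (ℕ.≤-trans (ℕ.≤-reflexive (List.length-map (ℤ._- x₀) B)) le))
        where
        B₀ : List ℤ
        B₀ = map (ℤ._- x₀) B
        e : ∀ x m → x ℤ.+ m ℤ.- x ≡ m
        e = ℤ-solve
        e₁ : ∀ x x₀ → 0ℤ ℤ.- (x ℤ.- x₀) ≡ x₀ ℤ.- x
        e₁ = ℤ-solve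
        e₂ : ∀ x x₀ m → x ℤ.- x₀ ℤ.- m ≡ x ℤ.- (x₀ ℤ.+ m)
        e₂ = ℤ-solve
        e₃ : ∀ x x₀ → x ℤ.- x₀ ℤ.+ x₀ ≡ x
        e₃ = ℤ-solve
        range₀ : ∀ {y} → y ∈ B₀ → 0ℤ ℤ.≤ y × y ℤ.≤ + suc m
        range₀ y∈ with ∈-map⁻ (ℤ._- x₀) y∈
        ... | x , x∈ , refl = let lo , hi = range x∈ in linℤ lo (e₁ x x₀) , linℤ hi (e₂ x x₀ (+ suc m))
        back : FewTranslates c A B₀ → Result
        back (bs₀ , sub , len , le) = bs , bs⊆B , ℕ.≤-trans (ℕ.≤-reflexive (List.length-map (ℤ._+ x₀) bs₀)) len ,
            ℕ.≤-trans (ℕ.≤-reflexive (cong (_+_ (length A)) (sym (List.length-map (ℤ._- x₀) B)))) (ℕ.≤-trans le (s≤s shift))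
          where
          bs : List ℤ
          bs = map (ℤ._+ x₀) bs₀
          bs⊆B : bs ⊆ B
          bs⊆B y∈ with ∈-map⁻ (ℤ._+ x₀) y∈
          ... | y , y∈ , refl with ∈-map⁻ (ℤ._- x₀) (sub y∈)
          ...   | x , x∈ , refl = subst (_∈ B) (sym (e₃ x x₀)) x∈
          shift : length (sums A bs₀) ≤ length (sums A bs)
          shift = length-rel {R = λ x y → y ≡ x ℤ.+ x₀} (sums-unique A bs₀) image
            (λ {x} {x′} _ _ r r′ → ∙-cancelʳ x₀ x x′ (trans (sym r) r′))
            where
            image : ∀ {x} → x ∈ sums A bs₀ → ∃[ y ] y ∈ sums A bs × y ≡ x ℤ.+ x₀
            image x∈ with ∈-sums⁻ A bs₀ x∈
            ... | a , b , a∈ , b∈ , refl = a ℤ.+ (b ℤ.+ x₀) , ∈-sums⁺ a∈ (∈-map⁺ (ℤ._+ x₀) b∈) , sym (ℤ.+-assoc a b x₀)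
      extremes : ∃[ y ] y ∈ B × 0 < 1 × (∀ {z} → z ∈ B → 0 < 1 → y ℤ.≤ z) →
                 ∃[ y ] y ∈ B × 0 < 1 × (∀ {z} → z ∈ B → 0 < 1 → z ℤ.≤ y) → Result
      extremes (x₀ , x₀∈ , _ , least) (x₁ , x₁∈ , _ , greatest) =
        translate x₀ ℤ.∣ x₁ ℤ.- x₀ ∣ x₀∈ (subst (_∈ B) x₁≡ x₁∈) (λ {x} x∈ → least x∈ (s≤s z≤n) , subst (x ℤ.≤_) x₁≡ (greatest x∈ (s≤s z≤n)))
        where
        e : ∀ x y → y ≡ x ℤ.+ (y ℤ.- x)
        e = ℤ-solve
        x₁≡ : x₁ ≡ x₀ ℤ.+ + ℤ.∣ x₁ ℤ.- x₀ ∣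
        x₁≡ = trans (e x₀ x₁) (cong (λ y → x₀ ℤ.+ y) (sym (ℤ.0≤i⇒+∣i∣≡i (ℤ.i≤j⇒0≤j-i (least x₁∈ (s≤s z≤n))))))

-- From α to a natural bound, and the theorem

ℕ→ℚ-< : ∀ q a b → 0ℚ ℚ.< q → a * ℚ.denominatorℕ q < b → ℕ→ℚ a ℚ.< q ℚ.* ℕ→ℚ b
ℕ→ℚ-< q@(mkℚ (+ zero)  _ _) a b (ℚ.*<* (ℤ.+<+ ())) _
ℕ→ℚ-< q@(mkℚ -[1+ _ ]  _ _) a b (ℚ.*<* ()) _
ℕ→ℚ-< q@(mkℚ (+ suc n) d _) a b _ ad<b = ℚ.toℚᵘ-cancel-<
  (ℚᵘ.<-respˡ-≃ (ℚᵘ.≃-sym (ℚ.toℚᵘ-fromℚᵘ (mkℚᵘ (+ a) 0)))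
    (ℚᵘ.<-respʳ-≃ (ℚᵘ.≃-sym (ℚᵘ.≃-trans (ℚ.toℚᵘ-homo-* q (ℕ→ℚ b)) (ℚᵘ.*-cong ℚᵘ.≃-refl (ℚ.toℚᵘ-fromℚᵘ (mkℚᵘ (+ b) 0)))))
      (ℚᵘ.*<* (subst₂ ℤ._<_ (ℤ.pos-* a (suc d * 1)) (trans (cong +_ (sym (ℕ.*-identityʳ (suc n * b)))) (trans (ℤ.pos-* (suc n * b) 1) (cong (ℤ._* 1ℤ) (ℤ.pos-* (suc n) b))))
        (ℤ.+<+ (ℕ.<-≤-trans (subst (λ d → a * d < b) (sym (ℕ.*-identityʳ (suc d))) ad<b) (ℕ.m≤m+n b (n * b))))))))

-- A rational q with 0 < q < α is at least the reciprocal of its denominator. If b exceeded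
-- denominator times a, then a < q b would place a strictly below α b, and hence below itself.
archimedean : ∀ α → 0ℝ <ℝ α → ∃[ k ] (∀ a b → fromℕ a ≥ℝ α · b → b ≤ suc k * a)
archimedean α (q , 0<q , Lq) = ℚ.ℚ.denominator-1 q , bound
  where
  bound : ∀ a b → fromℕ a ≥ℝ α · b → b ≤ ℚ.denominatorℕ q * a
  bound a b a≥αb = ℕ.≮⇒≥ λ lt → ℚ.<-irrefl refl
    (a≥αb (q , Lq , ℕ→ℚ-< q a b 0<q (subst (_< b) (ℕ.*-comm (ℚ.denominatorℕ q) a) lt)))

-- Fills the remaining positions with a fixed element of `B`: repetitions are allowed, and further
-- elements only enlarge the sumset. A list longer than c would be truncated, which the length bound
-- in `⊆-pad` excludes.
pad : ∀ {c} → ℤ → List ℤ → Fin c → ℤ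
pad b []       i       = b
pad b (x ∷ xs) zero    = x
pad b (x ∷ xs) (suc i) = pad b xs i

pad-∈ : ∀ {c b B} bs → b ∈ B → bs ⊆ B → ∀ (i : Fin c) → pad b bs i ∈ B
pad-∈ []       b∈ sub i       = b∈
pad-∈ (x ∷ xs) b∈ sub zero    = sub (here refl)
pad-∈ (x ∷ xs) b∈ sub (suc i) = pad-∈ xs b∈ (sub ∘ there) i

⊆-pad : ∀ {c} b bs → length bs ≤ c → bs ⊆ tabulate (pad {c} b bs)
⊆-pad b (x ∷ xs) (s≤s le) (here refl) = here refl
⊆-pad b (x ∷ xs) (s≤s le) (there y∈)  = there (⊆-pad b xs le y∈)

theorem2 : ∀ (α : ℝ) → 0ℝ <ℝ α →
    ∃[ c ] 0 < c ×
    (∀ (A B : FiniteSubset) → A ≢ [] → B ≢ [] →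
    fromℕ ∣ A ∣ₛ ≥ℝ α · ∣ B ∣ₛ →
    ∃[ b ] (∀ (i : Fin c) → b i ∈ B) ×
    ∣ A +ₛ tabulate b ∣ₛ ≥ ∣ A ∣ₛ + ∣ B ∣ₛ ∸ 1)
theorem2 α α>0 = let k , bound = archimedean α α>0 in from k bound (few-translates (suc k))
  where
  Statement : ℕ → Set
  Statement c = ∀ (A B : FiniteSubset) → A ≢ [] → B ≢ [] → fromℕ ∣ A ∣ₛ ≥ℝ α · ∣ B ∣ₛ →
    ∃[ b ] (∀ (i : Fin c) → b i ∈ B) × ∣ A +ₛ tabulate b ∣ₛ ≥ ∣ A ∣ₛ + ∣ B ∣ₛ ∸ 1
  from : ∀ k → (∀ a b → fromℕ a ≥ℝ α · b → b ≤ suc k * a) →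
         ∃[ c ] 0 < c × (∀ A B → Unique A → Unique B → B ≢ [] → length B ≤ suc k * length A → FewTranslates c A B) →
         ∃[ c ] 0 < c × Statement c
  from k bound (c , c>0 , few) = c , c>0 , solution
    where
    solution : Statement c
    solution A []         _ B≢[] _  = contradiction refl B≢[]
    solution A (b₀ ∷ B′) _ _    A≥αB = choice (few (deduplicate ℤ._≟_ A) (deduplicate ℤ._≟_ B)
        (deduplicate-! A) (deduplicate-! B) (λ ()) (bound ∣ A ∣ₛ ∣ B ∣ₛ A≥αB))
      where
      B : FiniteSubset
      B = b₀ ∷ B′
      choice : FewTranslates c (deduplicate ℤ._≟_ A) (deduplicate ℤ._≟_ B) →
               ∃[ b ] (∀ (i : Fin c) → b i ∈ B) × ∣ A +ₛ tabulate b ∣ₛ ≥ ∣ A ∣ₛ + ∣ B ∣ₛ ∸ 1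
      choice (bs , sub , len , le) = pad b₀ bs , pad-∈ bs (here refl) (∈-deduplicate⁻ ℤ._≟_ B ∘ sub) ,
        ℕ.≤-trans (ℕ.∸-monoˡ-≤ 1 le) (⊆-length (sums-unique (deduplicate ℤ._≟_ A) bs) image)
        where
        image : sums (deduplicate ℤ._≟_ A) bs ⊆ sums A (tabulate (pad {c} b₀ bs))
        image x∈ with ∈-sums⁻ (deduplicate ℤ._≟_ A) bs x∈
        ... | a , b , a∈ , b∈ , refl = ∈-sums⁺ (∈-deduplicate⁻ ℤ._≟_ A a∈) (⊆-pad b₀ bs len b∈)
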